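{- Let $\gamma(t)=1+\gamma_1t+\gamma_2t^2$ be a polynomial with integer coefficients $\gamma_1,\gamma_2$, and assume that every root of $\gamma(t)-t$ is real and negative. Then $h(t)=(1+t)^4\gamma\!\left(\frac{t}{(1+t)^2}\right)$ is the h-polynomial of a flag simplicial complex triangulating the $3$-sphere.
   Context: Simplicial complexes contain the empty face; $\#\sigma$ denotes the number of vertices of $\sigma$. Flag: every set of pairwise adjacent vertices is a face. f-polynomial $f_X(t)=\sum_{\sigma\in X}t^{\#\sigma}$. For $X$ triangulating $S^3$, the h-polynomial $h_X$ is defined by $(1+t)^4h_X(\frac1{1+t})=t^4f_X(\frac1t)$. -}

module Defs where

open import Algebra.Bundles.Raw using (RawMonoid; RawRing)
open import Algebra.Definitions.RawMonoid using (sum)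
open import Data.Fin using (Fin)
open import Data.Fin.Subset using (Subset; inside; outside; ⁅_⁆; _∈_; _⊆_; _∪_; ∣_∣) renaming (⊥ to ∅)
open import Data.Integer using (ℤ)
open import Data.List using (List; []; _∷_; _++_; map; filter; foldr)
open import Data.Nat as ℕ using (ℕ; zero; suc)
import Data.Nat.Properties as ℕₚ
open import Data.Product using (Σ; Σ-syntax; ∃; _×_; _,_; proj₁; proj₂)
open import Data.Rational as ℚ using (ℚ; 0ℚ; 1ℚ; ½)
import Data.Rational.Properties as ℚₚ
open import Data.Rational.Solver using (module +-*-Solver)
open import Data.Vec using ([]; _∷_)
open import Data.Vec.Functional using (Vector)
open import Function.Bundles using (Inverse)
open import Level using (0ℓ)
open import Relation.Binary.Bundles using (Setoid)
open import Relation.Binary.PropositionalEquality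
  using (_≡_; _≢_; refl; sym; trans; cong; subst)
open import Relation.Nullary using (¬_)
open import Relation.Unary using (Pred; Decidable)

import Algebra.Definitions.RawSemiring (RawRing.rawSemiring ℚ.+-*-rawRing) as ℚ^
open ℚ^ public using (_^_)

private
  abstract
    half+half : ∀ ε → ½ ℚ.* ε ℚ.+ ½ ℚ.* ε ≡ ε
    half+half ε = trans (sym (ℚₚ.*-distribʳ-+ ε ½ ½)) (ℚₚ.*-identityˡ ε)

    0<half : ∀ {ε} → 0ℚ ℚ.< ε → 0ℚ ℚ.< ½ ℚ.* ε
    0<half {ε} 0<ε = subst (ℚ._< ½ ℚ.* ε) (ℚₚ.*-zeroʳ ½) (ℚₚ.*-monoʳ-<-pos ½ 0<ε)

    swap-∣-∣ : ∀ a b → ℚ.∣ a ℚ.- b ∣ ≡ ℚ.∣ b ℚ.- a ∣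
    swap-∣-∣ a b = trans (cong ℚ.∣_∣ lem) (ℚₚ.∣-p∣≡∣p∣ (b ℚ.- a))
      where
      open +-*-Solver
      lem : a ℚ.- b ≡ ℚ.- (b ℚ.- a)
      lem = solve 2 (λ x y → x :- y := :- (y :- x)) refl a b

    split-∣-∣ : ∀ {p q r ε} → p ≡ q ℚ.+ r → ℚ.∣ q ∣ ℚ.< ½ ℚ.* ε → ℚ.∣ r ∣ ℚ.< ½ ℚ.* ε → ℚ.∣ p ∣ ℚ.< ε
    split-∣-∣ {p} {q} {r} {ε} refl u v =
      ℚₚ.≤-<-trans (ℚₚ.∣p+q∣≤∣p∣+∣q∣ q r) (subst (ℚ.∣ q ∣ ℚ.+ ℚ.∣ r ∣ ℚ.<_) (half+half ε) (ℚₚ.+-mono-< u v))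

    sum-∣-∣ : ∀ a b a′ b′ {ε} → ℚ.∣ a ℚ.- a′ ∣ ℚ.< ½ ℚ.* ε → ℚ.∣ b ℚ.- b′ ∣ ℚ.< ½ ℚ.* ε →
              ℚ.∣ (a ℚ.+ b) ℚ.- (a′ ℚ.+ b′) ∣ ℚ.< ε
    sum-∣-∣ a b a′ b′ = split-∣-∣ (solve 4 (λ a b c d → (a :+ b) :- (c :+ d) := (a :- c) :+ (b :- d)) refl a b a′ b′)
      where open +-*-Solver

    triangle-∣-∣ : ∀ a b c {ε} → ℚ.∣ a ℚ.- b ∣ ℚ.< ½ ℚ.* ε → ℚ.∣ b ℚ.- c ∣ ℚ.< ½ ℚ.* ε → ℚ.∣ a ℚ.- c ∣ ℚ.< ε
    triangle-∣-∣ a b c = split-∣-∣ (solve 3 (λ a b c → a :- c := (a :- b) :+ (b :- c)) refl a b c)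
      where open +-*-Solver

    neg-∣-∣ : ∀ a b → ℚ.∣ (ℚ.- a) ℚ.- (ℚ.- b) ∣ ≡ ℚ.∣ a ℚ.- b ∣
    neg-∣-∣ a b = trans (cong ℚ.∣_∣ (solve 2 (λ a b → (:- a) :- (:- b) := b :- a) refl a b)) (swap-∣-∣ b a)
      where open +-*-Solver

    self-∣-∣ : ∀ a → ℚ.∣ a ℚ.- a ∣ ≡ 0ℚ
    self-∣-∣ a = cong ℚ.∣_∣ (ℚₚ.+-inverseʳ a)

    bound-∣-∣ : ∀ a b → ℚ.∣ a ℚ.- b ∣ ℚ.< 1ℚ → ℚ.∣ a ∣ ℚ.≤ ℚ.∣ b ∣ ℚ.+ 1ℚ
    bound-∣-∣ a b h = ℚₚ.≤-trans
      (subst (λ z → ℚ.∣ z ∣ ℚ.≤ ℚ.∣ b ∣ ℚ.+ ℚ.∣ a ℚ.- b ∣)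
             (solve 2 (λ a b → b :+ (a :- b) := a) refl a b)
             (ℚₚ.∣p+q∣≤∣p∣+∣q∣ b (a ℚ.- b)))
      (ℚₚ.+-monoʳ-≤ ℚ.∣ b ∣ (ℚₚ.<⇒≤ h))
      where open +-*-Solver

    0<∣∣+1 : ∀ a → 0ℚ ℚ.< ℚ.∣ a ∣ ℚ.+ 1ℚ
    0<∣∣+1 a = subst (ℚ._< ℚ.∣ a ∣ ℚ.+ 1ℚ) (ℚₚ.+-identityˡ 0ℚ)
                 (ℚₚ.+-mono-≤-< (ℚₚ.0≤∣p∣ a) (ℚₚ.positive⁻¹ 1ℚ))

    shrink : ∀ A ε → 0ℚ ℚ.< A → 0ℚ ℚ.< ε → ∃ λ δ → 0ℚ ℚ.< δ × A ℚ.* δ ≡ ε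
    shrink A ε 0<A 0<ε = 1/A ℚ.* ε , 0<δ , eq
      where
      instance
        A-pos : ℚ.Positive A
        A-pos = ℚ.positive 0<A
        A-nz : ℚ.NonZero A
        A-nz = ℚₚ.pos⇒nonZero A
      1/A : ℚ
      1/A = ℚ.1/ A
      instance
        1/A-pos : ℚ.Positive 1/A
        1/A-pos = ℚₚ.1/pos⇒pos A
      0<δ : 0ℚ ℚ.< 1/A ℚ.* ε
      0<δ = subst (ℚ._< 1/A ℚ.* ε) (ℚₚ.*-zeroʳ 1/A) (ℚₚ.*-monoʳ-<-pos 1/A 0<ε)
      eq : A ℚ.* (1/A ℚ.* ε) ≡ ε
      eq = trans (sym (ℚₚ.*-assoc A 1/A ε)) (trans (cong (ℚ._* ε) (ℚₚ.*-inverseʳ A)) (ℚₚ.*-identityˡ ε))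

    prod-< : ∀ {A δ ε} p q → 0ℚ ℚ.< A → ℚ.∣ p ∣ ℚ.≤ A → ℚ.∣ q ∣ ℚ.< δ → A ℚ.* δ ≡ ε → ℚ.∣ p ℚ.* q ∣ ℚ.< ε
    prod-< {A} {δ} p q 0<A u v refl = subst (ℚ._< A ℚ.* δ) (sym (ℚₚ.∣p*q∣≡∣p∣*∣q∣ p q))
      (ℚₚ.≤-<-trans (ℚₚ.*-monoʳ-≤-nonNeg ℚ.∣ q ∣ {{ℚₚ.∣-∣-nonNeg q}} u)
                    (ℚₚ.*-monoʳ-<-pos A {{ℚ.positive 0<A}} v))

    mul-∣-∣ : ∀ a b a′ b′ {ε} → ℚ.∣ a ℚ.* (b ℚ.- b′) ∣ ℚ.< ½ ℚ.* ε → ℚ.∣ b′ ℚ.* (a ℚ.- a′) ∣ ℚ.< ½ ℚ.* ε →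
              ℚ.∣ (a ℚ.* b) ℚ.- (a′ ℚ.* b′) ∣ ℚ.< ε
    mul-∣-∣ a b a′ b′ =
      split-∣-∣ (solve 4 (λ a b c d → (a :* b) :- (c :* d) := (a :* (b :- d)) :+ (d :* (a :- c))) refl a b a′ b′)
      where open +-*-Solver

Cauchy : (ℕ → ℚ) → Set
Cauchy x = ∀ ε → 0ℚ ℚ.< ε → ∃ λ N → ∀ m n → N ℕ.≤ m → N ℕ.≤ n → ℚ.∣ x m ℚ.- x n ∣ ℚ.< ε

-- Real numbers are Cauchy sequences up to the setoid equality _≈_ below.
record ℝ : Set where
  constructor mkℝ
  field
    seq    : ℕ → ℚ
    cauchy : Cauchy seq

open ℝ public

infix  4 _≈_ _<_ _≤_
infixl 6 _+_
infixl 7 _*_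
infix  8 -_

_≈_ : ℝ → ℝ → Set
x ≈ y = ∀ ε → 0ℚ ℚ.< ε → ∃ λ N → ∀ n → N ℕ.≤ n → ℚ.∣ seq x n ℚ.- seq y n ∣ ℚ.< ε

_<_ : ℝ → ℝ → Set
x < y = Σ[ ε ∈ ℚ ] 0ℚ ℚ.< ε × ∃ λ N → ∀ n → N ℕ.≤ n → seq x n ℚ.+ ε ℚ.< seq y n

_≤_ : ℝ → ℝ → Set
x ≤ y = ¬ (y < x)

private
  abstract
    const-cauchy : ∀ q → Cauchy (λ _ → q)
    const-cauchy q ε 0<ε = 0 , λ _ _ _ _ → subst (ℚ._< ε) (sym (self-∣-∣ q)) 0<ε

    +-cauchy : ∀ {x y} → Cauchy x → Cauchy y → Cauchy (λ n → x n ℚ.+ y n)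
    +-cauchy {x} {y} cx cy ε 0<ε with cx (½ ℚ.* ε) (0<half 0<ε) | cy (½ ℚ.* ε) (0<half 0<ε)
    ... | M , p | N , q = M ℕ.⊔ N , λ m n u v → sum-∣-∣ (x m) (y m) (x n) (y n)
      (p m n (ℕₚ.m⊔n≤o⇒m≤o M N u) (ℕₚ.m⊔n≤o⇒m≤o M N v))
      (q m n (ℕₚ.m⊔n≤o⇒n≤o M N u) (ℕₚ.m⊔n≤o⇒n≤o M N v))

    neg-cauchy : ∀ {x} → Cauchy x → Cauchy (λ n → ℚ.- x n)
    neg-cauchy {x} cx ε 0<ε with cx ε 0<ε
    ... | N , p = N , λ m n u v → subst (ℚ._< ε) (sym (neg-∣-∣ (x m) (x n))) (p m n u v)

    *-cauchy : ∀ {x y} → Cauchy x → Cauchy y → Cauchy (λ n → x n ℚ.* y n)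
    *-cauchy {x} {y} cx cy ε 0<ε
      with cx 1ℚ (ℚₚ.positive⁻¹ 1ℚ) | cy 1ℚ (ℚₚ.positive⁻¹ 1ℚ)
    ... | K , bx | L , by
      with shrink (ℚ.∣ x K ∣ ℚ.+ 1ℚ) (½ ℚ.* ε) (0<∣∣+1 (x K)) (0<half 0<ε)
         | shrink (ℚ.∣ y L ∣ ℚ.+ 1ℚ) (½ ℚ.* ε) (0<∣∣+1 (y L)) (0<half 0<ε)
    ... | δ , 0<δ , eδ | η , 0<η , eη with cy δ 0<δ | cx η 0<η
    ... | M , p | N , q = (K ℕ.⊔ L) ℕ.⊔ (M ℕ.⊔ N) , λ m n u v → mul-∣-∣ (x m) (y m) (x n) (y n)
      (prod-< (x m) (y m ℚ.- y n) (0<∣∣+1 (x K)) (bound-∣-∣ (x m) (x K) (bx m K (K≤ u) ℕₚ.≤-refl)) (p m n (M≤ u) (M≤ v)) eδ)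
      (prod-< (y n) (x m ℚ.- x n) (0<∣∣+1 (y L)) (bound-∣-∣ (y n) (y L) (by n L (L≤ v) ℕₚ.≤-refl)) (q m n (N≤ u) (N≤ v)) eη)
      where
      K≤ : ∀ {o} → (K ℕ.⊔ L) ℕ.⊔ (M ℕ.⊔ N) ℕ.≤ o → K ℕ.≤ o
      K≤ h = ℕₚ.m⊔n≤o⇒m≤o K L (ℕₚ.m⊔n≤o⇒m≤o (K ℕ.⊔ L) (M ℕ.⊔ N) h)
      L≤ : ∀ {o} → (K ℕ.⊔ L) ℕ.⊔ (M ℕ.⊔ N) ℕ.≤ o → L ℕ.≤ o
      L≤ h = ℕₚ.m⊔n≤o⇒n≤o K L (ℕₚ.m⊔n≤o⇒m≤o (K ℕ.⊔ L) (M ℕ.⊔ N) h)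
      M≤ : ∀ {o} → (K ℕ.⊔ L) ℕ.⊔ (M ℕ.⊔ N) ℕ.≤ o → M ℕ.≤ o
      M≤ h = ℕₚ.m⊔n≤o⇒m≤o M N (ℕₚ.m⊔n≤o⇒n≤o (K ℕ.⊔ L) (M ℕ.⊔ N) h)
      N≤ : ∀ {o} → (K ℕ.⊔ L) ℕ.⊔ (M ℕ.⊔ N) ℕ.≤ o → N ℕ.≤ o
      N≤ h = ℕₚ.m⊔n≤o⇒n≤o M N (ℕₚ.m⊔n≤o⇒n≤o (K ℕ.⊔ L) (M ℕ.⊔ N) h)

  abstract
    ≈-refl : ∀ {x} → x ≈ x
    ≈-refl {x} ε 0<ε = 0 , λ n _ → subst (ℚ._< ε) (sym (self-∣-∣ (seq x n))) 0<ε

    ≈-sym : ∀ {x y} → x ≈ y → y ≈ x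
    ≈-sym {x} {y} h ε 0<ε with h ε 0<ε
    ... | N , p = N , λ n u → subst (ℚ._< ε) (swap-∣-∣ (seq x n) (seq y n)) (p n u)

    ≈-trans : ∀ {x y z} → x ≈ y → y ≈ z → x ≈ z
    ≈-trans {x} {y} {z} h k ε 0<ε with h (½ ℚ.* ε) (0<half 0<ε) | k (½ ℚ.* ε) (0<half 0<ε)
    ... | M , p | N , q = M ℕ.⊔ N , λ n u → triangle-∣-∣ (seq x n) (seq y n) (seq z n)
      (p n (ℕₚ.m⊔n≤o⇒m≤o M N u)) (q n (ℕₚ.m⊔n≤o⇒n≤o M N u))

fromℚ : ℚ → ℝ
fromℚ q = mkℝ (λ _ → q) (const-cauchy q)

fromℤ : ℤ → ℝ
fromℤ i = fromℚ (i ℚ./ 1)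

0ℝ 1ℝ : ℝ
0ℝ = fromℚ 0ℚ
1ℝ = fromℚ 1ℚ

_+_ : ℝ → ℝ → ℝ
x + y = mkℝ (λ n → seq x n ℚ.+ seq y n) (+-cauchy {seq x} {seq y} (cauchy x) (cauchy y))

_*_ : ℝ → ℝ → ℝ
x * y = mkℝ (λ n → seq x n ℚ.* seq y n) (*-cauchy {seq x} {seq y} (cauchy x) (cauchy y))

-_ : ℝ → ℝ
- x = mkℝ (λ n → ℚ.- seq x n) (neg-cauchy {seq x} (cauchy x))

ℝ-setoid : Setoid 0ℓ 0ℓ
ℝ-setoid = record
  { Carrier = ℝ
  ; _≈_ = _≈_
  ; isEquivalence = record
    { refl = λ {x} → ≈-refl {x}
    ; sym = λ {x} {y} → ≈-sym {x} {y}
    ; trans = λ {x} {y} {z} → ≈-trans {x} {y} {z}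
    }
  }

+-rawMonoid : RawMonoid 0ℓ 0ℓ
+-rawMonoid = record { Carrier = ℝ ; _≈_ = _≈_ ; _∙_ = _+_ ; ε = 0ℝ }

Σℝ : ∀ {n} → Vector ℝ n → ℝ
Σℝ = sum +-rawMonoid

record ℂ : Set where
  constructor _+i_
  field
    re im : ℝ

open ℂ public

ℂ-rawRing : RawRing 0ℓ 0ℓ
ℂ-rawRing = record
  { Carrier = ℂ
  ; _≈_ = λ z w → re z ≈ re w × im z ≈ im w
  ; _+_ = λ z w → (re z + re w) +i (im z + im w)
  ; _*_ = λ z w → (re z * re w + - (im z * im w)) +i (re z * im w + im z * re w)
  ; -_ = λ z → (- re z) +i (- im z)
  ; 0# = 0ℝ +i 0ℝ
  ; 1# = 1ℝ +i 0ℝ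
  }

ℤ→ℂ : ℤ → ℂ
ℤ→ℂ i = fromℤ i +i 0ℝ

-- Coefficients, constant term first.
Polynomial : Set
Polynomial = List ℤ

eval : ∀ {c ℓ} (R : RawRing c ℓ) → (ℤ → RawRing.Carrier R) → Polynomial → RawRing.Carrier R → RawRing.Carrier R
eval R ι p x = foldr (λ a y → ι a R.+ x R.* y) R.0# p
  where module R = RawRing R

evalℚ : Polynomial → ℚ → ℚ
evalℚ = eval ℚ.+-*-rawRing (λ i → i ℚ./ 1)

evalℂ : Polynomial → ℂ → ℂ
evalℂ = eval ℂ-rawRing ℤ→ℂ

IsRootOf[_-t] : Polynomial → ℂ → Set
IsRootOf[ p -t] z = (evalℂ p z C.+ C.- z) C.≈ C.0#
  where module C = RawRing ℂ-rawRing

-- h(t) = (1+t)⁴ p(t/(1+t)²). An identity of rational functions is stated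
-- as equality of values wherever the denominators do not vanish; since ℚ is
-- infinite, this determines the polynomial h.
Is[1+t]⁴p[t/[1+t]²] : (h p : Polynomial) → Set
Is[1+t]⁴p[t/[1+t]²] h p = ∀ (t : ℚ) .{{_ : ℚ.NonZero ((1ℚ ℚ.+ t) ^ 2)}} →
  evalℚ h t ≡ (1ℚ ℚ.+ t) ^ 4 ℚ.* evalℚ p (t ℚ.÷ ((1ℚ ℚ.+ t) ^ 2))

-- Finite complexes whose vertices are exactly the elements of Fin n; a
-- triangulation of a compact space is necessarily finite.
record SimplicialComplex (n : ℕ) : Set₁ where
  field
    Face        : Pred (Subset n) 0ℓ
    face?       : Decidable Face
    empty-face  : Face ∅
    vertex-face : ∀ v → Face ⁅ v ⁆
    down-closed : ∀ {σ τ} → σ ⊆ τ → Face τ → Face σ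

allSubsets : ∀ n → List (Subset n)
allSubsets zero    = [] ∷ []
allSubsets (suc n) = map (outside ∷_) (allSubsets n) ++ map (inside ∷_) (allSubsets n)

module _ {n : ℕ} (X : SimplicialComplex n) where
  open SimplicialComplex X

  Adjacent : Fin n → Fin n → Set
  Adjacent u v = u ≢ v × Face (⁅ u ⁆ ∪ ⁅ v ⁆)

  Flag : Set
  Flag = ∀ σ → (∀ u v → u ∈ σ → v ∈ σ → u ≢ v → Adjacent u v) → Face σ

  faces : List (Subset n)
  faces = filter face? (allSubsets n)

  fPolynomial : ℚ → ℚ
  fPolynomial t = foldr ℚ._+_ 0ℚ (map (λ σ → t ^ ∣ σ ∣) faces)

  -- (1+t)⁴ h(1/(1+t)) = t⁴ f(1/t); the exponent 4 is that of complexes of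
  -- dimension 3.
  IsHPolynomial : Polynomial → Set
  IsHPolynomial h = ∀ (t : ℚ) .{{_ : ℚ.NonZero t}} .{{_ : ℚ.NonZero (1ℚ ℚ.+ t)}} →
    (1ℚ ℚ.+ t) ^ 4 ℚ.* evalℚ h (ℚ.1/ (1ℚ ℚ.+ t)) ≡ t ^ 4 ℚ.* fPolynomial (ℚ.1/ t)

  -- Barycentric coordinates. The last conjunct says that the support
  -- { v | x v > 0 } is a face; constructively this set need not be given by
  -- a Subset, so the condition is imposed on all Subsets contained in it.
  InRealization : Pred (Vector ℝ n) 0ℓ
  InRealization x = (∀ v → 0ℝ ≤ x v) × Σℝ x ≈ 1ℝ × (∀ τ → (∀ v → v ∈ τ → 0ℝ < x v) → Face τ)

Subspace : ∀ {n} → Pred (Vector ℝ n) 0ℓ → Setoid 0ℓ 0ℓ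
Subspace {n} P = record
  { Carrier = Σ (Vector ℝ n) P
  ; _≈_ = λ x y → ∀ i → proj₁ x i ≈ proj₁ y i
  ; isEquivalence = record
    { refl = λ {x} i → R.refl {proj₁ x i}
    ; sym = λ {x} {y} h i → R.sym {proj₁ x i} {proj₁ y i} (h i)
    ; trans = λ {x} {y} {z} h k i → R.trans {proj₁ x i} {proj₁ y i} {proj₁ z i} (h i) (k i)
    }
  }
  where module R = Setoid ℝ-setoid

-- Distance less than ε in the maximum metric, which induces the Euclidean
-- topology.
Within : ∀ {n} → ℝ → Vector ℝ n → Vector ℝ n → Set
Within ε x y = ∀ i → x i < y i + ε × y i < x i + ε

Continuous : ∀ {m n} {P : Pred (Vector ℝ m) 0ℓ} {Q : Pred (Vector ℝ n) 0ℓ} →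
             (Σ (Vector ℝ m) P → Σ (Vector ℝ n) Q) → Set
Continuous {P = P} f = ∀ x ε → 0ℝ < ε → Σ[ δ ∈ ℝ ] 0ℝ < δ ×
  (∀ y → Within δ (proj₁ x) (proj₁ y) → Within ε (proj₁ (f x)) (proj₁ (f y)))

record Homeomorphism {m n} (P : Pred (Vector ℝ m) 0ℓ) (Q : Pred (Vector ℝ n) 0ℓ) : Set where
  field
    bijection : Inverse (Subspace P) (Subspace Q)
  open Inverse bijection public
  field
    to-continuous   : Continuous {P = P} {Q = Q} to
    from-continuous : Continuous {P = Q} {Q = P} from

Sphere : (d : ℕ) → Pred (Vector ℝ (suc d)) 0ℓ
Sphere d x = Σℝ (λ i → x i * x i) ≈ 1ℝ

TriangulatesS³ : ∀ {n} → SimplicialComplex n → Set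
TriangulatesS³ X = Homeomorphism (InRealization X) (Sphere 3)

{-# OPTIONS --safe #-}

-- With a = γ₁ − 1, the polynomial γ(t) − t = 1 + a t + γ₂ t² has only negative
-- real roots only if a ≥ 0 and 0 ≤ γ₂ ≤ a²/4: otherwise one of the explicit complex
-- numbers (−a ± √(a² − 4γ₂))/2γ₂, or −1/a when γ₂ = 0, violates the hypothesis.
--
-- Subdividing an edge of a flag 3-sphere whose link is a (4 + k)-gon yields a flag
-- 3-sphere and increases (γ₁ , γ₂) by (1 , k). Starting from the boundary of the
-- cross-polytope, c subdivisions of one edge and b subdivisions of the opposite
-- edge of a facet give (b + c , b c), the join of two polygons. Subdividing an edge
-- between the two polygons costs (1 , 0) and creates an edge whose link has
-- length 4 + r if it is done just before the last r of the b subdivisions; one more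
-- subdivision then adds (1 , r). Taking b = ⌊a/2⌋ and γ₂ = b c + r reaches γ₁ = a + 1.
--
-- All complexes are clique complexes of graphs, and the homeomorphisms are
-- explicit: for a subdivision (x_u , x_v) ↦ (x_u − m , x_v − m , 2 m) with
-- m = min(x_u , x_v), and for the cross-polytope the difference of the square roots
-- of antipodal coordinates.
module Submission where

open import Defs
open import Data.Bool as Bool using (Bool; true; false; _∧_; _∨_; not; if_then_else_)
open import Data.Bool.Properties using (∧-comm; ∧-assoc; ∧-zeroʳ; ∧-identityʳ; ∨-comm; ∨-identityʳ; ∨-zeroʳ)
open import Data.Empty using (⊥)
open import Data.Fin using (Fin; zero; suc)
import Data.Fin.Properties as Fin
open import Data.Fin.Subset using (Subset; inside; outside; ⁅_⁆; _∈_; _∪_; ∣_∣)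
open import Data.Fin.Subset.Properties using (x∈⁅y⁆⇒x≡y; x∈⁅x⁆; ∉⊥; _∈?_; x∈p∪q⁺; x∈p∪q⁻)
open import Data.Integer as ℤ using (ℤ; +_; -[1+_])
import Data.Integer.Properties as ℤ
open import Data.List using (List; []; _∷_; _++_; map; filter; foldr)
open import Data.List.Properties using (filter-++)
import Data.List.Relation.Binary.Permutation.Propositional as ↭
open import Data.Nat as ℕ using (ℕ; zero; suc)
import Data.Nat.Coprimality as Coprimality
open import Data.Nat.DivMod using (_/_; _%_; m≡m%n+[m/n]*n; m%n<n)
import Data.Nat.Properties as ℕ
open import Data.Nat.Solver using () renaming (module +-*-Solver to ℕ-Solver)
open import Data.Product using (Σ; ∃; ∃₂; Σ-syntax; _×_; _,_; proj₁; proj₂)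
open import Data.Rational as ℚ using (ℚ; 0ℚ; 1ℚ; ½; mkℚ; *<*; *≤*)
import Data.Rational.Properties as ℚ
open import Data.Rational.Solver using (module +-*-Solver)
import Data.Rational.Unnormalised as ℚᵘ
import Data.Rational.Unnormalised.Properties as ℚᵘ
open import Data.Sum as Sum using (_⊎_; inj₁; inj₂)
open import Data.Vec using ([]; _∷_; here; there)
open import Data.Vec.Functional using (Vector)
open import Function using (_∘_; _⇔_; mk⇔; Equivalence)
open import Function.Construct.Composition using (inverse)
open import Level using (0ℓ)
open import Relation.Binary.Bundles using (Setoid)
open import Relation.Binary.PropositionalEquality as ≡ using (_≡_; _≢_; refl; sym; cong; cong₂; subst; subst₂)
open import Relation.Nullary using (¬_; Dec; yes; no; does; contradiction)
open import Relation.Nullary.Decidable using (_→-dec_; dec-true; dec-false; ¬?)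
open import Relation.Unary using (Pred; Decidable)
open import Algebra.Properties.CommutativeMonoid.Sum ℚ.+-0-commutativeMonoid using (sum-cong-≗; ∑-distrib-+; sum-replicate-zero) renaming (sum to Σℚ)
open ↭ using (_↭_; prep; swap)
open ≡.≡-Reasoning


-- Clique complexes and clique polynomials

-- The term `- t` of the hypothesis is worth one unit of `γ₁`, and this unit pays for the
-- subdivision between the two polygons: a join alone reaches only products `b c`, whereas a general
-- `γ₂` is a product plus a remainder.
--
-- Positivity of a constructive real is undecidable, so a point cannot be located in a simplex.
-- Hence each homeomorphism is a single formula on the whole coordinate space, and the support
-- condition is used in negative form: two non-adjacent vertices never both have positive
-- coordinates. The roots, too, have to be produced as Cauchy sequences; since the coefficients are
-- integers, the discriminant is rational and its sign can be decided.
--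
-- Faces are counted through links: it suffices to carry the f-polynomials of the links of a few
-- faces of one facet, because each subdivision expresses the new ones through the old ones.

∧-true : ∀ {a b} → a ∧ b ≡ true → a ≡ true × b ≡ true
∧-true {true} p = refl , p

Adjacency : ℕ → Set
Adjacency n = Fin n → Fin n → Bool

record Graph (n : ℕ) : Set where
  field
    adj    : Adjacency n
    symm   : ∀ i j → adj i j ≡ adj j i
    irrefl : ∀ i → adj i i ≡ false

IsClique : ∀ {n} → Adjacency n → Subset n → Set
IsClique adj σ = ∀ i j → i ∈ σ → j ∈ σ → i ≢ j → adj i j ≡ true

isClique? : ∀ {n} (adj : Adjacency n) → Decidable (IsClique adj)
isClique? adj σ = Fin.all? λ i → Fin.all? λ j →
  (i ∈? σ) →-dec ((j ∈? σ) →-dec (¬? (i Fin.≟ j) →-dec (adj i j Bool.≟ true)))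

cliqueComplex : ∀ {n} → Graph n → SimplicialComplex n
cliqueComplex G = record
  { Face        = IsClique adj
  ; face?       = isClique? adj
  ; empty-face  = λ i j i∈∅ → contradiction i∈∅ ∉⊥
  ; vertex-face = λ v i j i∈v j∈v i≢j →
      contradiction (≡.trans (x∈⁅y⁆⇒x≡y v i∈v) (sym (x∈⁅y⁆⇒x≡y v j∈v))) i≢j
  ; down-closed = λ σ⊆τ clique i j i∈σ j∈σ → clique i j (σ⊆τ i∈σ) (σ⊆τ j∈σ)
  }
  where open Graph G

cliqueComplex-flag : ∀ {n} (G : Graph n) → Flag (cliqueComplex G)
cliqueComplex-flag G σ pairwise i j i∈σ j∈σ i≢j =
  proj₂ (pairwise i j i∈σ j∈σ i≢j) i j
    (x∈p∪q⁺ (inj₁ (x∈⁅x⁆ i))) (x∈p∪q⁺ (inj₂ (x∈⁅x⁆ j))) i≢j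

VertexSet : ℕ → Set
VertexSet n = Fin n → Bool

_∩_ : ∀ {n} → VertexSet n → VertexSet n → VertexSet n
(S ∩ R) i = S i ∧ R i

_∖_ : ∀ {n} → VertexSet n → Fin n → VertexSet n
(S ∖ u) i = S i ∧ not (does (i Fin.≟ u))

module _ (t : ℚ) where

  -- Generating function, by size, of the cliques contained in S.
  K : ∀ {n} → Adjacency n → VertexSet n → ℚ
  K {zero}  adj S = 1ℚ
  K {suc n} adj S = K adj⁺ (S ∘ suc) ℚ.+ (if S zero then t ℚ.* K adj⁺ ((S ∘ suc) ∩ (adj zero ∘ suc)) else 0ℚ)
    where
    adj⁺ : Adjacency n
    adj⁺ i j = adj (suc i) (suc j)

  -- An edge with an end outside the vertex set is invisible to `K`, so agreement is required only
  -- inside it. This is what makes the removal of an edge harmless for sets that miss one of its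
  -- ends.
  K-cong : ∀ {n} {adj adj′ : Adjacency n} {S S′ : VertexSet n} → (∀ i → S i ≡ S′ i) →
           (∀ i j → S i ≡ true → S j ≡ true → adj i j ≡ adj′ i j) → K adj S ≡ K adj′ S′
  K-cong {zero} _ _ = refl
  K-cong {suc n} {adj} {adj′} {S} {S′} S≗S′ eq with S zero in S0 | S′ zero in S′0
  ... | true  | false = contradiction (≡.trans (sym S0) (≡.trans (S≗S′ zero) S′0)) λ ()
  ... | false | true  = contradiction (≡.trans (sym S0) (≡.trans (S≗S′ zero) S′0)) λ ()
  ... | false | false = cong (ℚ._+ 0ℚ) (K-cong (S≗S′ ∘ suc) (λ i j → eq (suc i) (suc j)))
  ... | true  | true  = cong₂ (λ p q → p ℚ.+ t ℚ.* q)
    (K-cong (S≗S′ ∘ suc) (λ i j → eq (suc i) (suc j)))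
    (K-cong pointwise (λ i j p q → eq (suc i) (suc j) (proj₁ (∧-true p)) (proj₁ (∧-true q))))
    where
    pointwise : ∀ i → S (suc i) ∧ adj zero (suc i) ≡ S′ (suc i) ∧ adj′ zero (suc i)
    pointwise i rewrite sym (S≗S′ (suc i)) with S (suc i) in Si
    ... | true  = eq zero (suc i) S0 Si
    ... | false = refl

  K-ext : ∀ {n} (adj : Adjacency n) {S S′ : VertexSet n} → (∀ i → S i ≡ S′ i) → K adj S ≡ K adj S′
  K-ext adj S≗S′ = K-cong S≗S′ (λ _ _ _ _ → refl)

  private
    if-step : ∀ b {p q} → p ≡ q → (if b then p else 0ℚ) ≡ (if b then q else 0ℚ)
    if-step b = cong (λ p → if b then p else 0ℚ)

  K-absent : ∀ {n} (adj : Adjacency n) S u → S u ≡ false → K adj S ≡ K adj (S ∖ u)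
  K-absent adj S u Su = K-ext adj pointwise
    where
    pointwise : ∀ i → S i ≡ (S ∖ u) i
    pointwise i with i Fin.≟ u
    ... | yes refl = ≡.trans Su (sym (∧-zeroʳ (S i)))
    ... | no _     = sym (∧-identityʳ (S i))

  -- The definition of `K` splits cliques only by the vertex `zero`; this splits them by any `u`.
  -- The induction splits by both `zero` and `u`, and `rearrange` regroups the four classes of
  -- cliques: `a` with neither, `b` with `u`, `c` with `zero`, `d` with both.
  K-delete : ∀ {n} (adj : Adjacency n) → (∀ i j → adj i j ≡ adj j i) → (∀ i → adj i i ≡ false) →
             ∀ S u → S u ≡ true → K adj S ≡ K adj (S ∖ u) ℚ.+ t ℚ.* K adj (S ∩ adj u)
  K-delete {suc n} adj symm irrefl S zero Su = begin
    K adj S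
      ≡⟨ cong (λ b → a ℚ.+ (if b then t ℚ.* b′ else 0ℚ)) Su ⟩
    a ℚ.+ t ℚ.* b′
      ≡⟨ solve 2 (λ x y → x :+ y := (x :+ con 0ℚ) :+ (y)) refl a (t ℚ.* b′) ⟩
    (a ℚ.+ 0ℚ) ℚ.+ t ℚ.* b′
      ≡⟨ cong₂ (λ p q → p ℚ.+ t ℚ.* q) (sym del) (sym nbr) ⟩
    K adj (S ∖ zero) ℚ.+ t ℚ.* K adj (S ∩ adj zero) ∎
    where
    open +-*-Solver
    adj⁺ : Adjacency n
    adj⁺ i j = adj (suc i) (suc j)
    a b′ : ℚ
    a = K adj⁺ (S ∘ suc)
    b′ = K adj⁺ ((S ∘ suc) ∩ (adj zero ∘ suc))
    del : K adj (S ∖ zero) ≡ a ℚ.+ 0ℚ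
    del rewrite ∧-zeroʳ (S zero) = cong (ℚ._+ 0ℚ) (K-ext adj⁺ (λ i → ∧-identityʳ (S (suc i))))
    nbr : K adj (S ∩ adj zero) ≡ b′
    nbr rewrite irrefl zero | ∧-zeroʳ (S zero) = ℚ.+-identityʳ b′
  K-delete {suc n} adj symm irrefl S (suc u) Su = begin
    K adj S
      ≡⟨ cong₂ (λ p q → p ℚ.+ q) (K-delete adj⁺ symm⁺ irrefl⁺ S⁺ u Su) (if-step (S zero) (cong (t ℚ.*_) inner)) ⟩
    (a ℚ.+ t ℚ.* b) ℚ.+ (if S zero then t ℚ.* (c ℚ.+ (if adj (suc u) zero then t ℚ.* d else 0ℚ)) else 0ℚ)
      ≡⟨ rearrange (S zero) (adj (suc u) zero) ⟩
    (a ℚ.+ (if S zero then t ℚ.* c else 0ℚ)) ℚ.+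
      t ℚ.* (b ℚ.+ (if S zero ∧ adj (suc u) zero then t ℚ.* d else 0ℚ))
      ≡⟨ cong₂ (λ p q → p ℚ.+ t ℚ.* q) (sym del) (sym nbr) ⟩
    K adj (S ∖ suc u) ℚ.+ t ℚ.* K adj (S ∩ adj (suc u)) ∎
    where
    open +-*-Solver
    adj⁺ : Adjacency n
    adj⁺ i j = adj (suc i) (suc j)
    symm⁺ : ∀ i j → adj⁺ i j ≡ adj⁺ j i
    symm⁺ i j = symm (suc i) (suc j)
    irrefl⁺ : ∀ i → adj⁺ i i ≡ false
    irrefl⁺ i = irrefl (suc i)
    S⁺ N₀ : VertexSet n
    S⁺ = S ∘ suc
    N₀ = adj zero ∘ suc
    a b c d : ℚ
    a = K adj⁺ (S⁺ ∖ u)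
    b = K adj⁺ (S⁺ ∩ adj⁺ u)
    c = K adj⁺ ((S⁺ ∩ N₀) ∖ u)
    d = K adj⁺ ((S⁺ ∩ N₀) ∩ adj⁺ u)
    inner : K adj⁺ (S⁺ ∩ N₀) ≡ c ℚ.+ (if adj (suc u) zero then t ℚ.* d else 0ℚ)
    inner with adj (suc u) zero in eq
    ... | true  = K-delete adj⁺ symm⁺ irrefl⁺ (S⁺ ∩ N₀) u (cong₂ _∧_ Su (≡.trans (symm zero (suc u)) eq))
    ... | false = ≡.trans (K-absent adj⁺ (S⁺ ∩ N₀) u (≡.trans (cong (S⁺ u ∧_) (≡.trans (symm zero (suc u)) eq)) (∧-zeroʳ _)))
                          (sym (ℚ.+-identityʳ c))
    ∧-swap : ∀ x y z → (x ∧ y) ∧ z ≡ (x ∧ z) ∧ y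
    ∧-swap x y z = ≡.trans (∧-assoc x y z) (≡.trans (cong (x ∧_) (∧-comm y z)) (sym (∧-assoc x z y)))
    del : K adj (S ∖ suc u) ≡ a ℚ.+ (if S zero then t ℚ.* c else 0ℚ)
    del rewrite ∧-identityʳ (S zero) =
      cong (a ℚ.+_) (if-step (S zero) (cong (t ℚ.*_) (K-ext adj⁺ (λ i → ∧-swap (S⁺ i) _ (N₀ i)))))
    nbr : K adj (S ∩ adj (suc u)) ≡ b ℚ.+ (if S zero ∧ adj (suc u) zero then t ℚ.* d else 0ℚ)
    nbr = cong (b ℚ.+_) (if-step (S zero ∧ adj (suc u) zero)
                          (cong (t ℚ.*_) (K-ext adj⁺ (λ i → ∧-swap (S⁺ i) (adj⁺ u i) (N₀ i)))))
    rearrange : ∀ s e →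
      (a ℚ.+ t ℚ.* b) ℚ.+ (if s then t ℚ.* (c ℚ.+ (if e then t ℚ.* d else 0ℚ)) else 0ℚ) ≡
      (a ℚ.+ (if s then t ℚ.* c else 0ℚ)) ℚ.+ t ℚ.* (b ℚ.+ (if s ∧ e then t ℚ.* d else 0ℚ))
    rearrange false e = solve 3 (λ a b t → (a :+ t :* b) :+ con 0ℚ := (a :+ con 0ℚ) :+ t :* (b :+ con 0ℚ)) refl a b t
    rearrange true false = solve 4 (λ a b c t → (a :+ t :* b) :+ t :* (c :+ con 0ℚ) := (a :+ t :* c) :+ t :*
        (b :+ con 0ℚ)) refl a b c t
    rearrange true true = solve 5 (λ a b c d t → (a :+ t :* b) :+ t :* (c :+ t :* d) := (a :+ t :* c) :+ t :*
        (b :+ t :* d)) refl a b c d t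

  private
    weight : ∀ {n} → List (Subset n) → ℚ
    weight σs = foldr ℚ._+_ 0ℚ (map (λ σ → t ^ ∣ σ ∣) σs)

    weight-++ : ∀ {n} (σs τs : List (Subset n)) → weight (σs ++ τs) ≡ weight σs ℚ.+ weight τs
    weight-++ []       τs = sym (ℚ.+-identityˡ (weight τs))
    weight-++ (σ ∷ σs) τs = ≡.trans (cong (t ^ ∣ σ ∣ ℚ.+_) (weight-++ σs τs))
        (sym (ℚ.+-assoc (t ^ ∣ σ ∣) (weight σs) (weight τs)))

    weight-outside : ∀ {n} {P : Pred (Subset (suc n)) 0ℓ} (P? : Decidable P) σs →
      weight (filter P? (map (outside ∷_) σs)) ≡ weight (filter (P? ∘ (outside ∷_)) σs)
    weight-outside P? [] = refl
    weight-outside P? (σ ∷ σs) with does (P? (outside ∷ σ))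
    ... | true  = cong (t ^ ∣ σ ∣ ℚ.+_) (weight-outside P? σs)
    ... | false = weight-outside P? σs

    weight-inside : ∀ {n} {P : Pred (Subset (suc n)) 0ℓ} (P? : Decidable P) σs →
      weight (filter P? (map (inside ∷_) σs)) ≡ t ℚ.* weight (filter (P? ∘ (inside ∷_)) σs)
    weight-inside P? [] = sym (ℚ.*-zeroʳ t)
    weight-inside P? (σ ∷ σs) with does (P? (inside ∷ σ))
    ... | true  = ≡.trans (cong (t ^ ∣ inside ∷ σ ∣ ℚ.+_) (weight-inside P? σs))
                          (sym (ℚ.*-distribˡ-+ t (t ^ ∣ σ ∣) (weight (filter (P? ∘ (inside ∷_)) σs))))
    ... | false = weight-inside P? σs

    weight-none : ∀ {n} {P : Pred (Subset n) 0ℓ} (P? : Decidable P) → (∀ σ → ¬ P σ) → ∀ σs → weight (filter P? σs) ≡ 0ℚ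
    weight-none P? ¬P [] = refl
    weight-none P? ¬P (σ ∷ σs) with P? σ
    ... | yes Pσ = contradiction Pσ (¬P σ)
    ... | no  _  = weight-none P? ¬P σs

  -- The predicate is arbitrary because the induction leaves the form `IsClique`: deciding about the
  -- first vertex turns `P` into `P` of an extended subset, and including that vertex restricts the
  -- allowed set to its neighbours.
  K-counts : ∀ {n} (adj : Adjacency n) → (∀ i j → adj i j ≡ adj j i) → ∀ S {P : Pred (Subset n) 0ℓ} (P? : Decidable P) →
             (∀ σ → P σ ⇔ (IsClique adj σ × (∀ i → i ∈ σ → S i ≡ true))) →
             foldr ℚ._+_ 0ℚ (map (λ σ → t ^ ∣ σ ∣) (filter P? (allSubsets n))) ≡ K adj S
  K-counts {zero} adj symm S P? P⇔ with P? []
  ... | yes _ = refl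
  ... | no ¬p = contradiction (Equivalence.from (P⇔ []) ((λ ()) , λ ())) ¬p
  K-counts {suc n} adj symm S {P} P? P⇔ = begin
    weight (filter P? (map (outside ∷_) (allSubsets n) ++ map (inside ∷_) (allSubsets n)))
      ≡⟨ cong weight (filter-++ P? (map (outside ∷_) (allSubsets n)) _) ⟩
    weight (filter P? (map (outside ∷_) (allSubsets n)) ++ filter P? (map (inside ∷_) (allSubsets n)))
      ≡⟨ weight-++ (filter P? (map (outside ∷_) (allSubsets n))) _ ⟩
    weight (filter P? (map (outside ∷_) (allSubsets n))) ℚ.+ weight (filter P? (map (inside ∷_) (allSubsets n)))
      ≡⟨ cong₂ ℚ._+_ (≡.trans (weight-outside P? (allSubsets n)) outsides)
                     (≡.trans (weight-inside P? (allSubsets n)) insides) ⟩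
    K adj S ∎
    where
    adj⁺ : Adjacency n
    adj⁺ i j = adj (suc i) (suc j)
    symm⁺ : ∀ i j → adj⁺ i j ≡ adj⁺ j i
    symm⁺ i j = symm (suc i) (suc j)
    S⁺ N₀ : VertexSet n
    S⁺ = S ∘ suc
    N₀ = adj zero ∘ suc
    outsides : weight (filter (P? ∘ (outside ∷_)) (allSubsets n)) ≡ K adj⁺ S⁺
    outsides = K-counts adj⁺ symm⁺ S⁺ (P? ∘ (outside ∷_)) λ σ → mk⇔
      (λ p → let clique , ⊆S = Equivalence.to (P⇔ (outside ∷ σ)) p in
        (λ i j i∈ j∈ i≢j → clique (suc i) (suc j) (there i∈) (there j∈) (i≢j ∘ Fin.suc-injective)) ,
        (λ i i∈ → ⊆S (suc i) (there i∈)))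
      (λ (clique , ⊆S) → Equivalence.from (P⇔ (outside ∷ σ))
        ( (λ { (suc i) (suc j) (there i∈) (there j∈) i≢j → clique i j i∈ j∈ (i≢j ∘ cong suc) })
        , (λ { (suc i) (there i∈) → ⊆S i i∈ })))
    insides : t ℚ.* weight (filter (P? ∘ (inside ∷_)) (allSubsets n)) ≡ (if S zero then t ℚ.* K adj⁺ (S⁺ ∩ N₀) else 0ℚ)
    insides with S zero in S0
    ... | false = ≡.trans (cong (t ℚ.*_) (weight-none (P? ∘ (inside ∷_))
                    (λ σ p → contradiction (≡.trans (sym S0) (proj₂ (Equivalence.to (P⇔ (inside ∷ σ)) p) zero here)) λ
                        ())
                    (allSubsets n))) (ℚ.*-zeroʳ t)
    ... | true = cong (t ℚ.*_) (K-counts adj⁺ symm⁺ (S⁺ ∩ N₀) (P? ∘ (inside ∷_)) λ σ → mk⇔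
      (λ p → let clique , ⊆S = Equivalence.to (P⇔ (inside ∷ σ)) p in
        (λ i j i∈ j∈ i≢j → clique (suc i) (suc j) (there i∈) (there j∈) (i≢j ∘ Fin.suc-injective)) ,
        (λ i i∈ → cong₂ _∧_ (⊆S (suc i) (there i∈)) (clique zero (suc i) here (there i∈) (λ ()))))
      (λ (clique , ⊆) → Equivalence.from (P⇔ (inside ∷ σ))
        ( (λ { zero zero _ _ 0≢0 → contradiction refl 0≢0
             ; zero (suc j) _ (there j∈) _ → proj₂ (∧-true {S⁺ j} (⊆ j j∈))
             ; (suc i) zero (there i∈) _ _ → ≡.trans (symm (suc i) zero) (proj₂ (∧-true {S⁺ i} (⊆ i i∈)))
             ; (suc i) (suc j) (there i∈) (there j∈) i≢j → clique i j i∈ j∈ (i≢j ∘ cong suc) })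
        , (λ { zero here → S0 ; (suc i) (there i∈) → proj₁ (∧-true (⊆ i i∈)) }))))

everything : ∀ {n} → VertexSet n
everything _ = true

fPolynomial≡K : ∀ {n} (G : Graph n) t → fPolynomial (cliqueComplex G) t ≡ K t (Graph.adj G) everything
fPolynomial≡K G t = K-counts t adj symm everything (isClique? adj) (λ σ → mk⇔ (λ c → c , λ _ _ → refl) proj₁)
  where open Graph G

-- Edge subdivision: clique polynomials of links

_==_ : ∀ {n} → Fin n → Fin n → Bool
i == j = does (i Fin.≟ j)

==-refl : ∀ {n} (i : Fin n) → (i == i) ≡ true
==-refl i = dec-true (i Fin.≟ i) refl

≢⇒==-false : ∀ {n} {i j : Fin n} → i ≢ j → (i == j) ≡ false
≢⇒==-false {i = i} {j} = dec-false (i Fin.≟ j)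

-- In a flag complex the link of a face is the full subcomplex on the common neighbours of its
-- vertices, so `K` on this set is the f-polynomial of the link. The empty list gives the whole
-- complex, which lets the statements on links cover the total count too.
lk : ∀ {n} → Adjacency n → List (Fin n) → VertexSet n
lk adj []      i = true
lk adj (a ∷ σ) i = adj a i ∧ lk adj σ i

lk-↭ : ∀ {n} (adj : Adjacency n) {σ τ} → σ ↭ τ → ∀ i → lk adj σ i ≡ lk adj τ i
lk-↭ adj ↭.refl        i = refl
lk-↭ adj (prep a p)   i = cong (adj a i ∧_) (lk-↭ adj p i)
lk-↭ adj {_ ∷ _ ∷ σ} {_ ∷ _ ∷ τ} (swap a b p) i = begin
  adj a i ∧ (adj b i ∧ lk adj σ i) ≡⟨ ∧-assoc (adj a i) (adj b i) _ ⟨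
  (adj a i ∧ adj b i) ∧ lk adj σ i ≡⟨ cong₂ _∧_ (∧-comm (adj a i) (adj b i)) (lk-↭ adj p i) ⟩
  (adj b i ∧ adj a i) ∧ lk adj τ i ≡⟨ ∧-assoc (adj b i) (adj a i) _ ⟩
  adj b i ∧ (adj a i ∧ lk adj τ i) ∎
lk-↭ adj (↭.trans p q) i = ≡.trans (lk-↭ adj p i) (lk-↭ adj q i)

module Subdivision {n} (G : Graph n) (u v : Fin n) (uv : Graph.adj G u v ≡ true) where
  open Graph G

  adjacent⇒≢ : ∀ {i j} → adj i j ≡ true → i ≢ j
  adjacent⇒≢ {i} ij refl = contradiction (≡.trans (sym ij) (irrefl i)) λ ()

  u≢v : u ≢ v
  u≢v = adjacent⇒≢ uv

  onEdge common nearby : VertexSet n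
  onEdge i = (i == u) ∨ (i == v)
  common i = adj u i ∧ adj v i
  nearby i = onEdge i ∨ common i

  isEdge adj⁻ : Adjacency n
  isEdge i j = ((i == u) ∧ (j == v)) ∨ ((i == v) ∧ (j == u))
  adj⁻ i j = adj i j ∧ not (isEdge i j)

  -- The edge graph of the stellar subdivision, with `zero` as the midpoint of `uv`. The graph
  -- determines everything, since subdividing an edge of a flag complex creates no minimal non-face
  -- with more than two vertices.
  adj′ : Adjacency (suc n)
  adj′ zero    zero    = false
  adj′ zero    (suc j) = nearby j
  adj′ (suc i) zero    = nearby i
  adj′ (suc i) (suc j) = adj⁻ i j

  isEdge-symm : ∀ i j → isEdge i j ≡ isEdge j i
  isEdge-symm i j = ≡.trans (∨-comm ((i == u) ∧ (j == v)) _)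
    (cong₂ _∨_ (∧-comm (i == v) (j == u)) (∧-comm (i == u) (j == v)))

  adj⁻-symm : ∀ i j → adj⁻ i j ≡ adj⁻ j i
  adj⁻-symm i j = cong₂ (λ a b → a ∧ not b) (symm i j) (isEdge-symm i j)

  adj⁻-irrefl : ∀ i → adj⁻ i i ≡ false
  adj⁻-irrefl i = cong (_∧ not (isEdge i i)) (irrefl i)

  subdivision : Graph (suc n)
  subdivision = record
    { adj    = adj′
    ; symm   = λ { zero zero → refl ; zero (suc j) → refl ; (suc i) zero → refl ; (suc i) (suc j) → adj⁻-symm i j }
    ; irrefl = λ { zero → refl ; (suc i) → adj⁻-irrefl i }
    }

  isEdge-false : ∀ {i j} → i ≢ u → i ≢ v → isEdge i j ≡ false
  isEdge-false i≢u i≢v rewrite ≢⇒==-false i≢u | ≢⇒==-false i≢v = refl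

  isEdge-u : ∀ j → isEdge u j ≡ (j == v)
  isEdge-u j rewrite ==-refl u | ≢⇒==-false u≢v = ∨-identityʳ (j == v)

  adj⁻-away : ∀ {i j} → i ≢ u → i ≢ v → adj⁻ i j ≡ adj i j
  adj⁻-away {i} {j} i≢u i≢v = ≡.trans (cong (λ b → adj i j ∧ not b) (isEdge-false {i} {j} i≢u i≢v))
      (∧-identityʳ (adj i j))

  adj⁻-uv : adj⁻ u v ≡ false
  adj⁻-uv rewrite isEdge-u v | ==-refl v = ∧-zeroʳ (adj u v)

  nearby-u : nearby u ≡ true
  nearby-u rewrite ==-refl u = refl

  nearby-v : nearby v ≡ true
  nearby-v rewrite ==-refl v with v == u
  ... | true  = refl
  ... | false = refl

  nearby-common : ∀ {i} → adj u i ≡ true → adj v i ≡ true → nearby i ≡ true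
  nearby-common {i} ui vi rewrite ui | vi = ∨-zeroʳ (onEdge i)

  nearby-away : ∀ {i} → i ≢ u → i ≢ v → nearby i ≡ common i
  nearby-away i≢u i≢v rewrite ≢⇒==-false i≢u | ≢⇒==-false i≢v = refl

  edge-cases : ∀ {ℓ} (P : Fin n → Set ℓ) → P u → P v → (∀ i → i ≢ u → i ≢ v → P i) → ∀ i → P i
  edge-cases P Pu Pv rest i with i Fin.≟ u | i Fin.≟ v
  ... | yes refl | _        = Pu
  ... | no _     | yes refl = Pv
  ... | no i≢u   | no i≢v   = rest i i≢u i≢v

  common-u : common u ≡ false
  common-u rewrite irrefl u = refl

  common-v : common v ≡ false
  common-v rewrite irrefl v = ∧-zeroʳ (adj u v)

  lk′-old : ∀ σ → lk adj σ u ≡ true → lk adj σ v ≡ true → ∀ i → lk adj′ (map suc σ) (suc i) ≡ lk adj σ i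
  lk′-old []      _ _ i = refl
  lk′-old (a ∷ σ) σu σv i with au , σu ← ∧-true σu | av , σv ← ∧-true σv =
    cong₂ _∧_ (adj⁻-away (adjacent⇒≢ au) (adjacent⇒≢ av)) (lk′-old σ σu σv i)

  lk′-new : ∀ σ → lk adj σ u ≡ true → lk adj σ v ≡ true → lk adj′ (map suc σ) zero ≡ true
  lk′-new []      _ _ = refl
  lk′-new (a ∷ σ) σu σv with au , σu ← ∧-true σu | av , σv ← ∧-true σv =
    cong₂ _∧_ (nearby-common (≡.trans (symm u a) au) (≡.trans (symm v a) av)) (lk′-new σ σu σv)

  module _ (t : ℚ) where

    K⁻-avoiding : ∀ S → S u ≡ false ⊎ S v ≡ false → K t adj⁻ S ≡ K t adj S
    K⁻-avoiding S avoids = K-cong t (λ _ → refl) λ i j Si Sj →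
      ≡.trans (cong (λ b → adj i j ∧ not b) (no-edge avoids i j Si Sj)) (∧-identityʳ _)
      where
      outside-S : ∀ {a i} → S a ≡ false → S i ≡ true → (i == a) ≡ false
      outside-S {a} {i} Sa Si = ≢⇒==-false {i = i} {a} λ { refl → contradiction (≡.trans (sym Sa) Si) λ () }
      no-edge : S u ≡ false ⊎ S v ≡ false → ∀ i j → S i ≡ true → S j ≡ true → isEdge i j ≡ false
      no-edge (inj₁ Su) i j Si Sj rewrite outside-S Su Si | outside-S Su Sj = ∧-zeroʳ (i == v)
      no-edge (inj₂ Sv) i j Si Sj rewrite outside-S Sv Si | outside-S Sv Sj | ∧-zeroʳ (i == u) = refl

    ∖-self : ∀ (S : VertexSet n) a → (S ∖ a) a ≡ false
    ∖-self S a rewrite ==-refl a = ∧-zeroʳ (S a)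

    ∖-other : ∀ (S : VertexSet n) {a i} → i ≢ a → (S ∖ a) i ≡ S i
    ∖-other S i≢a rewrite ≢⇒==-false i≢a = ∧-identityʳ _

    -- The cliques lost with the edge are `u`, `v` and a clique of their common neighbours, whence
    -- the factor `t` twice. Deleting `u` and then `v` isolates this term; the rest is the deletion
    -- of `u` for `adj⁻`, where `v` is no longer a neighbour of `u`.
    K-removeEdge : ∀ S → S u ≡ true → S v ≡ true →
                   K t adj S ≡ K t adj⁻ S ℚ.+ t ℚ.* (t ℚ.* K t adj (S ∩ common))
    K-removeEdge S Su Sv = begin
      K t adj S
        ≡⟨ K-delete t adj symm irrefl S u Su ⟩
      A ℚ.+ t ℚ.* K t adj (S ∩ adj u)
        ≡⟨ cong (λ z → A ℚ.+ t ℚ.* z) (K-delete t adj symm irrefl (S ∩ adj u) v (cong₂ _∧_ Sv uv)) ⟩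
      A ℚ.+ t ℚ.* (B ℚ.+ t ℚ.* K t adj ((S ∩ adj u) ∩ adj v))
        ≡⟨ cong (λ z → A ℚ.+ t ℚ.* (B ℚ.+ t ℚ.* z)) (K-ext t adj (λ i → ∧-assoc (S i) (adj u i) (adj v i))) ⟩
      A ℚ.+ t ℚ.* (B ℚ.+ t ℚ.* C)
        ≡⟨ solve 4 (λ a b c t → a :+ t :* (b :+ t :* c) := (a :+ t :* b) :+ t :* (t :* c)) refl A B C t ⟩
      (A ℚ.+ t ℚ.* B) ℚ.+ t ℚ.* (t ℚ.* C)
        ≡⟨ cong (ℚ._+ t ℚ.* (t ℚ.* C)) (sym removed) ⟩
      K t adj⁻ S ℚ.+ t ℚ.* (t ℚ.* C) ∎
      where
      open +-*-Solver
      A B C : ℚ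
      A = K t adj (S ∖ u)
      B = K t adj ((S ∩ adj u) ∖ v)
      C = K t adj (S ∩ common)
      pointwise : ∀ i → (S ∩ adj⁻ u) i ≡ ((S ∩ adj u) ∖ v) i
      pointwise i = ≡.trans (cong (λ b → S i ∧ (adj u i ∧ not b)) (isEdge-u i)) (sym (∧-assoc (S i) (adj u i) _))
      removed : K t adj⁻ S ≡ A ℚ.+ t ℚ.* B
      removed = ≡.trans (K-delete t adj⁻ adj⁻-symm adj⁻-irrefl S u Su) (cong₂ (λ a b → a ℚ.+ t ℚ.* b)
        (K⁻-avoiding (S ∖ u) (inj₁ (∖-self S u)))
        (≡.trans (K-ext t adj⁻ pointwise) (K⁻-avoiding ((S ∩ adj u) ∖ v) (inj₂ (∖-self (S ∩ adj u) v)))))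

    -- The neighbourhood of the new vertex is the suspension of the link of `uv`: its poles `u` and
    -- `v` are no longer adjacent and are joined to all common neighbours. The factor `1 + 2 t`
    -- counts no pole or one of the two; `core` identifies what remains in each of these three
    -- cases.
    K-suspended : ∀ R → R u ≡ true → R v ≡ true →
                  K t adj⁻ (R ∩ nearby) ≡ (1ℚ ℚ.+ (t ℚ.+ t)) ℚ.* K t adj (R ∩ common)
    K-suspended R Ru Rv = begin
      K t adj⁻ W
        ≡⟨ K-delete t adj⁻ adj⁻-symm adj⁻-irrefl W u (cong₂ _∧_ Ru nearby-u) ⟩
      K t adj⁻ (W ∖ u) ℚ.+ t ℚ.* K t adj⁻ (W ∩ adj⁻ u)
        ≡⟨ cong₂ (λ a b → a ℚ.+ t ℚ.* b)
             (K-delete t adj⁻ adj⁻-symm adj⁻-irrefl (W ∖ u) v (≡.trans (∖-other W (u≢v ∘ sym)) (cong₂ _∧_ Rv nearby-v)))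
             (core (W ∩ adj⁻ u) at-u₁ at-v₁ rest₁) ⟩
      (K t adj⁻ ((W ∖ u) ∖ v) ℚ.+ t ℚ.* K t adj⁻ ((W ∖ u) ∩ adj⁻ v)) ℚ.+ t ℚ.* C
        ≡⟨ cong₂ (λ a b → (a ℚ.+ t ℚ.* b) ℚ.+ t ℚ.* C)
             (core ((W ∖ u) ∖ v) (≡.trans (∖-other (W ∖ u) u≢v) (∖-self W u)) (∖-self (W ∖ u) v) rest₂)
             (core ((W ∖ u) ∩ adj⁻ v) (cong (_∧ adj⁻ v u) (∖-self W u)) at-v₃ rest₃) ⟩
      (C ℚ.+ t ℚ.* C) ℚ.+ t ℚ.* C
        ≡⟨ solve 2 (λ c t → (c :+ t :* c) :+ t :* c := (con 1ℚ :+ (t :+ t)) :* c) refl C t ⟩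
      (1ℚ ℚ.+ (t ℚ.+ t)) ℚ.* C ∎
      where
      open +-*-Solver
      W : VertexSet n
      W = R ∩ nearby
      C : ℚ
      C = K t adj (R ∩ common)
      core : ∀ S → S u ≡ false → S v ≡ false → (∀ i → i ≢ u → i ≢ v → S i ≡ R i ∧ common i) → K t adj⁻ S ≡ C
      core S Su Sv rest = ≡.trans (K⁻-avoiding S (inj₁ Su)) (K-ext t adj pointwise)
        where
        pointwise : ∀ i → S i ≡ R i ∧ common i
        pointwise = edge-cases (λ i → S i ≡ R i ∧ common i)
          (≡.trans Su (sym (≡.trans (cong (R u ∧_) common-u) (∧-zeroʳ (R u)))))
          (≡.trans Sv (sym (≡.trans (cong (R v ∧_) common-v) (∧-zeroʳ (R v)))))
          rest
      W-rest : ∀ i → i ≢ u → i ≢ v → W i ≡ R i ∧ common i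
      W-rest i i≢u i≢v = cong (R i ∧_) (nearby-away i≢u i≢v)
      absorbˡ : ∀ r a b → (r ∧ (a ∧ b)) ∧ a ≡ r ∧ (a ∧ b)
      absorbˡ false _     _     = refl
      absorbˡ true  false _     = refl
      absorbˡ true  true  false = refl
      absorbˡ true  true  true  = refl
      absorbʳ : ∀ r a b → (r ∧ (a ∧ b)) ∧ b ≡ r ∧ (a ∧ b)
      absorbʳ r a b = ≡.trans (cong (λ z → (r ∧ z) ∧ b) (∧-comm a b))
                        (≡.trans (absorbˡ r b a) (cong (r ∧_) (∧-comm b a)))
      at-u₁ : (W ∩ adj⁻ u) u ≡ false
      at-u₁ = ≡.trans (cong (W u ∧_) (adj⁻-irrefl u)) (∧-zeroʳ (W u))
      at-v₁ : (W ∩ adj⁻ u) v ≡ false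
      at-v₁ = ≡.trans (cong (W v ∧_) adj⁻-uv) (∧-zeroʳ (W v))
      rest₁ : ∀ i → i ≢ u → i ≢ v → (W ∩ adj⁻ u) i ≡ R i ∧ common i
      rest₁ i i≢u i≢v = ≡.trans
          (cong₂ _∧_ (W-rest i i≢u i≢v) (≡.trans (adj⁻-symm u i) (≡.trans (adj⁻-away i≢u i≢v) (symm i u))))
                               (absorbˡ (R i) (adj u i) (adj v i))
      rest₂ : ∀ i → i ≢ u → i ≢ v → ((W ∖ u) ∖ v) i ≡ R i ∧ common i
      rest₂ i i≢u i≢v = ≡.trans (∖-other (W ∖ u) i≢v) (≡.trans (∖-other W i≢u) (W-rest i i≢u i≢v))
      at-v₃ : ((W ∖ u) ∩ adj⁻ v) v ≡ false
      at-v₃ = ≡.trans (cong ((W ∖ u) v ∧_) (adj⁻-irrefl v)) (∧-zeroʳ ((W ∖ u) v))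
      rest₃ : ∀ i → i ≢ u → i ≢ v → ((W ∖ u) ∩ adj⁻ v) i ≡ R i ∧ common i
      rest₃ i i≢u i≢v = ≡.trans (cong₂ _∧_ (≡.trans (∖-other W i≢u) (W-rest i i≢u i≢v))
                                          (≡.trans (adj⁻-symm v i) (≡.trans (adj⁻-away i≢u i≢v) (symm i v))))
                               (absorbʳ (R i) (adj u i) (adj v i))

    module _ (σ : List (Fin n)) (σu : lk adj σ u ≡ true) (σv : lk adj σ v ≡ true) where

      private
        R : VertexSet n
        R = lk adj σ

        core≡lk : ∀ i → (R ∩ common) i ≡ lk adj (u ∷ v ∷ σ) i
        core≡lk i = ≡.trans (∧-comm (R i) (common i)) (∧-assoc (adj u i) (adj v i) (R i))

      -- Cliques with the new vertex contribute `t (1 + 2 t)` times the count for the link of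
      -- `u ∷ v ∷ σ`, and those lost with the edge `uv` cost `t * t` times it; the difference is
      -- `t + t * t`.
      K-lk-disjoint : K t adj′ (lk adj′ (map suc σ)) ≡
                      K t adj (lk adj σ) ℚ.+ (t ℚ.+ t ℚ.* t) ℚ.* K t adj (lk adj (u ∷ v ∷ σ))
      K-lk-disjoint = begin
        K t adj′ (lk adj′ (map suc σ))
          ≡⟨ cong₂ ℚ._+_ (K-ext t adj⁻ (lk′-old σ σu σv))
               (≡.trans (cong (if_then t ℚ.* K t adj⁻ ((lk adj′ (map suc σ) ∘ suc) ∩ nearby) else 0ℚ) (lk′-new σ σu σv))
                        (cong (t ℚ.*_) (K-ext t adj⁻ (λ i → cong (_∧ nearby i) (lk′-old σ σu σv i))))) ⟩
        K t adj⁻ R ℚ.+ t ℚ.* K t adj⁻ (R ∩ nearby)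
          ≡⟨ cong (λ z → K t adj⁻ R ℚ.+ t ℚ.* z) (K-suspended R σu σv) ⟩
        K t adj⁻ R ℚ.+ t ℚ.* ((1ℚ ℚ.+ (t ℚ.+ t)) ℚ.* C)
          ≡⟨ solve 3 (λ a c t → a :+ t :* ((con 1ℚ :+ (t :+ t)) :* c) := (a :+ t :* (t :* c)) :+
              (t :+ t :* t) :* c) refl (K t adj⁻ R) C t ⟩
        (K t adj⁻ R ℚ.+ t ℚ.* (t ℚ.* C)) ℚ.+ (t ℚ.+ t ℚ.* t) ℚ.* C
          ≡⟨ cong₂ (λ a c → a ℚ.+ (t ℚ.+ t ℚ.* t) ℚ.* c) (sym (K-removeEdge R σu σv)) (K-ext t adj core≡lk) ⟩
        K t adj R ℚ.+ (t ℚ.+ t ℚ.* t) ℚ.* K t adj (lk adj (u ∷ v ∷ σ)) ∎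
        where
        open +-*-Solver
        C : ℚ
        C = K t adj (R ∩ common)

      -- The neighbours of the new vertex form a suspension, and joining `σ` to it cuts the
      -- suspended link down to that of `u ∷ v ∷ σ`.
      K-lk-newVertex : K t adj′ (lk adj′ (zero ∷ map suc σ)) ≡ (1ℚ ℚ.+ (t ℚ.+ t)) ℚ.* K t adj (lk adj (u ∷ v ∷ σ))
      K-lk-newVertex = begin
        K t adj′ (lk adj′ (zero ∷ map suc σ))
          ≡⟨ ℚ.+-identityʳ _ ⟩
        K t adj⁻ (λ i → nearby i ∧ lk adj′ (map suc σ) (suc i))
          ≡⟨ K-ext t adj⁻ (λ i → ≡.trans (∧-comm (nearby i) _) (cong (_∧ nearby i) (lk′-old σ σu σv i))) ⟩
        K t adj⁻ (R ∩ nearby)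
          ≡⟨ K-suspended R σu σv ⟩
        (1ℚ ℚ.+ (t ℚ.+ t)) ℚ.* K t adj (R ∩ common)
          ≡⟨ cong ((1ℚ ℚ.+ (t ℚ.+ t)) ℚ.*_) (K-ext t adj core≡lk) ⟩
        (1ℚ ℚ.+ (t ℚ.+ t)) ℚ.* K t adj (lk adj (u ∷ v ∷ σ)) ∎

      -- Being adjacent to both `u` and the midpoint excludes `v` and forces adjacency to `v`:
      -- exactly the old common neighbours of `u` and `v` remain. Hence a half of the edge can be
      -- subdivided again with the same effect.
      K-lk-halfEdge : K t adj′ (lk adj′ (suc u ∷ zero ∷ map suc σ)) ≡ K t adj (lk adj (u ∷ v ∷ σ))
      K-lk-halfEdge = begin
        K t adj′ (lk adj′ (suc u ∷ zero ∷ map suc σ))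
          ≡⟨ cong (λ b → K t adj⁻ S ℚ.+ (if b then t ℚ.* K t adj⁻ (S ∩ nearby) else 0ℚ)) (∧-zeroʳ (nearby u)) ⟩
        K t adj⁻ S ℚ.+ 0ℚ
          ≡⟨ ℚ.+-identityʳ _ ⟩
        K t adj⁻ S
          ≡⟨ K-ext t adj⁻ pointwise ⟩
        K t adj⁻ (lk adj (u ∷ v ∷ σ))
          ≡⟨ K⁻-avoiding (lk adj (u ∷ v ∷ σ)) (inj₁ (cong (_∧ (adj v u ∧ R u)) (irrefl u))) ⟩
        K t adj (lk adj (u ∷ v ∷ σ)) ∎
        where
        S : VertexSet n
        S i = adj⁻ u i ∧ (nearby i ∧ lk adj′ (map suc σ) (suc i))
        idem : ∀ a b r → a ∧ ((a ∧ b) ∧ r) ≡ a ∧ (b ∧ r)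
        idem false _ _ = refl
        idem true  _ _ = refl
        pointwise : ∀ i → S i ≡ lk adj (u ∷ v ∷ σ) i
        pointwise = edge-cases (λ i → S i ≡ lk adj (u ∷ v ∷ σ) i)
          (≡.trans (cong (_∧ (nearby u ∧ lk adj′ (map suc σ) (suc u))) (adj⁻-irrefl u))
              (sym (cong (_∧ (adj v u ∧ R u)) (irrefl u))))
          (≡.trans (cong (_∧ (nearby v ∧ lk adj′ (map suc σ) (suc v))) adj⁻-uv)
            (sym (≡.trans (cong (λ b → adj u v ∧ (b ∧ R v)) (irrefl v)) (∧-zeroʳ (adj u v)))))
          λ i i≢u i≢v → ≡.trans
            (cong₂ _∧_ (≡.trans (adj⁻-symm u i) (≡.trans (adj⁻-away i≢u i≢v) (symm i u)))
                       (cong₂ _∧_ (nearby-away i≢u i≢v) (lk′-old σ σu σv i)))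
            (idem (adj u i) (adj v i) (R i))

      -- Around a face that contains `u` but not `v`, the midpoint merely takes over the role of
      -- `v`. The first step in the definition of `K`, at `zero`, therefore matches `K-delete` at
      -- `v` in the old graph.
      K-lk-sharing : K t adj′ (lk adj′ (suc u ∷ map suc σ)) ≡ K t adj (lk adj (u ∷ σ))
      K-lk-sharing = begin
        K t adj′ (lk adj′ (suc u ∷ map suc σ))
          ≡⟨ cong (λ b → K t adj⁻ S ℚ.+ (if b then t ℚ.* K t adj⁻ (S ∩ nearby) else 0ℚ))
                  (cong₂ _∧_ nearby-u (lk′-new σ σu σv)) ⟩
        K t adj⁻ S ℚ.+ t ℚ.* K t adj⁻ (S ∩ nearby)
          ≡⟨ cong₂ (λ a b → a ℚ.+ t ℚ.* b) (K-ext t adj⁻ S≗) (K-ext t adj⁻ S∩≗) ⟩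
        K t adj⁻ (M ∖ v) ℚ.+ t ℚ.* K t adj⁻ (M ∩ adj v)
          ≡⟨ cong₂ (λ a b → a ℚ.+ t ℚ.* b) (K⁻-avoiding (M ∖ v) (inj₂ (∖-self M v)))
                   (K⁻-avoiding (M ∩ adj v) (inj₁ (cong (_∧ adj v u) M-u))) ⟩
        K t adj (M ∖ v) ℚ.+ t ℚ.* K t adj (M ∩ adj v)
          ≡⟨ K-delete t adj symm irrefl M v (cong₂ _∧_ uv σv) ⟨
        K t adj M ∎
        where
        S M : VertexSet n
        S i = adj⁻ u i ∧ lk adj′ (map suc σ) (suc i)
        M = lk adj (u ∷ σ)
        M-u : M u ≡ false
        M-u = cong (_∧ R u) (irrefl u)
        shuffle : ∀ a b r → (a ∧ b) ∧ r ≡ (a ∧ r) ∧ b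
        shuffle a b r = ≡.trans (∧-assoc a b r) (≡.trans (cong (a ∧_) (∧-comm b r)) (sym (∧-assoc a r b)))
        S≗ : ∀ i → S i ≡ (M ∖ v) i
        S≗ i rewrite isEdge-u i | lk′-old σ σu σv i = shuffle (adj u i) (not (i == v)) (R i)
        absorb : ∀ a b r → (a ∧ r) ∧ (a ∧ b) ≡ (a ∧ r) ∧ b
        absorb false _ _ = refl
        absorb true  _ _ = refl
        S∩≗ : ∀ i → (S ∩ nearby) i ≡ (M ∩ adj v) i
        S∩≗ i = ≡.trans (cong (_∧ nearby i) (S≗ i)) (by-cases i)
          where
          by-cases : ∀ i → (M ∖ v) i ∧ nearby i ≡ M i ∧ adj v i
          by-cases = edge-cases (λ i → (M ∖ v) i ∧ nearby i ≡ M i ∧ adj v i)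
            (≡.trans (cong (λ b → (b ∧ _) ∧ nearby u) M-u) (sym (cong (_∧ adj v u) M-u)))
            (≡.trans (cong (_∧ nearby v) (∖-self M v))
              (sym (≡.trans (cong (M v ∧_) (irrefl v)) (∧-zeroʳ (M v)))))
            λ i i≢u i≢v → ≡.trans (cong₂ _∧_ (∖-other M i≢v) (nearby-away i≢u i≢v)) (absorb (adj u i) (adj v i) (R i))

-- Real numbers

private
  module ≈ = Setoid ℝ-setoid

≈-refl : ∀ {x} → x ≈ x
≈-refl {x} = ≈.refl {x}

≈-sym : ∀ {x y} → x ≈ y → y ≈ x
≈-sym {x} {y} = ≈.sym {x} {y}

≈-trans : ∀ {x y z} → x ≈ y → y ≈ z → x ≈ z
≈-trans {x} {y} {z} = ≈.trans {x} {y} {z}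

-- A linear inequality is reduced to a known one by a ring identity between the
-- differences of their sides.
<-by : ∀ {a b x y} → x ℚ.< y → b ℚ.- a ≡ y ℚ.- x → a ℚ.< b
<-by {a} {b} {x} {y} x<y eq = subst₂ ℚ._<_
  (solve 2 (λ a x → x :+ (a :- x) := a) refl a x)
  (≡.trans (solve 3 (λ a x y → y :+ (a :- x) := (y :- x) :+ a) refl a x y)
    (≡.trans (cong (ℚ._+ a) (sym eq)) (solve 2 (λ a b → (b :- a) :+ a := b) refl a b)))
  (ℚ.+-monoˡ-< (a ℚ.- x) x<y)
  where open +-*-Solver

≤-by : ∀ {a b x y} → x ℚ.≤ y → b ℚ.- a ≡ y ℚ.- x → a ℚ.≤ b
≤-by {a} {b} {x} {y} x≤y eq = subst₂ ℚ._≤_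
  (solve 2 (λ a x → x :+ (a :- x) := a) refl a x)
  (≡.trans (solve 3 (λ a x y → y :+ (a :- x) := (y :- x) :+ a) refl a x y)
    (≡.trans (cong (ℚ._+ a) (sym eq)) (solve 2 (λ a b → (b :- a) :+ a := b) refl a b)))
  (ℚ.+-monoˡ-≤ (a ℚ.- x) x≤y)
  where open +-*-Solver

half : ℚ → ℚ
half e = ½ ℚ.* e

half-sum : ∀ e → half e ℚ.+ half e ≡ e
half-sum e = ≡.trans (sym (ℚ.*-distribʳ-+ e ½ ½)) (ℚ.*-identityˡ e)

0<half : ∀ {e} → 0ℚ ℚ.< e → 0ℚ ℚ.< half e
0<half {e} 0<e = subst (ℚ._< half e) (ℚ.*-zeroʳ ½) (ℚ.*-monoʳ-<-pos ½ 0<e)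

half<self : ∀ {e} → 0ℚ ℚ.< e → half e ℚ.< e
half<self {e} 0<e = <-by (0<half 0<e) (≡.trans (cong (ℚ._- half e) (sym (half-sum e)))
  (solve 1 (λ h → (h :+ h) :- h := h :- con 0ℚ) refl (half e)))
  where open +-*-Solver

0<e+f : ∀ {e f} → 0ℚ ℚ.< e → 0ℚ ℚ.< f → 0ℚ ℚ.< e ℚ.+ f
0<e+f = ℚ.+-mono-<

0<e*f : ∀ {e f} → 0ℚ ℚ.< e → 0ℚ ℚ.< f → 0ℚ ℚ.< e ℚ.* f
0<e*f {e} {f} 0<e 0<f = subst (ℚ._< e ℚ.* f) (ℚ.*-zeroʳ e) (ℚ.*-monoʳ-<-pos e {{ℚ.positive 0<e}} 0<f)

0≤e*f : ∀ {e f} → 0ℚ ℚ.≤ e → 0ℚ ℚ.≤ f → 0ℚ ℚ.≤ e ℚ.* f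
0≤e*f {e} {f} 0≤e 0≤f = subst (ℚ._≤ e ℚ.* f) (ℚ.*-zeroʳ e) (ℚ.*-monoˡ-≤-nonNeg e {{ℚ.nonNegative 0≤e}} 0≤f)

square-mono-≤ : ∀ {a b} → 0ℚ ℚ.≤ a → a ℚ.≤ b → a ℚ.* a ℚ.≤ b ℚ.* b
square-mono-≤ {a} {b} 0≤a a≤b = ℚ.≤-trans
  (ℚ.*-monoˡ-≤-nonNeg a {{ℚ.nonNegative 0≤a}} a≤b)
  (ℚ.*-monoʳ-≤-nonNeg b {{ℚ.nonNegative (ℚ.≤-trans 0≤a a≤b)}} a≤b)

square-mono-< : ∀ {a b} → 0ℚ ℚ.≤ a → a ℚ.< b → a ℚ.* a ℚ.< b ℚ.* b
square-mono-< {a} {b} 0≤a a<b = ℚ.≤-<-trans (ℚ.*-monoˡ-≤-nonNeg a {{ℚ.nonNegative 0≤a}} (ℚ.<⇒≤ a<b))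
  (ℚ.*-monoˡ-<-pos b {{ℚ.positive (ℚ.≤-<-trans 0≤a a<b)}} a<b)

square-cancel-< : ∀ {a b} → 0ℚ ℚ.≤ b → a ℚ.* a ℚ.< b ℚ.* b → a ℚ.< b
square-cancel-< {a} {b} 0≤b lt with a ℚ.<? b
... | yes a<b = a<b
... | no  a≮b = contradiction (ℚ.<-≤-trans lt (square-mono-≤ 0≤b (ℚ.≮⇒≥ a≮b))) (ℚ.<-irrefl refl)

0≤square : ∀ a → 0ℚ ℚ.≤ a ℚ.* a
0≤square a with ℚ.≤-total 0ℚ a
... | inj₁ 0≤a = 0≤e*f 0≤a 0≤a
... | inj₂ a≤0 = subst (0ℚ ℚ.≤_) (solve 1 (λ a → (:- a) :* (:- a) := a :* a) refl a)
                   (0≤e*f (ℚ.neg-antimono-≤ a≤0) (ℚ.neg-antimono-≤ a≤0))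
  where open +-*-Solver

≤-abs : ∀ p → p ℚ.≤ ℚ.∣ p ∣
≤-abs p with ℚ.≤-total 0ℚ p
... | inj₁ 0≤p = ℚ.≤-reflexive (sym (ℚ.0≤p⇒∣p∣≡p 0≤p))
... | inj₂ p≤0 = ℚ.≤-trans p≤0 (ℚ.0≤∣p∣ p)

-- Two linear inequalities in place of `∣ a - b ∣ < e`, so that `<-by` applies to each of them.
record Near (e a b : ℚ) : Set where
  constructor _,_
  field
    below : a ℚ.< b ℚ.+ e
    above : b ℚ.< a ℚ.+ e

open Near

abs⇒Near : ∀ {e a b} → ℚ.∣ a ℚ.- b ∣ ℚ.< e → Near e a b
abs⇒Near {e} {a} {b} lt =
  <-by (ℚ.≤-<-trans (≤-abs (a ℚ.- b)) lt) (solve 3 (λ a b e → (b :+ e) :- a := e :- (a :- b)) refl a b e) ,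
  <-by (ℚ.≤-<-trans (≤-abs (ℚ.- (a ℚ.- b))) (subst (ℚ._< e) (sym (ℚ.∣-p∣≡∣p∣ (a ℚ.- b))) lt))
       (solve 3 (λ a b e → (a :+ e) :- b := e :- (:- (a :- b))) refl a b e)
  where open +-*-Solver

Near⇒abs : ∀ {e a b} → Near e a b → ℚ.∣ a ℚ.- b ∣ ℚ.< e
Near⇒abs {e} {a} {b} (a<b+e , b<a+e) with ℚ.∣p∣≡p∨∣p∣≡-p (a ℚ.- b)
... | inj₁ eq = subst (ℚ._< e) (sym eq) (<-by a<b+e (solve 3 (λ a b e → e :- (a :- b) := (b :+ e) :- a) refl a b e))
  where open +-*-Solver
... | inj₂ eq = subst (ℚ._< e) (sym eq) (<-by b<a+e (solve 3 (λ a b e → e :- (:- (a :- b)) := (a :+ e) :- b) refl a b e))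
  where open +-*-Solver

<+ : ∀ {a e} → 0ℚ ℚ.< e → a ℚ.< a ℚ.+ e
<+ {a} {e} 0<e = <-by 0<e (solve 2 (λ a e → (a :+ e) :- a := e :- con 0ℚ) refl a e)
  where open +-*-Solver

Near-refl : ∀ {e a} → 0ℚ ℚ.< e → Near e a a
Near-refl 0<e = <+ 0<e , <+ 0<e

Near-sym : ∀ {e a b} → Near e a b → Near e b a
Near-sym (p , q) = q , p

Near-≤ : ∀ {e f a b} → e ℚ.≤ f → Near e a b → Near f a b
Near-≤ {a = a} {b} e≤f (p , q) = ℚ.<-≤-trans p (ℚ.+-monoʳ-≤ b e≤f) , ℚ.<-≤-trans q (ℚ.+-monoʳ-≤ a e≤f)

Near-+ : ∀ {e f a b a′ b′} → Near e a b → Near f a′ b′ → Near (e ℚ.+ f) (a ℚ.+ a′) (b ℚ.+ b′)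
Near-+ {e} {f} {a} {b} {a′} {b′} (p , q) (p′ , q′) =
  <-by (ℚ.+-mono-< p p′) (cong (ℚ._- (a ℚ.+ a′)) (shuffle b b′)) ,
  <-by (ℚ.+-mono-< q q′) (cong (ℚ._- (b ℚ.+ b′)) (shuffle a a′))
  where
  open +-*-Solver
  shuffle : ∀ x y → (x ℚ.+ y) ℚ.+ (e ℚ.+ f) ≡ (x ℚ.+ e) ℚ.+ (y ℚ.+ f)
  shuffle x y = solve 4 (λ x y e f → (x :+ y) :+ (e :+ f) := (x :+ e) :+ (y :+ f)) refl x y e f

Near-+½ : ∀ {e a b a′ b′} → Near (half e) a b → Near (half e) a′ b′ → Near e (a ℚ.+ a′) (b ℚ.+ b′)
Near-+½ {e} p q = subst (λ f → Near f _ _) (half-sum e) (Near-+ p q)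

Near-neg : ∀ {e a b} → Near e a b → Near e (ℚ.- a) (ℚ.- b)
Near-neg {e} {a} {b} (p , q) =
  <-by q (solve 3 (λ a b e → ((:- b) :+ e) :- (:- a) := (a :+ e) :- b) refl a b e) ,
  <-by p (solve 3 (λ a b e → ((:- a) :+ e) :- (:- b) := (b :+ e) :- a) refl a b e)
  where open +-*-Solver

⊓-mono-< : ∀ {a b c d} → a ℚ.< c → b ℚ.< d → a ℚ.⊓ b ℚ.< c ℚ.⊓ d
⊓-mono-< {a} {b} {c} {d} a<c b<d with ℚ.⊓-sel c d
... | inj₁ eq = subst (a ℚ.⊓ b ℚ.<_) (sym eq) (ℚ.≤-<-trans (ℚ.p⊓q≤p a b) a<c)
... | inj₂ eq = subst (a ℚ.⊓ b ℚ.<_) (sym eq) (ℚ.≤-<-trans (ℚ.p⊓q≤q a b) b<d)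

+-distribʳ-⊓ : ∀ e a b → a ℚ.⊓ b ℚ.+ e ≡ (a ℚ.+ e) ℚ.⊓ (b ℚ.+ e)
+-distribʳ-⊓ e = ℚ.mono-≤-distrib-⊓ (ℚ.+-monoˡ-≤ e)

Near-⊓ : ∀ {e a b a′ b′} → Near e a b → Near e a′ b′ → Near e (a ℚ.⊓ a′) (b ℚ.⊓ b′)
Near-⊓ {e} {a} {b} {a′} {b′} (p , q) (p′ , q′) =
  subst (_ ℚ.<_) (sym (+-distribʳ-⊓ e b b′)) (⊓-mono-< p p′) ,
  subst (_ ℚ.<_) (sym (+-distribʳ-⊓ e a a′)) (⊓-mono-< q q′)

Near-* : ∀ {d B a b a′ b′} → 0ℚ ℚ.< B → ℚ.∣ a ∣ ℚ.≤ B → ℚ.∣ b′ ∣ ℚ.≤ B → Near d a b → Near d a′ b′ →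
         Near (B ℚ.* d ℚ.+ B ℚ.* d) (a ℚ.* a′) (b ℚ.* b′)
Near-* {d} {B} {a} {b} {a′} {b′} 0<B ∣a∣≤B ∣b′∣≤B p p′ = abs⇒Near
  (subst (λ z → ℚ.∣ z ∣ ℚ.< B ℚ.* d ℚ.+ B ℚ.* d)
    (solve 4 (λ a b a′ b′ → a :* (a′ :- b′) :+ b′ :* (a :- b) := a :* a′ :- b :* b′) refl a b a′ b′)
    (ℚ.≤-<-trans (ℚ.∣p+q∣≤∣p∣+∣q∣ (a ℚ.* (a′ ℚ.- b′)) (b′ ℚ.* (a ℚ.- b)))
        (ℚ.+-mono-< (bound a (a′ ℚ.- b′) ∣a∣≤B (Near⇒abs p′)) (bound b′ (a ℚ.- b) ∣b′∣≤B (Near⇒abs p)))))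
  where
  open +-*-Solver
  bound : ∀ x y → ℚ.∣ x ∣ ℚ.≤ B → ℚ.∣ y ∣ ℚ.< d → ℚ.∣ x ℚ.* y ∣ ℚ.< B ℚ.* d
  bound x y x≤B y<d = subst (ℚ._< B ℚ.* d) (sym (ℚ.∣p*q∣≡∣p∣*∣q∣ x y)) (ℚ.≤-<-trans
    (ℚ.*-monoʳ-≤-nonNeg ℚ.∣ y ∣ {{ℚ.∣-∣-nonNeg y}} x≤B)
    (ℚ.*-monoʳ-<-pos B {{ℚ.positive 0<B}} y<d))

divide : ∀ {A e} → 0ℚ ℚ.< A → 0ℚ ℚ.< e → ∃ λ d → 0ℚ ℚ.< d × A ℚ.* d ≡ e
divide {A} {e} 0<A 0<e = inv ℚ.* e , 0<e*f (ℚ.positive⁻¹ inv {{ℚ.1/pos⇒pos A}}) 0<e ,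
  ≡.trans (sym (ℚ.*-assoc A inv e)) (≡.trans (cong (ℚ._* e) (ℚ.*-inverseʳ A)) (ℚ.*-identityˡ e))
  where
  instance
    A-pos : ℚ.Positive A
    A-pos = ℚ.positive 0<A
    A-nonZero : ℚ.NonZero A
    A-nonZero = ℚ.pos⇒nonZero A
  inv : ℚ
  inv = ℚ.1/ A

-- Eventual properties of Cauchy sequences, order and minimum of reals

Eventually : (ℕ → Set) → Set
Eventually P = ∃ λ N → ∀ n → N ℕ.≤ n → P n

always : ∀ {P} → (∀ n → P n) → Eventually P
always p = 0 , λ n _ → p n

ev-map : ∀ {P Q : ℕ → Set} → (∀ n → P n → Q n) → Eventually P → Eventually Q
ev-map f (N , p) = N , λ n N≤n → f n (p n N≤n)

ev-map₂ : ∀ {P Q R : ℕ → Set} → (∀ n → P n → Q n → R n) → Eventually P → Eventually Q → Eventually R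
ev-map₂ f (M , p) (N , q) = M ℕ.⊔ N , λ n le →
  f n (p n (ℕ.m⊔n≤o⇒m≤o M N le)) (q n (ℕ.m⊔n≤o⇒n≤o M N le))

ev-both : ∀ {P Q : ℕ → Set} → Eventually P → Eventually Q → Eventually (λ n → P n × Q n)
ev-both = ev-map₂ (λ _ p q → p , q)

ev-now : ∀ {P : ℕ → Set} → Eventually P → ∃ P
ev-now (N , p) = N , p N ℕ.≤-refl

Close : ℚ → ℝ → ℝ → Set
Close e x y = Eventually λ n → Near e (seq x n) (seq y n)

≈⇒Close : ∀ {x y} → x ≈ y → ∀ {e} → 0ℚ ℚ.< e → Close e x y
≈⇒Close x≈y {e} 0<e = ev-map (λ _ → abs⇒Near) (x≈y e 0<e)

Close⇒≈ : ∀ {x y} → (∀ {e} → 0ℚ ℚ.< e → Close e x y) → x ≈ y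
Close⇒≈ close e 0<e = ev-map (λ _ → Near⇒abs) (close 0<e)

pointwise⇒≈ : ∀ {x y} → (∀ n → seq x n ≡ seq y n) → x ≈ y
pointwise⇒≈ {x} {y} eq = Close⇒≈ {x} {y} λ 0<e → always λ n → subst (Near _ (seq x n)) (eq n) (Near-refl 0<e)

+-cong : ∀ {x y x′ y′} → x ≈ y → x′ ≈ y′ → x + x′ ≈ y + y′
+-cong {x} {y} {x′} {y′} p q = Close⇒≈ {x + x′} {y + y′} λ 0<e →
  ev-map₂ (λ _ → Near-+½) (≈⇒Close {x} {y} p (0<half 0<e)) (≈⇒Close {x′} {y′} q (0<half 0<e))

-‿cong : ∀ {x y} → x ≈ y → - x ≈ - y
-‿cong {x} {y} p = Close⇒≈ { - x} { - y} λ 0<e → ev-map (λ _ → Near-neg) (≈⇒Close {x} {y} p 0<e)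

bounded : ∀ x → ∃ λ B → 0ℚ ℚ.< B × Eventually λ n → ℚ.∣ seq x n ∣ ℚ.≤ B
bounded x with cauchy x 1ℚ (ℚ.positive⁻¹ 1ℚ)
... | N , close = ℚ.∣ seq x N ∣ ℚ.+ 1ℚ , ℚ.+-mono-≤-< (ℚ.0≤∣p∣ (seq x N)) (ℚ.positive⁻¹ 1ℚ) ,
  N , λ n N≤n → ℚ.≤-trans
    (subst (λ z → ℚ.∣ z ∣ ℚ.≤ ℚ.∣ seq x N ∣ ℚ.+ ℚ.∣ seq x n ℚ.- seq x N ∣)
      (solve 2 (λ a b → b :+ (a :- b) := a) refl (seq x n) (seq x N))
      (ℚ.∣p+q∣≤∣p∣+∣q∣ (seq x N) (seq x n ℚ.- seq x N)))
    (ℚ.+-monoʳ-≤ ℚ.∣ seq x N ∣ (ℚ.<⇒≤ (close n N N≤n ℕ.≤-refl)))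
  where open +-*-Solver

*-cong : ∀ {x y x′ y′} → x ≈ y → x′ ≈ y′ → x * x′ ≈ y * y′
*-cong {x} {y} {x′} {y′} p q = Close⇒≈ {x * x′} {y * y′} close
  where
  A B : ℚ
  A = proj₁ (bounded x)
  B = proj₁ (bounded y′)
  0<A : 0ℚ ℚ.< A
  0<A = proj₁ (proj₂ (bounded x))
  0<B : 0ℚ ℚ.< B
  0<B = proj₁ (proj₂ (bounded y′))
  0<A+B : 0ℚ ℚ.< A ℚ.+ B
  0<A+B = 0<e+f 0<A 0<B
  A≤ : A ℚ.≤ A ℚ.+ B
  A≤ = subst (ℚ._≤ A ℚ.+ B) (ℚ.+-identityʳ A) (ℚ.+-monoʳ-≤ A (ℚ.<⇒≤ 0<B))
  B≤ : B ℚ.≤ A ℚ.+ B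
  B≤ = subst (ℚ._≤ A ℚ.+ B) (ℚ.+-identityˡ B) (ℚ.+-monoˡ-≤ B (ℚ.<⇒≤ 0<A))
  close : ∀ {e} → 0ℚ ℚ.< e → Close e (x * x′) (y * y′)
  close {e} 0<e = let d , 0<d , eq = divide 0<A+B (0<half 0<e) in ev-map₂
    (λ n (near , near′) (b , b′) →
      subst (λ f → Near f (seq x n ℚ.* seq x′ n) (seq y n ℚ.* seq y′ n)) (≡.trans (cong₂ ℚ._+_ eq eq) (half-sum e))
        (Near-* 0<A+B (ℚ.≤-trans b A≤) (ℚ.≤-trans b′ B≤) near near′))
    (ev-both (≈⇒Close {x} {y} p 0<d) (≈⇒Close {x′} {y′} q 0<d))
    (ev-both (proj₂ (proj₂ (bounded x))) (proj₂ (proj₂ (bounded y′))))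

infixl 7 _⊓_

_⊓_ : ℝ → ℝ → ℝ
x ⊓ y = mkℝ (λ n → seq x n ℚ.⊓ seq y n) λ e 0<e → let (M , p) = cauchy x e 0<e ; (N , q) = cauchy y e 0<e in
  M ℕ.⊔ N , λ m n u v → Near⇒abs (Near-⊓
    (abs⇒Near {a = seq x m} {seq x n} (p m n (ℕ.m⊔n≤o⇒m≤o M N u) (ℕ.m⊔n≤o⇒m≤o M N v)))
    (abs⇒Near {a = seq y m} {seq y n} (q m n (ℕ.m⊔n≤o⇒n≤o M N u) (ℕ.m⊔n≤o⇒n≤o M N v))))

Ev≤ : ℝ → ℝ → Set
Ev≤ x y = ∀ {e} → 0ℚ ℚ.< e → Eventually λ n → seq x n ℚ.< seq y n ℚ.+ e

Ev≤⇒≤ : ∀ {x y} → Ev≤ x y → x ≤ y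
Ev≤⇒≤ x≤y (e , 0<e , y<x) with ev-now (ev-map₂ (λ _ → ℚ.<-trans) (x≤y 0<e) y<x)
... | _ , lt = ℚ.<-irrefl refl lt

-- Turns a negated strict inequality into positive information. From index `k` on both sequences
-- move by less than `d = e / 8`. An excess of `x` over `y` by more than `e / 2` at `k` would
-- persist with margin `2 d` and give `y < x`; so the decidable comparison at `k` has the other
-- outcome, and later indices add at most `2 d` to `e / 2`.
≤⇒Ev≤ : ∀ {x y} → x ≤ y → Ev≤ x y
≤⇒Ev≤ {x} {y} x≤y {e} 0<e = k , λ n k≤n → let (r , _) , (_ , s) = near n k≤n in
  <-by (ℚ.+-mono-< (ℚ.+-mono-<-≤ r bound) (ℚ.+-mono-< s (0<e+f 0<d 0<d))) (≡.trans
    (cong (λ z → (seq y n ℚ.+ z) ℚ.- seq x n) e≡) (≡.trans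
    (solve 5 (λ a b c z h → (c :+ (((h :+ h) :+ (h :+ h)) :+ ((h :+ h) :+ (h :+ h)))) :- z :=
        (((a :+ h) :+ (b :+ ((h :+ h) :+ (h :+ h)))) :+ ((c :+ h) :+ (h :+ h))) :- ((z :+ a) :+ (b :+ con 0ℚ)))
      refl (seq x k) (seq y k) (seq y n) (seq x n) d)
    (cong (λ z → (((seq x k ℚ.+ d) ℚ.+ (seq y k ℚ.+ z)) ℚ.+ ((seq y n ℚ.+ d) ℚ.+ (d ℚ.+ d))) ℚ.-
        ((seq x n ℚ.+ seq x k) ℚ.+ (seq y k ℚ.+ 0ℚ)))
      (sym ½e≡))))
  where
  open +-*-Solver
  d : ℚ
  d = half (half (half e))
  0<d : 0ℚ ℚ.< d
  0<d = 0<half (0<half (0<half 0<e))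
  M N k : ℕ
  M = proj₁ (cauchy x d 0<d)
  N = proj₁ (cauchy y d 0<d)
  k = M ℕ.⊔ N
  near : ∀ n → k ℕ.≤ n → Near d (seq x n) (seq x k) × Near d (seq y n) (seq y k)
  near n k≤n =
    abs⇒Near (proj₂ (cauchy x d 0<d) n k (ℕ.m⊔n≤o⇒m≤o M N k≤n) (ℕ.m≤m⊔n M N)) ,
    abs⇒Near (proj₂ (cauchy y d 0<d) n k (ℕ.m⊔n≤o⇒n≤o M N k≤n) (ℕ.m≤n⊔m M N))
  ½e≡ : half e ≡ (d ℚ.+ d) ℚ.+ (d ℚ.+ d)
  ½e≡ = sym (≡.trans (cong₂ ℚ._+_ (half-sum (half (half e))) (half-sum (half (half e)))) (half-sum (half e)))
  e≡ : e ≡ ((d ℚ.+ d) ℚ.+ (d ℚ.+ d)) ℚ.+ ((d ℚ.+ d) ℚ.+ (d ℚ.+ d))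
  e≡ = ≡.trans (sym (half-sum e)) (cong₂ ℚ._+_ ½e≡ ½e≡)
  bound : seq x k ℚ.≤ seq y k ℚ.+ half e
  bound = ℚ.≮⇒≥ λ lt → x≤y (d ℚ.+ d , 0<e+f 0<d 0<d , k , λ n k≤n → let (_ , r) , (s , _) = near n k≤n in
    <-by (ℚ.+-mono-< lt (ℚ.+-mono-< r s)) (≡.trans
      (solve 5 (λ a b c z h → z :- (c :+ (h :+ h)) :=
          (a :+ ((z :+ h) :+ (b :+ h))) :- ((b :+ ((h :+ h) :+ (h :+ h))) :+ (a :+ c)))
        refl (seq x k) (seq y k) (seq y n) (seq x n) d)
      (cong (λ z → (seq x k ℚ.+ ((seq x n ℚ.+ d) ℚ.+ (seq y k ℚ.+ d))) ℚ.- ((seq y k ℚ.+ z) ℚ.+ (seq x k ℚ.+ seq y n)))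
        (sym ½e≡))))

pointwise⇒≤ : ∀ {x y} → (∀ n → seq x n ℚ.≤ seq y n) → x ≤ y
pointwise⇒≤ {x} {y} x≤y = Ev≤⇒≤ {x} {y} λ 0<e → always λ n → ℚ.≤-<-trans (x≤y n) (<+ 0<e)

≤-antisym : ∀ {x y} → x ≤ y → y ≤ x → x ≈ y
≤-antisym {x} {y} x≤y y≤x = Close⇒≈ {x} {y} λ 0<e →
  ev-map₂ (λ _ → _,_) (≤⇒Ev≤ {x} {y} x≤y 0<e) (≤⇒Ev≤ {y} {x} y≤x 0<e)

≈⇒≤ : ∀ {x y} → x ≈ y → x ≤ y
≈⇒≤ {x} {y} x≈y = Ev≤⇒≤ {x} {y} λ 0<e → ev-map (λ _ → below) (≈⇒Close {x} {y} x≈y 0<e)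

<-≤-trans : ∀ {x y z} → x < y → y ≤ z → x < z
<-≤-trans {x} {y} {z} (e , 0<e , x<y) y≤z = half e , 0<half 0<e ,
  ev-map₂ (λ n lt le → <-by (ℚ.+-mono-< lt le) (step n)) x<y (≤⇒Ev≤ {y} {z} y≤z (0<half 0<e))
  where
  open +-*-Solver
  step : ∀ n → seq z n ℚ.- (seq x n ℚ.+ half e) ≡ (seq y n ℚ.+ (seq z n ℚ.+ half e)) ℚ.- ((seq x n ℚ.+ e) ℚ.+ seq y n)
  step n = ≡.trans
    (solve 4 (λ x y z h → z :- (x :+ h) := (y :+ (z :+ h)) :- ((x :+ (h :+ h)) :+ y)) refl (seq x n) (seq y n) (seq z n)
        (half e))
    (cong (λ f → (seq y n ℚ.+ (seq z n ℚ.+ half e)) ℚ.- ((seq x n ℚ.+ f) ℚ.+ seq y n)) (half-sum e))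

≤-trans : ∀ {x y z} → x ≤ y → y ≤ z → x ≤ z
≤-trans {x} {y} {z} x≤y y≤z z<x = y≤z (<-≤-trans {z} {x} {y} z<x x≤y)

0≤+ : ∀ {x y} → 0ℝ ≤ x → 0ℝ ≤ y → 0ℝ ≤ x + y
0≤+ {x} {y} 0≤x 0≤y = Ev≤⇒≤ {0ℝ} {x + y} λ {e} 0<e → ev-map₂
  (λ n p q → subst (0ℚ ℚ.<_)
    (≡.trans (solve 3 (λ x y h → (x :+ h) :+ (y :+ h) := (x :+ y) :+ (h :+ h)) refl (seq x n) (seq y n) (half e))
             (cong (seq x n ℚ.+ seq y n ℚ.+_) (half-sum e)))
    (ℚ.+-mono-< p q))
  (≤⇒Ev≤ {0ℝ} {x} 0≤x (0<half 0<e)) (≤⇒Ev≤ {0ℝ} {y} 0≤y (0<half 0<e))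
  where open +-*-Solver

+≤0 : ∀ {x y} → x ≤ 0ℝ → y ≤ 0ℝ → x + y ≤ 0ℝ
+≤0 {x} {y} x≤0 y≤0 = Ev≤⇒≤ {x + y} {0ℝ} λ {e} 0<e → ev-map₂
  (λ n p q → subst (seq x n ℚ.+ seq y n ℚ.<_)
    (≡.trans (solve 1 (λ h → (con 0ℚ :+ h) :+ (con 0ℚ :+ h) := con 0ℚ :+ (h :+ h)) refl (half e))
             (cong (0ℚ ℚ.+_) (half-sum e)))
    (ℚ.+-mono-< p q))
  (≤⇒Ev≤ {x} {0ℝ} x≤0 (0<half 0<e)) (≤⇒Ev≤ {y} {0ℝ} y≤0 (0<half 0<e))
  where open +-*-Solver

0<⇒Ev : ∀ {x} → 0ℝ < x → Eventually λ n → 0ℚ ℚ.< seq x n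
0<⇒Ev (e , 0<e , lt) = ev-map (λ _ → ℚ.<-trans (subst (0ℚ ℚ.<_) (sym (ℚ.+-identityˡ e)) 0<e)) lt

0≤⊓ : ∀ {x y} → 0ℝ ≤ x → 0ℝ ≤ y → 0ℝ ≤ x ⊓ y
0≤⊓ {x} {y} 0≤x 0≤y = Ev≤⇒≤ {0ℝ} {x ⊓ y} λ {e} 0<e → ev-map₂
  (λ n p q → subst₂ ℚ._<_ (ℚ.⊓-idem 0ℚ) (sym (+-distribʳ-⊓ e (seq x n) (seq y n))) (⊓-mono-< p q))
  (≤⇒Ev≤ {0ℝ} {x} 0≤x 0<e) (≤⇒Ev≤ {0ℝ} {y} 0≤y 0<e)

⊓≤ˡ : ∀ x y → x ⊓ y ≤ x
⊓≤ˡ x y = pointwise⇒≤ {x ⊓ y} {x} λ n → ℚ.p⊓q≤p (seq x n) (seq y n)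

⊓≤ʳ : ∀ x y → x ⊓ y ≤ y
⊓≤ʳ x y = pointwise⇒≤ {x ⊓ y} {y} λ n → ℚ.p⊓q≤q (seq x n) (seq y n)

-- Which of the two vanishes cannot be decided. But `_≤_` is a negation, so for `x ⊓ y ≤ 0ℝ` it is
-- enough that a positive minimum would make both positive.
⊓-zero : ∀ {x y} → 0ℝ ≤ x → 0ℝ ≤ y → ¬ (0ℝ < x × 0ℝ < y) → x ⊓ y ≈ 0ℝ
⊓-zero {x} {y} 0≤x 0≤y disjoint = ≤-antisym {x ⊓ y} {0ℝ}
  (λ 0<m → disjoint (<-≤-trans {0ℝ} {x ⊓ y} {x} 0<m (⊓≤ˡ x y) , <-≤-trans {0ℝ} {x ⊓ y} {y} 0<m (⊓≤ʳ x y)))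
  (0≤⊓ {x} {y} 0≤x 0≤y)

⊓-cong : ∀ {x y x′ y′} → x ≈ y → x′ ≈ y′ → x ⊓ x′ ≈ y ⊓ y′
⊓-cong {x} {y} {x′} {y′} p q = Close⇒≈ {x ⊓ x′} {y ⊓ y′} λ 0<e →
  ev-map₂ (λ _ → Near-⊓) (≈⇒Close {x} {y} p 0<e) (≈⇒Close {x′} {y′} q 0<e)

-- Integers as rationals, and square roots of reals

ι : ℤ → ℚ
ι i = i ℚ./ 1

private
  toℚᵘ-ι : ∀ i → ℚ.toℚᵘ (ι i) ℚᵘ.≃ ℚᵘ.mkℚᵘ i 0
  toℚᵘ-ι i = ℚ.toℚᵘ-fromℚᵘ (ℚᵘ.mkℚᵘ i 0)

ι-homo-+ : ∀ i j → ι (i ℤ.+ j) ≡ ι i ℚ.+ ι j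
ι-homo-+ i j = ℚ.toℚᵘ-injective (ℚᵘ.≃-trans (toℚᵘ-ι (i ℤ.+ j)) (ℚᵘ.≃-sym (ℚᵘ.≃-trans (ℚ.toℚᵘ-homo-+ (ι i) (ι j))
  (ℚᵘ.≃-trans (ℚᵘ.+-cong (toℚᵘ-ι i) (toℚᵘ-ι j))
    (ℚᵘ.*≡* (cong (ℤ._* + 1) (cong₂ ℤ._+_ (ℤ.*-identityʳ i) (ℤ.*-identityʳ j))))))))

ι-homo-* : ∀ i j → ι (i ℤ.* j) ≡ ι i ℚ.* ι j
ι-homo-* i j = ℚ.toℚᵘ-injective (ℚᵘ.≃-trans (toℚᵘ-ι (i ℤ.* j)) (ℚᵘ.≃-sym (ℚᵘ.≃-trans (ℚ.toℚᵘ-homo-* (ι i) (ι j))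
  (ℚᵘ.*-cong (toℚᵘ-ι i) (toℚᵘ-ι j)))))

ι-mono-< : ∀ {i j} → i ℤ.< j → ι i ℚ.< ι j
ι-mono-< {i} {j} i<j = ℚ.toℚᵘ-cancel-< (ℚᵘ.<-respˡ-≃ (ℚᵘ.≃-sym (toℚᵘ-ι i)) (ℚᵘ.<-respʳ-≃ (ℚᵘ.≃-sym (toℚᵘ-ι j))
  (ℚᵘ.*<* (subst₂ ℤ._<_ (sym (ℤ.*-identityʳ i)) (sym (ℤ.*-identityʳ j)) i<j))))

ι-mono-≤ : ∀ {i j} → i ℤ.≤ j → ι i ℚ.≤ ι j
ι-mono-≤ {i} {j} i≤j = ℚ.toℚᵘ-cancel-≤ (ℚᵘ.≤-respˡ-≃ (ℚᵘ.≃-sym (toℚᵘ-ι i)) (ℚᵘ.≤-respʳ-≃ (ℚᵘ.≃-sym (toℚᵘ-ι j))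
  (ℚᵘ.*≤* (subst₂ ℤ._≤_ (sym (ℤ.*-identityʳ i)) (sym (ℤ.*-identityʳ j)) i≤j))))

-- The rational `1 / (n + 1)`: the denominator is stored as its predecessor.
δ : ℕ → ℚ
δ n = mkℚ (+ 1) n (Coprimality.1-coprimeTo (suc n))

0<δ : ∀ n → 0ℚ ℚ.< δ n
0<δ n = ℚ.positive⁻¹ (δ n)

δ-small : ∀ {e} → 0ℚ ℚ.< e → Eventually λ n → δ n ℚ.< e
δ-small {mkℚ (+ zero) d _} (*<* (ℤ.+<+ ()))
δ-small {mkℚ (+ suc k) d _} _ = suc d , λ n d<n → *<* (ℤ.+<+ (ℕ.s≤s
  (ℕ.≤-trans (ℕ.≤-reflexive (ℕ.+-identityʳ _)) (ℕ.≤-trans d<n (ℕ.m≤m+n n (k ℕ.* suc n))))))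
δ-small {mkℚ -[1+ k ] d _} (*<* ())

ι-δ : ∀ n → ι (+ suc n) ℚ.* δ n ≡ 1ℚ
ι-δ n = ≡.trans (cong (ℚ._* δ n) (ℚ.normalize-coprime {suc n} {0} (Coprimality.sym (Coprimality.1-coprimeTo (suc n)))))
                (ℚ.*-inverseˡ (δ n))

-- `r` approximates the square root of `q` from below with error less than `δ n`, expressed without
-- mentioning the root.
IsRoot : ℕ → ℚ → ℚ → Set
IsRoot n q r = 0ℚ ℚ.≤ r × r ℚ.* r ℚ.≤ q × q ℚ.< (r ℚ.+ δ n) ℚ.* (r ℚ.+ δ n)

private
  grid : ℕ → ℕ → ℚ
  grid n k = ι (+ k) ℚ.* δ n

  grid-suc : ∀ n k → grid n (suc k) ≡ grid n k ℚ.+ δ n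
  grid-suc n k = ≡.trans (cong (ℚ._* δ n) (≡.trans (ι-homo-+ (+ 1) (+ k)) (ℚ.+-comm 1ℚ (ι (+ k)))))
    (≡.trans (ℚ.*-distribʳ-+ (δ n) (ι (+ k)) 1ℚ) (cong (grid n k ℚ.+_) (ℚ.*-identityˡ (δ n))))

  -- Walks down the multiples of `δ n` from one whose square exceeds `q` to the first whose square
  -- does not; its upper neighbour, one `δ n` away, still does.
  search : ∀ n q → 0ℚ ℚ.≤ q → ∀ k → q ℚ.< grid n k ℚ.* grid n k → ∃ (IsRoot n q)
  search n q 0≤q zero q<0 = contradiction
    (ℚ.≤-<-trans 0≤q (subst (q ℚ.<_) (≡.trans (cong₂ ℚ._*_ (ℚ.*-zeroˡ (δ n)) (ℚ.*-zeroˡ (δ n))) (ℚ.*-zeroˡ 0ℚ)) q<0))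
    (ℚ.<-irrefl refl)
  search n q 0≤q (suc k) q<s with q ℚ.<? grid n k ℚ.* grid n k
  ... | yes q<g = search n q 0≤q k q<g
  ... | no  q≮g = grid n k , 0≤e*f (ι-mono-≤ {+ 0} {+ k} (ℤ.+≤+ ℕ.z≤n)) (ℚ.<⇒≤ (0<δ n)) , ℚ.≮⇒≥ q≮g ,
                  subst (λ g → q ℚ.< g ℚ.* g) (grid-suc n k) q<s

  0≤⇒≤ι : ∀ q → 0ℚ ℚ.≤ q → ∃ λ k → q ℚ.≤ ι (+ k)
  0≤⇒≤ι q@(mkℚ (+ a) d _) _ = a , ℚ.≤-trans {q} {mkℚ (+ a) 0 (Coprimality.sym (Coprimality.1-coprimeTo a))}
    (*≤* (ℤ.*-monoˡ-≤-nonNeg (+ a) (ℤ.+≤+ (ℕ.s≤s ℕ.z≤n))))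
    (ℚ.≤-reflexive (sym (ℚ.normalize-coprime {a} {0} (Coprimality.sym (Coprimality.1-coprimeTo a)))))
  0≤⇒≤ι (mkℚ -[1+ a ] d _) (*≤* ())

abstract
  -- The search starts at the integer `k + 1` for some `k ≥ q`, whose square exceeds `k`; on the
  -- grid it has index `(k + 1) (n + 1)`. Being abstract, the search is not unfolded during type
  -- checking.
  root : ∀ n q → 0ℚ ℚ.≤ q → ∃ (IsRoot n q)
  root n q 0≤q = search n q 0≤q (suc k ℕ.* suc n) (subst (λ g → q ℚ.< g ℚ.* g) (sym grid≡) (ℚ.≤-<-trans q≤k k<))
    where
    k : ℕ
    k = proj₁ (0≤⇒≤ι q 0≤q)
    q≤k : q ℚ.≤ ι (+ k)
    q≤k = proj₂ (0≤⇒≤ι q 0≤q)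
    grid≡ : grid n (suc k ℕ.* suc n) ≡ ι (+ suc k)
    grid≡ = ≡.trans (cong (ℚ._* δ n) (≡.trans (cong ι (ℤ.pos-* (suc k) (suc n))) (ι-homo-* (+ suc k) (+ suc n))))
      (≡.trans (ℚ.*-assoc (ι (+ suc k)) (ι (+ suc n)) (δ n))
        (≡.trans (cong (ι (+ suc k) ℚ.*_) (ι-δ n)) (ℚ.*-identityʳ (ι (+ suc k)))))
    k< : ι (+ k) ℚ.< ι (+ suc k) ℚ.* ι (+ suc k)
    k< = subst (ι (+ k) ℚ.<_) (ι-homo-* (+ suc k) (+ suc k))
           (ι-mono-< (ℤ.+<+ (ℕ.s≤s (ℕ.m≤m+n k (k ℕ.* suc k)))))

-- Subadditivity of the square root: `(s + δ n + e)²` is at least `(s + δ n)² + e²`, which exceeds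
-- `q + e²`. The modulus `e * e` works uniformly, including near zero where the square root is not
-- Lipschitz.
root-mono : ∀ {m n p q r s e} → 0ℚ ℚ.< e → IsRoot m p r → IsRoot n q s → p ℚ.< q ℚ.+ e ℚ.* e → r ℚ.< s ℚ.+ (δ n ℚ.+ e)
root-mono {m} {n} {p} {q} {r} {s} {e} 0<e (_ , r²≤p , _) (0≤s , _ , q<) p<q+e² = square-cancel-<
  (ℚ.<⇒≤ (ℚ.≤-<-trans 0≤s (<+ (0<e+f (0<δ n) 0<e))))
  (ℚ.≤-<-trans r²≤p (ℚ.<-trans p<q+e² (<-by (ℚ.+-mono-<-≤ q< cross≥0)
    (solve 4 (λ s d e q → (s :+ (d :+ e)) :* (s :+ (d :+ e)) :- (q :+ e :* e) :=
       ((s :+ d) :* (s :+ d) :+ ((s :+ d) :* e :+ (s :+ d) :* e)) :- (q :+ con 0ℚ)) refl s (δ n) e q))))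
  where
  open +-*-Solver
  0≤s+δ : 0ℚ ℚ.≤ s ℚ.+ δ n
  0≤s+δ = ℚ.<⇒≤ (ℚ.≤-<-trans 0≤s (<+ (0<δ n)))
  cross≥0 : 0ℚ ℚ.≤ (s ℚ.+ δ n) ℚ.* e ℚ.+ (s ℚ.+ δ n) ℚ.* e
  cross≥0 = ℚ.+-mono-≤ (0≤e*f 0≤s+δ (ℚ.<⇒≤ 0<e)) (0≤e*f 0≤s+δ (ℚ.<⇒≤ 0<e))

root-near : ∀ {m n p q r s e} → 0ℚ ℚ.< e → δ m ℚ.< e → δ n ℚ.< e → IsRoot m p r → IsRoot n q s →
            Near (e ℚ.* e) p q → Near (e ℚ.+ e) r s
root-near {m} {n} {p} {q} {r} {s} {e} 0<e δm<e δn<e rp sq near =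
  ℚ.<-trans (root-mono {m} {n} 0<e rp sq (below near)) (ℚ.+-monoʳ-< s (ℚ.+-monoˡ-< e δn<e)) ,
  ℚ.<-trans (root-mono {n} {m} 0<e sq rp (above near)) (ℚ.+-monoʳ-< r (ℚ.+-monoˡ-< e δm<e))

Near-abs : ∀ {e a b} → Near e a b → Near e ℚ.∣ a ∣ ℚ.∣ b ∣
Near-abs {e} {a} {b} near = one-side near , one-side (Near-sym near)
  where
  open +-*-Solver
  one-side : ∀ {a b} → Near e a b → ℚ.∣ a ∣ ℚ.< ℚ.∣ b ∣ ℚ.+ e
  one-side {a} {b} near = subst (λ z → ℚ.∣ z ∣ ℚ.< ℚ.∣ b ∣ ℚ.+ e) (solve 2 (λ a b → b :+ (a :- b) := a) refl a b)
    (ℚ.≤-<-trans (ℚ.∣p+q∣≤∣p∣+∣q∣ b (a ℚ.- b)) (ℚ.+-monoʳ-< ℚ.∣ b ∣ (Near⇒abs near)))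

abs-root : ∀ n q → ∃ (IsRoot n ℚ.∣ q ∣)
abs-root n q = root n ℚ.∣ q ∣ (ℚ.0≤∣p∣ q)

private
  √-seq : ℝ → ℕ → ℚ
  √-seq x n = proj₁ (abs-root n (seq x n))

  √-near : ∀ x y m n {e} → 0ℚ ℚ.< e → δ m ℚ.< half e → δ n ℚ.< half e →
           Near (half e ℚ.* half e) (seq x m) (seq y n) → Near e (√-seq x m) (√-seq y n)
  √-near x y m n {e} 0<e δm δn near = subst (λ f → Near f (√-seq x m) (√-seq y n)) (half-sum e)
    (root-near {m} {n} (0<half 0<e) δm δn (proj₂ (abs-root m (seq x m))) (proj₂ (abs-root n (seq y n))) (Near-abs near))

  √-cauchy : ∀ x → Cauchy (√-seq x)
  √-cauchy x e 0<e =
    let M , p = cauchy x (half e ℚ.* half e) (0<e*f (0<half 0<e) (0<half 0<e))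
        N , q = δ-small (0<half 0<e)
    in M ℕ.⊔ N , λ m n u v → Near⇒abs (√-near x x m n 0<e
      (q m (ℕ.m⊔n≤o⇒n≤o M N u)) (q n (ℕ.m⊔n≤o⇒n≤o M N v))
      (abs⇒Near {a = seq x m} {seq x n} (p m n (ℕ.m⊔n≤o⇒m≤o M N u) (ℕ.m⊔n≤o⇒m≤o M N v))))

-- √ x is the square root of ∣ x ∣, which makes it total.
√ : ℝ → ℝ
√ x = mkℝ (√-seq x) (√-cauchy x)

√-isRoot : ∀ x n → IsRoot n ℚ.∣ seq x n ∣ (seq (√ x) n)
√-isRoot x n = proj₂ (abs-root n (seq x n))

√-close : ∀ {x y e} → 0ℚ ℚ.< e → Close (half e ℚ.* half e) x y → Close e (√ x) (√ y)
√-close {x} {y} 0<e = ev-map₂ (λ n small near → √-near x y n n 0<e small small near) (δ-small (0<half 0<e))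

0≤√ : ∀ x → 0ℝ ≤ √ x
0≤√ x = pointwise⇒≤ {0ℝ} {√ x} λ n → proj₁ (√-isRoot x n)

-- A nonnegative real may have negative entries `a`, but eventually `a > - e / 2`. Then
-- `- a < a + e`, so the approximate root of `a * a`, which is close to `- a`, still stays below
-- `a + e`.
√-square : ∀ {x} → 0ℝ ≤ x → √ (x * x) ≈ x
√-square {x} 0≤x = Close⇒≈ {√ (x * x)} {x} λ {e} 0<e → ev-map₂ (λ n → near n 0<e)
  (δ-small (0<half 0<e)) (≤⇒Ev≤ {0ℝ} {x} 0≤x (0<half 0<e))
  where
  open +-*-Solver
  near : ∀ n {e} → 0ℚ ℚ.< e → δ n ℚ.< half e → 0ℚ ℚ.< seq x n ℚ.+ half e → Near e (seq (√ (x * x)) n) (seq x n)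
  near n {e} 0<e small pos = upper , lower
    where
    r a : ℚ
    r = seq (√ (x * x)) n
    a = seq x n
    r-root : IsRoot n (a ℚ.* a) r
    r-root = subst (λ q → IsRoot n q r) (ℚ.0≤p⇒∣p∣≡p (0≤square a)) (√-isRoot (x * x) n)
    0≤r : 0ℚ ℚ.≤ r
    0≤r = proj₁ r-root
    lower : a ℚ.< r ℚ.+ e
    lower = ℚ.<-trans (square-cancel-< (ℚ.<⇒≤ (ℚ.≤-<-trans 0≤r (<+ (0<δ n)))) (proj₂ (proj₂ r-root)))
                      (ℚ.+-monoʳ-< r (ℚ.<-trans small (half<self 0<e)))
    upper : r ℚ.< a ℚ.+ e
    upper with ℚ.≤-total 0ℚ a
    ... | inj₁ 0≤a = ℚ.≤-<-trans (ℚ.≮⇒≥ λ a<r → ℚ.<-irrefl refl (ℚ.<-≤-trans (square-mono-< 0≤a a<r) (proj₁ (proj₂ r-root)))) (<+ 0<e)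
    ... | inj₂ a≤0 = square-cancel-< (ℚ.<⇒≤ 0<a+e) (ℚ.≤-<-trans (proj₁ (proj₂ r-root)) a²<)
      where
      0<-a+a+e : 0ℚ ℚ.< (a ℚ.+ e) ℚ.- (ℚ.- a)
      0<-a+a+e = subst (0ℚ ℚ.<_) (≡.trans
        (solve 2 (λ a h → (a :+ h) :+ (a :+ h) := (a :+ (h :+ h)) :- (:- a)) refl a (half e))
        (cong (λ z → (a ℚ.+ z) ℚ.- (ℚ.- a)) (half-sum e))) (0<e+f pos pos)
      -a<a+e : ℚ.- a ℚ.< a ℚ.+ e
      -a<a+e = <-by 0<-a+a+e (sym (ℚ.+-identityʳ _))
      0<a+e : 0ℚ ℚ.< a ℚ.+ e
      0<a+e = ℚ.≤-<-trans (ℚ.neg-antimono-≤ a≤0) -a<a+e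
      a²< : a ℚ.* a ℚ.< (a ℚ.+ e) ℚ.* (a ℚ.+ e)
      a²< = <-by (0<e*f 0<-a+a+e 0<e)
          (solve 2 (λ a e → (a :+ e) :* (a :+ e) :- a :* a := ((a :+ e) :- (:- a)) :* e :- con 0ℚ) refl a e)

square-√ : ∀ {x} → 0ℝ ≤ x → √ x * √ x ≈ x
square-√ {x} 0≤x = Close⇒≈ {√ x * √ x} {x} close
  where
  open +-*-Solver
  B : ℚ
  B = proj₁ (bounded (√ x))
  0<B : 0ℚ ℚ.< B
  0<B = proj₁ (proj₂ (bounded (√ x)))
  C : ℚ
  -- `(r + δ n)²` exceeds `r * r` by `(2 r + δ n) δ n`; with `r ≤ B` and `δ n < 1` this is at most
  -- `C` times `δ n`.
  C = (B ℚ.+ B) ℚ.+ 1ℚ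
  0<C : 0ℚ ℚ.< C
  0<C = 0<e+f (0<e+f 0<B 0<B) (ℚ.positive⁻¹ 1ℚ)
  abs-close : ∀ {e} → 0ℚ ℚ.< e → Eventually λ n → ℚ.∣ seq x n ∣ ℚ.< seq x n ℚ.+ e
  abs-close {e} 0<e = ev-map (λ n → near n) (≤⇒Ev≤ {0ℝ} {x} 0≤x (0<half 0<e))
    where
    near : ∀ n → 0ℚ ℚ.< seq x n ℚ.+ half e → ℚ.∣ seq x n ∣ ℚ.< seq x n ℚ.+ e
    near n pos with ℚ.∣p∣≡p∨∣p∣≡-p (seq x n)
    ... | inj₁ eq = subst (ℚ._< seq x n ℚ.+ e) (sym eq) (<+ 0<e)
    ... | inj₂ eq = subst (ℚ._< seq x n ℚ.+ e) (sym eq) (<-by (0<e+f pos pos) (≡.trans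
      (cong (λ z → (seq x n ℚ.+ z) ℚ.- (ℚ.- seq x n)) (sym (half-sum e)))
      (solve 2 (λ a h → (a :+ (h :+ h)) :- (:- a) := ((a :+ h) :+ (a :+ h)) :- con 0ℚ) refl (seq x n) (half e))))
  close : ∀ {e} → 0ℚ ℚ.< e → Close e (√ x * √ x) x
  close {e} 0<e = let d , 0<d , eq = divide 0<C 0<e in
    ev-map₂ (λ n (b , ax) (small , δ<1) → near n d 0<d eq b ax small δ<1)
      (ev-both (proj₂ (proj₂ (bounded (√ x)))) (abs-close 0<e))
      (ev-both (δ-small 0<d) (δ-small (ℚ.positive⁻¹ 1ℚ)))
    where
    near : ∀ n d → 0ℚ ℚ.< d → C ℚ.* d ≡ e → ℚ.∣ seq (√ x) n ∣ ℚ.≤ B → ℚ.∣ seq x n ∣ ℚ.< seq x n ℚ.+ e →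
           δ n ℚ.< d → δ n ℚ.< 1ℚ → Near e (seq (√ x) n ℚ.* seq (√ x) n) (seq x n)
    near n d 0<d eq bound ax small δ<1 = ℚ.≤-<-trans (proj₁ (proj₂ r-root)) ax ,
      ℚ.≤-<-trans (≤-abs a) (ℚ.<-trans (proj₂ (proj₂ r-root)) (<-by error (≡.trans
        (solve 3 (λ r f e → (r :* r :+ e) :- (r :+ f) :* (r :+ f) := e :- ((r :+ r) :+ f) :* f) refl r (δ n) e)
        (cong (ℚ._- ((r ℚ.+ r) ℚ.+ δ n) ℚ.* δ n) (sym eq)))))
      where
      r a : ℚ
      r = seq (√ x) n
      a = seq x n
      r-root : IsRoot n ℚ.∣ a ∣ r
      r-root = √-isRoot x n
      r≤B : r ℚ.≤ B
      r≤B = ℚ.≤-trans (≤-abs r) bound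
      error : ((r ℚ.+ r) ℚ.+ δ n) ℚ.* δ n ℚ.< C ℚ.* d
      error = ℚ.≤-<-trans
        (ℚ.*-monoʳ-≤-nonNeg (δ n) {{ℚ.nonNegative (ℚ.<⇒≤ (0<δ n))}} (ℚ.+-mono-≤ (ℚ.+-mono-≤ r≤B r≤B) (ℚ.<⇒≤ δ<1)))
        (ℚ.*-monoʳ-<-pos C {{ℚ.positive 0<C}} small)

-- Edge subdivision: homeomorphism

-- Radii are rational and closeness is that of the representing sequences. This single condition on
-- a map of the ambient spaces gives both continuity of its restriction and compatibility with
-- `_≈_`.
UniformlyContinuous : ∀ {m n} → Pred (Vector ℝ m) 0ℓ → (Vector ℝ m → Vector ℝ n) → Set
UniformlyContinuous P f = ∀ {e} → 0ℚ ℚ.< e → Σ[ d ∈ ℚ ] 0ℚ ℚ.< d ×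
  (∀ {x y} → P x → P y → (∀ i → Close d (x i) (y i)) → ∀ j → Close e (f x j) (f y j))

private
  within⇒close : ∀ {m} {d} {x y : Vector ℝ m} → Within (fromℚ d) x y → ∀ i → Close d (x i) (y i)
  within⇒close {d = d} {x} {y} within i = ev-map₂ (λ _ → _,_)
    (weaken (x i) (y i + fromℚ d) (proj₁ (within i))) (weaken (y i) (x i + fromℚ d) (proj₂ (within i)))
    where
    weaken : ∀ x y → x < y → Eventually (λ n → seq x n ℚ.< seq y n)
    weaken _ _ (e , 0<e , lt) = ev-map (λ n → ℚ.<-trans (<+ 0<e)) lt

  close⇒within : ∀ {m} {ε e} {x y : Vector ℝ m} → 0ℚ ℚ.< e → Eventually (λ n → 0ℚ ℚ.+ e ℚ.< seq ε n) →
                 (∀ i → Close (half e) (x i) (y i)) → Within ε x y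
  close⇒within {ε = ε} {e} {x} {y} 0<e e<ε close i =
    (half e , 0<half 0<e , ev-map₂ (λ n near lt → step (seq (x i) n) (seq (y i) n) (seq ε n) (Near.below near) lt)
        (close i) e<ε) ,
    (half e , 0<half 0<e , ev-map₂ (λ n near lt → step (seq (y i) n) (seq (x i) n) (seq ε n) (Near.above near) lt)
        (close i) e<ε)
    where
    open +-*-Solver
    step : ∀ a b c → a ℚ.< b ℚ.+ half e → 0ℚ ℚ.+ e ℚ.< c → a ℚ.+ half e ℚ.< b ℚ.+ c
    step a b c p q = <-by (ℚ.+-mono-< p q) (≡.trans
      (solve 4 (λ a b c h → (b :+ c) :- (a :+ h) := ((b :+ h) :+ c) :- (a :+ (con 0ℚ :+ (h :+ h)))) refl a b c (half e))
      (cong (λ f → ((b ℚ.+ half e) ℚ.+ c) ℚ.- (a ℚ.+ (0ℚ ℚ.+ f))) (half-sum e)))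

module _ {m n} {P : Pred (Vector ℝ m) 0ℓ} {Q : Pred (Vector ℝ n) 0ℓ} (f : Vector ℝ m → Vector ℝ n)
         (f-maps : ∀ {x} → P x → Q (f x)) (uc : UniformlyContinuous P f) where

  restrict : Σ (Vector ℝ m) P → Σ (Vector ℝ n) Q
  restrict (x , Px) = f x , f-maps Px

  restrict-continuous : Continuous {P = P} {Q = Q} restrict
  restrict-continuous (x , Px) ε (e , 0<e , e<ε) = let d , 0<d , close = uc (0<half 0<e) in
    fromℚ d ,
    (half d , 0<half 0<d , always (λ _ → subst (ℚ._< d) (sym (ℚ.+-identityˡ (half d))) (half<self 0<d))) ,
    λ (y , Py) within → close⇒within {ε = ε} {x = f x} {f y} 0<e e<ε (close Px Py (within⇒close {x = x} {y} within))

  restrict-cong : ∀ {x y} → P x → P y → (∀ i → x i ≈ y i) → ∀ j → f x j ≈ f y j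
  restrict-cong {x} {y} Px Py x≈y j = Close⇒≈ {f x j} {f y j} λ 0<e →
    let d , 0<d , close = uc 0<e in close Px Py (λ i → ≈⇒Close {x i} {y i} (x≈y i) 0<d) j

mkHomeomorphism : ∀ {m n} {P : Pred (Vector ℝ m) 0ℓ} {Q : Pred (Vector ℝ n) 0ℓ} (f : Vector ℝ m → Vector ℝ n)
    (g : Vector ℝ n → Vector ℝ m) →
  (∀ {x} → P x → Q (f x)) → (∀ {y} → Q y → P (g y)) → UniformlyContinuous P f → UniformlyContinuous Q g →
  (∀ {y} → Q y → ∀ j → f (g y) j ≈ y j) → (∀ {x} → P x → ∀ i → g (f x) i ≈ x i) → Homeomorphism P Q
mkHomeomorphism {P = P} {Q} f g f-maps g-maps f-uc g-uc fg gf = record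
  { bijection = record
    { to        = restrict {P = P} {Q} f f-maps f-uc
    ; from      = restrict {P = Q} {P} g g-maps g-uc
    ; to-cong   = λ {(_ , Px)} {(_ , Py)} → restrict-cong {P = P} {Q} f f-maps f-uc Px Py
    ; from-cong = λ {(_ , Qx)} {(_ , Qy)} → restrict-cong {P = Q} {P} g g-maps g-uc Qx Qy
    ; inverse   =
      (λ {(y , Qy)} {(x , Px)} x≈gy j → ≈-trans {f x j} {f (g y) j} {y j}
        (restrict-cong {P = P} {Q} f f-maps f-uc Px (g-maps Qy) x≈gy j) (fg Qy j)) ,
      (λ {(x , Px)} {(y , Qy)} y≈fx i → ≈-trans {g y i} {g (f x) i} {x i}
        (restrict-cong {P = Q} {P} g g-maps g-uc Qy (f-maps Px) y≈fx i) (gf Px i))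
    }
  ; to-continuous   = restrict-continuous {P = P} {Q} f f-maps f-uc
  ; from-continuous = restrict-continuous {P = Q} {P} g g-maps g-uc
  }

Homeomorphism-trans : ∀ {l m n} {P : Pred (Vector ℝ l) 0ℓ} {Q : Pred (Vector ℝ m) 0ℓ} {R : Pred (Vector ℝ n) 0ℓ} →
                      Homeomorphism P Q → Homeomorphism Q R → Homeomorphism P R
Homeomorphism-trans H₁ H₂ = record
  { bijection       = inverse H₁.bijection H₂.bijection
  ; to-continuous   = λ x ε 0<ε → let η , 0<η , p = H₂.to-continuous (H₁.to x) ε 0<ε
                                      δ , 0<δ , q = H₁.to-continuous x η 0<η
                                  in δ , 0<δ , λ y within → p (H₁.to y) (q y within)
  ; from-continuous = λ x ε 0<ε → let η , 0<η , p = H₁.from-continuous (H₂.from x) ε 0<ε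
                                      δ , 0<δ , q = H₂.from-continuous x η 0<η
                                  in δ , 0<δ , λ y within → p (H₂.from y) (q y within)
  }
  where
  module H₁ = Homeomorphism H₁
  module H₂ = Homeomorphism H₂

module _ {n} (G : Graph n) where
  open Graph G

  -- For a clique complex the support condition over all subsets is a condition on pairs. In this
  -- negative form it can be proved by refutation, without deciding which coordinates are positive.
  Disjoint : Vector ℝ n → Set
  Disjoint x = ∀ i j → i ≢ j → adj i j ≡ false → ¬ (0ℝ < x i × 0ℝ < x j)

  realization⇒disjoint : ∀ x → InRealization (cliqueComplex G) x → Disjoint x
  realization⇒disjoint x (_ , _ , clique) i j i≢j ij (0<xi , 0<xj) = contradiction
    (≡.trans (sym ij) (clique (⁅ i ⁆ ∪ ⁅ j ⁆) positive i j (x∈p∪q⁺ (inj₁ (x∈⁅x⁆ i))) (x∈p∪q⁺ (inj₂ (x∈⁅x⁆ j))) i≢j)) λ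
        ()
    where
    positive : ∀ k → k ∈ ⁅ i ⁆ ∪ ⁅ j ⁆ → 0ℝ < x k
    positive k k∈ with x∈p∪q⁻ ⁅ i ⁆ ⁅ j ⁆ k∈
    ... | inj₁ k∈i = subst (λ k → 0ℝ < x k) (sym (x∈⁅y⁆⇒x≡y i k∈i)) 0<xi
    ... | inj₂ k∈j = subst (λ k → 0ℝ < x k) (sym (x∈⁅y⁆⇒x≡y j k∈j)) 0<xj

  disjoint⇒clique : ∀ x → Disjoint x → ∀ τ → (∀ v → v ∈ τ → 0ℝ < x v) → IsClique adj τ
  disjoint⇒clique x disjoint τ positive i j i∈τ j∈τ i≢j with adj i j in ij
  ... | true  = refl
  ... | false = contradiction (positive i i∈τ , positive j j∈τ) (disjoint i j i≢j ij)

seq-Σ : ∀ {n} (x : Vector ℝ n) k → seq (Σℝ x) k ≡ Σℚ (λ i → seq (x i) k)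
seq-Σ {zero}  x k = refl
seq-Σ {suc n} x k = cong (seq (x zero) k ℚ.+_) (seq-Σ (x ∘ suc) k)

Σℚ-single : ∀ {n} (u : Fin n) z → Σℚ (λ i → if i == u then z else 0ℚ) ≡ z
Σℚ-single {suc n} zero    z = ≡.trans (cong (z ℚ.+_) (sum-replicate-zero n)) (ℚ.+-identityʳ z)
Σℚ-single {suc n} (suc u) z = ≡.trans (ℚ.+-identityˡ _) (Σℚ-single u z)

sel : Bool → ℝ → ℝ
sel b x = if b then x else 0ℝ

seq-sel : ∀ b x k → seq (sel b x) k ≡ (if b then seq x k else 0ℚ)
seq-sel true  x k = refl
seq-sel false x k = refl

0≤sel : ∀ b {x} → 0ℝ ≤ x → 0ℝ ≤ sel b x
0≤sel true      0≤x = 0≤x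
0≤sel false {x} _   = pointwise⇒≤ {0ℝ} {0ℝ} λ _ → ℚ.≤-refl

sel-cong : ∀ b {x y} → x ≈ y → sel b x ≈ sel b y
sel-cong true  x≈y = x≈y
sel-cong false _   = ≈-refl {0ℝ}

sel-close : ∀ b {e x y} → 0ℚ ℚ.< e → Close e x y → Close e (sel b x) (sel b y)
sel-close true  0<e close = close
sel-close false 0<e _     = always λ _ → Near-refl 0<e

halfℝ : ℝ → ℝ
halfℝ x = fromℚ ½ * x

0≤halfℝ : ∀ {x} → 0ℝ ≤ x → 0ℝ ≤ halfℝ x
0≤halfℝ {x} 0≤x = Ev≤⇒≤ {0ℝ} {halfℝ x} λ {e} 0<e → ev-map
  (λ n pos → <-by (ℚ.+-mono-< (0<half pos) (0<half 0<e)) (≡.trans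
    (cong (λ f → (half (seq x n) ℚ.+ f) ℚ.- 0ℚ) (sym (half-sum e)))
    (solve 2 (λ x e → (con ½ :* x :+ (con ½ :* e :+ con ½ :* e)) :- con 0ℚ := (con ½ :* (x :+ e) :+ con ½ :* e) :-
        (con 0ℚ :+ con 0ℚ)) refl (seq x n) e)))
  (≤⇒Ev≤ {0ℝ} {x} 0≤x 0<e)
  where open +-*-Solver

0<halfℝ⁻ : ∀ {x} → 0ℝ < halfℝ x → 0ℝ < x
0<halfℝ⁻ {x} (e , 0<e , lt) = e , 0<e , ev-map
  (λ n p → <-by (ℚ.+-mono-< (ℚ.+-mono-< p p) 0<e) (≡.trans
     (cong (ℚ._- (0ℚ ℚ.+ e)) (sym (half-sum (seq x n))))
     (solve 2 (λ h e → (h :+ h) :- (con 0ℚ :+ e) := ((h :+ h) :+ e) :-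
         (((con 0ℚ :+ e) :+ (con 0ℚ :+ e)) :+ con 0ℚ)) refl (half (seq x n)) e))) lt
  where open +-*-Solver

halfℝ-close : ∀ {e x y} → 0ℚ ℚ.< e → Close e x y → Close e (halfℝ x) (halfℝ y)
halfℝ-close {e} {x} {y} 0<e = ev-map λ n near →
  step (seq x n) (seq y n) (Near.below near) , step (seq y n) (seq x n) (Near.above near)
  where
  open +-*-Solver
  step : ∀ a b → a ℚ.< b ℚ.+ e → half a ℚ.< half b ℚ.+ e
  step a b lt = ℚ.<-trans
    (subst (half a ℚ.<_) (ℚ.*-distribˡ-+ ½ b e) (ℚ.*-monoʳ-<-pos ½ lt))
    (ℚ.+-monoʳ-< (half b) (half<self 0<e))

cancel-sel : ∀ b a {c h m} → c ≈ a + sel b h → m ≈ h → c + - sel b m ≈ a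
cancel-sel b a {c} {h} {m} c≈ m≈h = ≈-trans {c + - sel b m} {a + sel b h + - sel b h} {a}
  (+-cong {c} {a + sel b h} { - sel b m} { - sel b h} c≈
    (-‿cong {sel b m} {sel b h} (sel-cong b {m} {h} m≈h)))
  (pointwise⇒≈ {a + sel b h + - sel b h} {a} λ k →
    solve 2 (λ a s → (a :+ s) :+ (:- s) := a) refl (seq a k) (seq (sel b h) k))
  where open +-*-Solver

module SubdivisionHomeomorphism {n} (G : Graph n) (u v : Fin n) (uv : Graph.adj G u v ≡ true) where
  open Graph G
  open Subdivision G u v uv

  private
    onEdge-u : onEdge u ≡ true
    onEdge-u rewrite ==-refl u = refl

    onEdge-v : onEdge v ≡ true
    onEdge-v rewrite ==-refl v = ∨-zeroʳ (v == u)

    onEdge-away : ∀ {i} → i ≢ u → i ≢ v → onEdge i ≡ false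
    onEdge-away i≢u i≢v rewrite ≢⇒==-false i≢u | ≢⇒==-false i≢v = refl

    -- The linear extension of the vertex map that fixes the old vertices and sends the new one to
    -- the midpoint of `uv`.
    f : Vector ℝ (suc n) → Vector ℝ n
    f x i = x (suc i) + sel (onEdge i) (halfℝ (x zero))

    μ : Vector ℝ n → ℝ
    μ y = y u ⊓ y v

    g : Vector ℝ n → Vector ℝ (suc n)
    g y zero    = μ y + μ y
    g y (suc i) = y i + - sel (onEdge i) (μ y)

    g-zero : ∀ y → g y zero ≈ μ y + μ y
    g-zero y = ≈-refl {g y zero}

    g-suc : ∀ y i → g y (suc i) ≈ y i + - sel (onEdge i) (μ y)
    g-suc y i = ≈-refl {g y (suc i)}

    Σℚ-edge : ∀ z → Σℚ (λ i → if onEdge i then z else 0ℚ) ≡ z ℚ.+ z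
    Σℚ-edge z = ≡.trans (sum-cong-≗ (edge-cases (λ i → (if onEdge i then z else 0ℚ) ≡ term u i ℚ.+ term v i)
        (≡.trans (cong (λ b → if b then z else 0ℚ) onEdge-u)
          (sym (≡.trans (cong₂ (λ a b → (if a then z else 0ℚ) ℚ.+ (if b then z else 0ℚ)) (==-refl u) (≢⇒==-false u≢v))
              (ℚ.+-identityʳ z))))
        (≡.trans (cong (λ b → if b then z else 0ℚ) onEdge-v)
          (sym (≡.trans (cong₂ (λ a b → (if a then z else 0ℚ) ℚ.+ (if b then z else 0ℚ)) (≢⇒==-false (u≢v ∘ sym))
              (==-refl v)) (ℚ.+-identityˡ z))))
        λ i i≢u i≢v → ≡.trans (cong (λ b → if b then z else 0ℚ) (onEdge-away i≢u i≢v))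
          (sym (cong₂ (λ a b → (if a then z else 0ℚ) ℚ.+ (if b then z else 0ℚ)) (≢⇒==-false i≢u) (≢⇒==-false i≢v)))))
      (≡.trans (∑-distrib-+ (term u) (term v)) (cong₂ ℚ._+_ (Σℚ-single u z) (Σℚ-single v z)))
      where
      term : Fin n → Fin n → ℚ
      term a i = if i == a then z else 0ℚ

    Σ-f : ∀ x → Σℝ (f x) ≈ Σℝ x
    Σ-f x = pointwise⇒≈ {Σℝ (f x)} {Σℝ x} λ k → begin
      seq (Σℝ (f x)) k
        ≡⟨ seq-Σ (f x) k ⟩
      Σℚ (λ i → seq (x (suc i)) k ℚ.+ seq (sel (onEdge i) (halfℝ (x zero))) k)
        ≡⟨ ∑-distrib-+ (λ i → seq (x (suc i)) k) _ ⟩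
      A k ℚ.+ Σℚ (λ i → seq (sel (onEdge i) (halfℝ (x zero))) k)
        ≡⟨ cong (A k ℚ.+_) (≡.trans (sum-cong-≗ (λ i → seq-sel (onEdge i) (halfℝ (x zero)) k))
            (Σℚ-edge (half (seq (x zero) k)))) ⟩
      A k ℚ.+ (half (seq (x zero) k) ℚ.+ half (seq (x zero) k))
        ≡⟨ cong (A k ℚ.+_) (half-sum (seq (x zero) k)) ⟩
      A k ℚ.+ seq (x zero) k
        ≡⟨ ℚ.+-comm (A k) _ ⟩
      seq (x zero) k ℚ.+ A k
        ≡⟨ seq-Σ x k ⟨
      seq (Σℝ x) k ∎
      where
      A : ℕ → ℚ
      A k = Σℚ (λ i → seq (x (suc i)) k)

    Σ-g : ∀ y → Σℝ (g y) ≈ Σℝ y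
    Σ-g y = pointwise⇒≈ {Σℝ (g y)} {Σℝ y} λ k → begin
      seq (Σℝ (g y)) k
        ≡⟨ seq-Σ (g y) k ⟩
      (m k ℚ.+ m k) ℚ.+ Σℚ (λ i → seq (y i) k ℚ.+ ℚ.- seq (sel (onEdge i) (μ y)) k)
        ≡⟨ cong ((m k ℚ.+ m k) ℚ.+_) (≡.trans (sum-cong-≗ (λ i → cong (seq (y i) k ℚ.+_) (neg (onEdge i) k)))
             (≡.trans (∑-distrib-+ (λ i → seq (y i) k) _) (cong (Σℚ (λ i → seq (y i) k) ℚ.+_) (Σℚ-edge (ℚ.- m k))))) ⟩
      (m k ℚ.+ m k) ℚ.+ (Σℚ (λ i → seq (y i) k) ℚ.+ (ℚ.- m k ℚ.+ ℚ.- m k))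
        ≡⟨ solve 2 (λ m a → (m :+ m) :+ (a :+ (:- m :+ :- m)) := a) refl (m k) (Σℚ (λ i → seq (y i) k)) ⟩
      Σℚ (λ i → seq (y i) k)
        ≡⟨ seq-Σ y k ⟨
      seq (Σℝ y) k ∎
      where
      open +-*-Solver
      m : ℕ → ℚ
      m k = seq (μ y) k
      neg : ∀ b k → ℚ.- seq (sel b (μ y)) k ≡ (if b then ℚ.- m k else 0ℚ)
      neg true  k = refl
      neg false k = refl

    -- As `u` and `v` are adjacent, the non-neighbour `i` of one end is not the other end either, so
    -- it could be nearby only as a common neighbour.
    nearby-false : ∀ {i j} → onEdge j ≡ true → i ≢ j → adj i j ≡ false → nearby i ≡ false
    nearby-false {i} {j} = edge-cases (λ j → onEdge j ≡ true → i ≢ j → adj i j ≡ false → nearby i ≡ false)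
      (λ _ i≢u iu → ≡.trans
          (nearby-away i≢u (λ { refl → contradiction (≡.trans (sym iu) (≡.trans (symm v u) uv)) λ () }))
        (cong (_∧ adj v i) (≡.trans (symm u i) iu)))
      (λ _ i≢v iv → ≡.trans (nearby-away (λ { refl → contradiction (≡.trans (sym iv) uv) λ () }) i≢v)
        (≡.trans (cong (adj u i ∧_) (≡.trans (symm v i) iv)) (∧-zeroʳ (adj u i))))
      (λ j j≢u j≢v on → contradiction (≡.trans (sym on) (onEdge-away j≢u j≢v)) λ ()) j

    f-realizes : ∀ {x} → InRealization (cliqueComplex subdivision) x → InRealization (cliqueComplex G) (f x)
    f-realizes {x} real@(0≤x , Σx , _) =
      (λ i → 0≤+ {x (suc i)} {sel (onEdge i) (halfℝ (x zero))} (0≤x (suc i))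
               (0≤sel (onEdge i) {halfℝ (x zero)} (0≤halfℝ {x zero} (0≤x zero)))) ,
      ≈-trans {Σℝ (f x)} {Σℝ x} {1ℝ} (Σ-f x) Σx ,
      disjoint⇒clique G (f x) disjoint
      where
      apart : Disjoint subdivision x
      apart = realization⇒disjoint subdivision x real
      -- Which summand of a positive sum is positive cannot be extracted from the negative order
      -- facts used here; a double negation suffices, since disjointness is itself a negation.
      source : ∀ i → 0ℝ < f x i → ¬ ¬ (0ℝ < x (suc i) ⊎ (onEdge i ≡ true × 0ℝ < x zero))
      source i pos none = +≤0 {x (suc i)} {sel (onEdge i) (halfℝ (x zero))} (none ∘ inj₁)
          (edge-part (onEdge i) refl) pos
        where
        edge-part : ∀ b → onEdge i ≡ b → sel b (halfℝ (x zero)) ≤ 0ℝ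
        edge-part true  on 0<h = none (inj₂ (on , 0<halfℝ⁻ {x zero} 0<h))
        edge-part false _      = pointwise⇒≤ {0ℝ} {0ℝ} λ _ → ℚ.≤-refl
      adj⁻-false : ∀ {i j} → adj i j ≡ false → adj⁻ i j ≡ false
      adj⁻-false {i} {j} ij = cong (_∧ not (isEdge i j)) ij
      disjoint : Disjoint G (f x)
      disjoint i j i≢j ij (pos-i , pos-j) = source i pos-i λ si → source j pos-j λ sj → refute si sj
        where
        ji : adj j i ≡ false
        ji = ≡.trans (symm j i) ij
        refute : 0ℝ < x (suc i) ⊎ (onEdge i ≡ true × 0ℝ < x zero) → 0ℝ < x (suc j) ⊎ (onEdge j ≡ true × 0ℝ < x zero) → ⊥
        refute (inj₁ pi) (inj₁ pj) = apart (suc i) (suc j) (i≢j ∘ Fin.suc-injective) (adj⁻-false ij) (pi , pj)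
        refute (inj₁ pi) (inj₂ (on , p0)) = apart (suc i) zero (λ ()) (nearby-false on i≢j ij) (pi , p0)
        refute (inj₂ (on , p0)) (inj₁ pj) = apart (suc j) zero (λ ()) (nearby-false on (i≢j ∘ sym) ji) (pj , p0)
        refute (inj₂ (oni , _)) (inj₂ (onj , _)) =
          contradiction (≡.trans (sym (nearby-false onj i≢j ij)) (cong (_∨ common i) oni)) λ ()

    g≤ : ∀ y → 0ℝ ≤ μ y → ∀ i → g y (suc i) ≤ y i
    g≤ y 0≤μ i = Ev≤⇒≤ {g y (suc i)} {y i} λ {e} 0<e → ev-map
      (λ k pos → <-by pos (solve 3 (λ a s e → (a :+ e) :- (a :+ (:- s)) := (s :+ e) :- con 0ℚ) refl (seq (y i) k)
          (seq (sel (onEdge i) (μ y)) k) e))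
      (≤⇒Ev≤ {0ℝ} {sel (onEdge i) (μ y)} (0≤sel (onEdge i) {μ y} 0≤μ) 0<e)
      where open +-*-Solver

    0<+self : ∀ {x} → 0ℝ < x + x → 0ℝ < x
    0<+self {x} (e , 0<e , lt) = half e , 0<half 0<e , ev-map
      (λ k p → subst₂ ℚ._<_ (solve 1 (λ e → con ½ :* (con 0ℚ :+ e) := con 0ℚ :+ con ½ :* e) refl e)
                            (solve 1 (λ a → con ½ :* (a :+ a) := a) refl (seq x k)) (ℚ.*-monoʳ-<-pos ½ p)) lt
      where open +-*-Solver

    ≤⇒0≤- : ∀ {x m} → (∀ k → seq m k ℚ.≤ seq x k) → 0ℝ ≤ x + - m
    ≤⇒0≤- {x} {m} m≤x = pointwise⇒≤ {0ℝ} {x + - m} λ k →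
      ≤-by (m≤x k) (solve 2 (λ x m → (x :- m) :- con 0ℚ := x :- m) refl (seq x k) (seq m k))
      where open +-*-Solver

    g-realizes : ∀ {y} → InRealization (cliqueComplex G) y → InRealization (cliqueComplex subdivision) (g y)
    g-realizes {y} real@(0≤y , Σy , _) =
      nonneg , ≈-trans {Σℝ (g y)} {Σℝ y} {1ℝ} (Σ-g y) Σy , disjoint⇒clique subdivision (g y) disjoint
      where
      apart : Disjoint G y
      apart = realization⇒disjoint G y real
      0≤μ : 0ℝ ≤ μ y
      0≤μ = 0≤⊓ {y u} {y v} (0≤y u) (0≤y v)
      nonneg : ∀ i → 0ℝ ≤ g y i
      nonneg zero    = 0≤+ {μ y} {μ y} 0≤μ 0≤μ
      nonneg (suc i) = edge-cases (λ i → 0ℝ ≤ g y (suc i))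
        (subst (λ b → 0ℝ ≤ y u + - sel b (μ y)) (sym onEdge-u)
          (≤⇒0≤- {y u} {μ y} λ k → ℚ.p⊓q≤p (seq (y u) k) (seq (y v) k)))
        (subst (λ b → 0ℝ ≤ y v + - sel b (μ y)) (sym onEdge-v)
          (≤⇒0≤- {y v} {μ y} λ k → ℚ.p⊓q≤q (seq (y u) k) (seq (y v) k)))
        (λ i i≢u i≢v → subst (λ b → 0ℝ ≤ y i + - sel b (μ y)) (sym (onEdge-away i≢u i≢v))
          (≤-trans {0ℝ} {y i} {y i + - 0ℝ} (0≤y i) (pointwise⇒≤ {y i} {y i + - 0ℝ} λ k → ℚ.≤-reflexive
              (sym (ℚ.+-identityʳ (seq (y i) k))))))
        i
      positive-y : ∀ i → 0ℝ < g y (suc i) → 0ℝ < y i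
      positive-y i pos = <-≤-trans {0ℝ} {g y (suc i)} {y i} pos (g≤ y 0≤μ i)
      zero-suc : ∀ j → nearby j ≡ false → ¬ (0ℝ < g y zero × 0ℝ < g y (suc j))
      zero-suc j far (p0 , pj) = refute (adj u j) (adj v j) refl refl
        where
        0<μ : 0ℝ < μ y
        0<μ = 0<+self {μ y} p0
        j≢u : j ≢ u
        j≢u refl = contradiction (≡.trans (sym far) nearby-u) λ ()
        j≢v : j ≢ v
        j≢v refl = contradiction (≡.trans (sym far) nearby-v) λ ()
        refute : ∀ a b → adj u j ≡ a → adj v j ≡ b → ⊥
        refute false b uj vj = apart u j (j≢u ∘ sym) uj
            (<-≤-trans {0ℝ} {μ y} {y u} 0<μ (⊓≤ˡ (y u) (y v)) , positive-y j pj)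
        refute true false uj vj = apart v j (j≢v ∘ sym) vj
            (<-≤-trans {0ℝ} {μ y} {y v} 0<μ (⊓≤ʳ (y u) (y v)) , positive-y j pj)
        refute true true uj vj = contradiction (≡.trans (sym far) (nearby-common uj vj)) λ ()
      both-ends : ¬ (0ℝ < g y (suc u) × 0ℝ < g y (suc v))
      both-ends (pu , pv) = refute (seq (y u) k) (seq (y v) k) (proj₁ (proj₂ now)) (proj₂ (proj₂ now))
        where
        positive-u : Eventually λ k → 0ℚ ℚ.< seq (y u) k ℚ.- seq (μ y) k
        positive-u = 0<⇒Ev {y u + - μ y} (subst (λ b → 0ℝ < y u + - sel b (μ y)) onEdge-u pu)
        positive-v : Eventually λ k → 0ℚ ℚ.< seq (y v) k ℚ.- seq (μ y) k
        positive-v = 0<⇒Ev {y v + - μ y} (subst (λ b → 0ℝ < y v + - sel b (μ y)) onEdge-v pv)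
        now : ∃ λ k → 0ℚ ℚ.< seq (y u) k ℚ.- seq (μ y) k × 0ℚ ℚ.< seq (y v) k ℚ.- seq (μ y) k
        now = ev-now (ev-both positive-u positive-v)
        k : ℕ
        k = proj₁ now
        -- At any single index one of the two coordinates equals the minimum, so subtracting the
        -- minimum leaves zero there.
        refute : ∀ a b → 0ℚ ℚ.< a ℚ.- a ℚ.⊓ b → 0ℚ ℚ.< b ℚ.- a ℚ.⊓ b → ⊥
        refute a b p q = Sum.[ (λ eq → self-< a (subst (λ z → 0ℚ ℚ.< a ℚ.- z) eq p)) ,
            (λ eq → self-< b (subst (λ z → 0ℚ ℚ.< b ℚ.- z) eq q)) ]′ (ℚ.⊓-sel a b)
          where
          self-< : ∀ a → ¬ 0ℚ ℚ.< a ℚ.- a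
          self-< a lt = ℚ.<-irrefl refl (subst (0ℚ ℚ.<_) (ℚ.+-inverseʳ a) lt)
      suc-suc : ∀ i j → i ≢ j → adj⁻ i j ≡ false → ¬ (0ℝ < g y (suc i) × 0ℝ < g y (suc j))
      suc-suc i j i≢j far (pi , pj) = decide (adj i j) refl
        where
        edge : adj i j ≡ true → Dec (i ≡ u) → Dec (i ≡ v) → Dec (j ≡ u) → Dec (j ≡ v) → ⊥
        edge _ (yes refl) _ _ (yes refl) = both-ends (pi , pj)
        edge _ _ (yes refl) (yes refl) _ = both-ends (pj , pi)
        edge ij (no i≢u) (no i≢v) _ _ = contradiction (≡.trans (sym far) (≡.trans (adj⁻-away i≢u i≢v) ij)) λ ()
        edge ij _ _ (no j≢u) (no j≢v) =
          contradiction
              (≡.trans (sym far) (≡.trans (adj⁻-symm i j) (≡.trans (adj⁻-away j≢u j≢v) (≡.trans (symm j i) ij)))) λ ()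
        edge _ (yes i≡u) _ (yes j≡u) (no _) = i≢j (≡.trans i≡u (sym j≡u))
        edge _ _ (yes i≡v) (no _) (yes j≡v) = i≢j (≡.trans i≡v (sym j≡v))
        decide : ∀ b → adj i j ≡ b → ⊥
        decide false ij = apart i j i≢j ij (positive-y i pi , positive-y j pj)
        decide true  ij = edge ij (i Fin.≟ u) (i Fin.≟ v) (j Fin.≟ u) (j Fin.≟ v)
      disjoint : Disjoint subdivision (g y)
      disjoint zero    zero    0≢0 _ = contradiction refl 0≢0
      disjoint zero    (suc j) _ far = zero-suc j far
      disjoint (suc i) zero    _ far (pi , p0) = zero-suc i far (p0 , pi)
      disjoint (suc i) (suc j) i≢j far = suc-suc i j (i≢j ∘ cong suc) far

    f-uc : UniformlyContinuous (InRealization (cliqueComplex subdivision)) f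
    f-uc {e} 0<e = half e , 0<half 0<e , λ {x} {y} _ _ close j → ev-map₂ (λ _ → Near-+½) (close (suc j))
      (sel-close (onEdge j) {half e} {halfℝ (x zero)} {halfℝ (y zero)} (0<half 0<e)
          (halfℝ-close {half e} {x zero} {y zero} (0<half 0<e) (close zero)))

    g-uc : UniformlyContinuous (InRealization (cliqueComplex G)) g
    g-uc {e} 0<e = half e , 0<half 0<e , λ {x} {y} _ _ close → λ
      { zero    → ev-map (λ _ near → Near-+½ near near) (μ-close {x} {y} close)
      ; (suc j) → ev-map₂ (λ _ p q → Near-+½ p (Near-neg q)) (close j)
                    (sel-close (onEdge j) {half e} {μ x} {μ y} (0<half 0<e) (μ-close {x} {y} close)) }
      where
      μ-close : ∀ {x y : Vector ℝ n} → (∀ i → Close (half e) (x i) (y i)) → Close (half e) (μ x) (μ y)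
      μ-close close = ev-map₂ (λ _ → Near-⊓) (close u) (close v)

    f∘g : ∀ y i → f (g y) i ≈ y i
    f∘g y i = pointwise⇒≈ {f (g y) i} {y i} λ k → cancel (onEdge i) k
      where
      open +-*-Solver
      cancel : ∀ b k → seq (y i + - sel b (μ y) + sel b (halfℝ (μ y + μ y))) k ≡ seq (y i) k
      cancel true  k = solve 2 (λ a m → (a :+ (:- m)) :+ con ½ :* (m :+ m) := a) refl (seq (y i) k) (seq (μ y) k)
      cancel false k = solve 1 (λ a → (a :+ (:- con 0ℚ)) :+ con 0ℚ := a) refl (seq (y i) k)

    module _ {x : Vector ℝ (suc n)} (real : InRealization (cliqueComplex subdivision) x) where
      open +-*-Solver

      z : ℝ
      z = x zero

      min≈0 : x (suc u) ⊓ x (suc v) ≈ 0ℝ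
      min≈0 = ⊓-zero {x (suc u)} {x (suc v)} (proj₁ real (suc u)) (proj₁ real (suc v))
        (realization⇒disjoint subdivision x real (suc u) (suc v) (u≢v ∘ Fin.suc-injective) adj⁻-uv)

      μ-shift : ∀ k → seq (μ (f x)) k ≡ seq (x (suc u) ⊓ x (suc v)) k ℚ.+ seq (halfℝ z) k
      μ-shift k = ≡.trans
        (cong₂ ℚ._⊓_ (cong (λ b → seq (x (suc u) + sel b (halfℝ z)) k) onEdge-u)
                     (cong (λ b → seq (x (suc v) + sel b (halfℝ z)) k) onEdge-v))
        (sym (+-distribʳ-⊓ (seq (halfℝ z) k) (seq (x (suc u)) k) (seq (x (suc v)) k)))

      -- `f` adds half of the new coordinate to both ends, which shifts their minimum by that
      -- amount; the minimum before the shift is zero because `u` and `v` are not adjacent after the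
      -- subdivision.
      μ≈ : μ (f x) ≈ halfℝ z
      μ≈ = ≈-trans {μ (f x)} {x (suc u) ⊓ x (suc v) + halfℝ z} {halfℝ z}
        (pointwise⇒≈ {μ (f x)} {x (suc u) ⊓ x (suc v) + halfℝ z} μ-shift)
        (≈-trans {x (suc u) ⊓ x (suc v) + halfℝ z} {0ℝ + halfℝ z} {halfℝ z}
          (+-cong {x (suc u) ⊓ x (suc v)} {0ℝ} {halfℝ z} {halfℝ z} min≈0 (≈-refl {halfℝ z}))
          (pointwise⇒≈ {0ℝ + halfℝ z} {halfℝ z} λ k → ℚ.+-identityˡ (seq (halfℝ z) k)))

      g∘f-suc : ∀ i → g (f x) (suc i) ≈ x (suc i)
      g∘f-suc i = ≈-trans {g (f x) (suc i)} {f x i + - sel (onEdge i) (μ (f x))} {x (suc i)} (g-suc (f x) i)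
        (cancel-sel (onEdge i) (x (suc i)) {f x i} {halfℝ z} {μ (f x)} (≈-refl {f x i}) μ≈)

      g∘f-zero : g (f x) zero ≈ x zero
      g∘f-zero = ≈-trans {g (f x) zero} {μ (f x) + μ (f x)} {z} (g-zero (f x))
        (≈-trans {μ (f x) + μ (f x)} {halfℝ z + halfℝ z} {z}
          (+-cong {μ (f x)} {halfℝ z} {μ (f x)} {halfℝ z} μ≈ μ≈)
          (pointwise⇒≈ {halfℝ z + halfℝ z} {z} λ k → half-sum (seq z k)))

      g∘f : ∀ i → g (f x) i ≈ x i
      g∘f zero    = g∘f-zero
      g∘f (suc i) = g∘f-suc i

  subdivision-homeomorphism : Homeomorphism (InRealization (cliqueComplex subdivision))
      (InRealization (cliqueComplex G))
  subdivision-homeomorphism = mkHomeomorphism f g (λ {x} → f-realizes {x}) (λ {y} → g-realizes {y})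
    (λ {e} → f-uc {e}) (λ {e} → g-uc {e}) (λ {y} _ → f∘g y) (λ {x} → g∘f {x})

-- The boundary of the cross-polytope

double : ℕ → ℕ
double zero    = zero
double (suc n) = suc (suc (double n))

pos neg : ∀ {n} → Fin n → Fin (double n)
pos zero    = zero
pos (suc k) = suc (suc (pos k))
neg zero    = suc zero
neg (suc k) = suc (suc (neg k))

axis : ∀ {n} → Fin (double n) → Fin n
axis {suc n} zero          = zero
axis {suc n} (suc zero)    = zero
axis {suc n} (suc (suc i)) = suc (axis i)

sign : ∀ {n} → Fin (double n) → Bool
sign {suc n} zero          = true
sign {suc n} (suc zero)    = false
sign {suc n} (suc (suc i)) = sign {n} i

vertex-cases : ∀ {n ℓ} (P : Fin (double n) → Set ℓ) → (∀ k → P (pos k)) → (∀ k → P (neg k)) → ∀ i → P i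
vertex-cases {suc n} P p q zero          = p zero
vertex-cases {suc n} P p q (suc zero)    = q zero
vertex-cases {suc n} P p q (suc (suc i)) = vertex-cases (λ i → P (suc (suc i))) (p ∘ suc) (q ∘ suc) i

axis-pos : ∀ {n} (k : Fin n) → axis (pos k) ≡ k
axis-pos zero    = refl
axis-pos (suc k) = cong suc (axis-pos k)

axis-neg : ∀ {n} (k : Fin n) → axis (neg k) ≡ k
axis-neg zero    = refl
axis-neg (suc k) = cong suc (axis-neg k)

sign-pos : ∀ {n} (k : Fin n) → sign (pos k) ≡ true
sign-pos zero    = refl
sign-pos (suc k) = sign-pos k

sign-neg : ∀ {n} (k : Fin n) → sign (neg k) ≡ false
sign-neg zero    = refl
sign-neg (suc k) = sign-neg k

==⇒≡ : ∀ {n} {i j : Fin n} → (i == j) ≡ true → i ≡ j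
==⇒≡ {i = i} {j} eq with i Fin.≟ j
... | yes i≡j = i≡j

crossPolytope : ∀ n → Graph (double n)
crossPolytope n = record
  { adj    = λ i j → not (axis {n} i == axis j)
  ; symm   = λ i j → cong not (==-symm (axis {n} i) (axis j))
  ; irrefl = λ i → cong not (==-refl (axis {n} i))
  }
  where
  ==-symm : ∀ {n} (i j : Fin n) → (i == j) ≡ (j == i)
  ==-symm zero    zero    = refl
  ==-symm zero    (suc j) = refl
  ==-symm (suc i) zero    = refl
  ==-symm (suc i) (suc j) = ==-symm i j

Σℚ-pairs : ∀ n (a : Fin (double n) → ℚ) → Σℚ {n} (λ k → a (pos k) ℚ.+ a (neg k)) ≡ Σℚ a
Σℚ-pairs zero    a = refl
Σℚ-pairs (suc n) a = ≡.trans (cong (a zero ℚ.+ a (suc zero) ℚ.+_) (Σℚ-pairs n (λ i → a (suc (suc i)))))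
  (ℚ.+-assoc (a zero) (a (suc zero)) (Σℚ {double n} (λ i → a (suc (suc i)))))

Σ-pairs : ∀ {n} (x : Vector ℝ (double n)) → Σℝ {n} (λ k → x (pos k) + x (neg k)) ≈ Σℝ x
Σ-pairs {n} x = pointwise⇒≈ {Σℝ {n} (λ k → x (pos k) + x (neg k))} {Σℝ x} λ j →
  ≡.trans (seq-Σ {n} (λ k → x (pos k) + x (neg k)) j) (≡.trans (Σℚ-pairs n (λ i → seq (x i) j)) (sym (seq-Σ x j)))

Σℝ-cong : ∀ {n} {x y : Vector ℝ n} → (∀ i → x i ≈ y i) → Σℝ x ≈ Σℝ y
Σℝ-cong {zero}          x≈y = ≈-refl {0ℝ}
Σℝ-cong {suc n} {x} {y} x≈y = +-cong {x zero} {y zero} {Σℝ (x ∘ suc)} {Σℝ (y ∘ suc)} (x≈y zero) (Σℝ-cong (x≈y ∘ suc))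

≡⇒≈ : ∀ {x y} → x ≡ y → x ≈ y
≡⇒≈ {x} refl = ≈-refl {x}

0<square : ∀ {x} → 0ℝ < x → 0ℝ < x * x
0<square {x} (e , 0<e , lt) = e ℚ.* e , 0<e*f 0<e 0<e , ev-map
  (λ n p → subst (ℚ._< seq x n ℚ.* seq x n) (sym (ℚ.+-identityˡ (e ℚ.* e))) 
    (square-mono-< (ℚ.<⇒≤ 0<e) (subst (ℚ._< seq x n) (ℚ.+-identityˡ e) p))) lt

-- The squares of the positive and of the negative part.
part : Bool → ℝ → ℝ
part true  z = (z + - (z ⊓ 0ℝ)) * (z + - (z ⊓ 0ℝ))
part false z = - (z ⊓ 0ℝ) * - (z ⊓ 0ℝ)

0≤part : ∀ b z → 0ℝ ≤ part b z
0≤part true  z = pointwise⇒≤ {0ℝ} {part true z} λ n → 0≤square (seq z n ℚ.+ ℚ.- (seq z n ℚ.⊓ 0ℚ))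
0≤part false z = pointwise⇒≤ {0ℝ} {part false z} λ n → 0≤square (ℚ.- (seq z n ℚ.⊓ 0ℚ))

part-sum : ∀ z → part true z + part false z ≈ z * z
part-sum z = pointwise⇒≈ {part true z + part false z} {z * z} λ n → lemma (seq z n)
  where
  open +-*-Solver
  lemma : ∀ a → (a ℚ.+ ℚ.- (a ℚ.⊓ 0ℚ)) ℚ.* (a ℚ.+ ℚ.- (a ℚ.⊓ 0ℚ)) ℚ.+ ℚ.- (a ℚ.⊓ 0ℚ) ℚ.* ℚ.- (a ℚ.⊓ 0ℚ) ≡ a ℚ.* a
  lemma a = Sum.[
      (λ eq → ≡.trans (cong F eq) (solve 1 (λ a → (a :+ (:- a)) :* (a :+ (:- a)) :+ (:- a) :* (:- a) := a :* a) refl a))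
                , (λ eq → ≡.trans (cong F eq)
                    (solve 1 (λ a → (a :+ (:- con 0ℚ)) :* (a :+ (:- con 0ℚ)) :+ (:- con 0ℚ) :* (:- con 0ℚ) :=
                    a :* a) refl a)) ]′
              (ℚ.⊓-sel a 0ℚ)
    where
    F : ℚ → ℚ
    F m = (a ℚ.+ ℚ.- m) ℚ.* (a ℚ.+ ℚ.- m) ℚ.+ ℚ.- m ℚ.* ℚ.- m

part-disjoint : ∀ z → ¬ (0ℝ < part true z × 0ℝ < part false z)
part-disjoint z (p , q) = refute (seq z k) (proj₁ (proj₂ now)) (proj₂ (proj₂ now))
  where
  open +-*-Solver
  now : ∃ λ n → 0ℚ ℚ.< seq (part true z) n × 0ℚ ℚ.< seq (part false z) n
  now = ev-now (ev-both (0<⇒Ev {part true z} p) (0<⇒Ev {part false z} q))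
  k : ℕ
  k = proj₁ now
  refute : ∀ a → 0ℚ ℚ.< (a ℚ.+ ℚ.- (a ℚ.⊓ 0ℚ)) ℚ.* (a ℚ.+ ℚ.- (a ℚ.⊓ 0ℚ)) → 0ℚ ℚ.< ℚ.- (a ℚ.⊓ 0ℚ) ℚ.* ℚ.- (a ℚ.⊓ 0ℚ) → ⊥
  refute a lt lt′ = Sum.[
      (λ eq → ℚ.<-irrefl refl (subst (0ℚ ℚ.<_) (≡.trans (cong (λ m → (a ℚ.+ ℚ.- m) ℚ.* (a ℚ.+ ℚ.- m)) eq)
        (solve 1 (λ a → (a :+ (:- a)) :* (a :+ (:- a)) := con 0ℚ) refl a)) lt))
    , (λ eq → ℚ.<-irrefl refl (subst (0ℚ ℚ.<_) (cong (λ m → ℚ.- m ℚ.* ℚ.- m) eq) lt′)) ]′ (ℚ.⊓-sel a 0ℚ)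

√-part-true : ∀ z → √ (part true z) ≈ z + - (z ⊓ 0ℝ)
√-part-true z = √-square {z + - (z ⊓ 0ℝ)} (pointwise⇒≤ {0ℝ} {z + - (z ⊓ 0ℝ)} λ n →
  ≤-by (ℚ.p⊓q≤p (seq z n) 0ℚ) (solve 2 (λ a m → (a :+ (:- m)) :- con 0ℚ := a :- m) refl (seq z n) (seq z n ℚ.⊓ 0ℚ)))
  where open +-*-Solver

√-part-false : ∀ z → √ (part false z) ≈ - (z ⊓ 0ℝ)
√-part-false z = √-square { - (z ⊓ 0ℝ)} (pointwise⇒≤ {0ℝ} { - (z ⊓ 0ℝ)} λ n → ℚ.neg-antimono-≤ (ℚ.p⊓q≤q (seq z n) 0ℚ))

module _ {c P Q : ℝ} (c≈ : c ≈ P + - Q) (disjoint : P ⊓ Q ≈ 0ℝ) where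
  private
    -- Writing `0ℝ` as `Q - Q`, the common shift by `- Q` comes out of the minimum:
    -- `(P - Q) ⊓ (Q - Q)` is `P ⊓ Q - Q`. So `P` and `Q` are recovered as the positive and negative
    -- parts of their difference.
    c⊓0≈ : c ⊓ 0ℝ ≈ - Q
    c⊓0≈ = ≈-trans {c ⊓ 0ℝ} {(P + - Q) ⊓ (Q + - Q)} { - Q}
      (⊓-cong {c} {P + - Q} {0ℝ} {Q + - Q} c≈ (pointwise⇒≈ {0ℝ} {Q + - Q} λ n → sym (ℚ.+-inverseʳ (seq Q n))))
      (≈-trans {(P + - Q) ⊓ (Q + - Q)} {P ⊓ Q + - Q} { - Q}
        (pointwise⇒≈ {(P + - Q) ⊓ (Q + - Q)} {P ⊓ Q + - Q} λ n → sym (+-distribʳ-⊓ (ℚ.- seq Q n) (seq P n) (seq Q n)))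
        (≈-trans {P ⊓ Q + - Q} {0ℝ + - Q} { - Q}
          (+-cong {P ⊓ Q} {0ℝ} { - Q} { - Q} disjoint (≈-refl { - Q}))
          (pointwise⇒≈ {0ℝ + - Q} { - Q} λ n → ℚ.+-identityˡ (ℚ.- seq Q n))))

    -c⊓0≈ : - (c ⊓ 0ℝ) ≈ Q
    -c⊓0≈ = ≈-trans { - (c ⊓ 0ℝ)} { - - Q} {Q} (-‿cong {c ⊓ 0ℝ} { - Q} c⊓0≈)
      (pointwise⇒≈ { - - Q} {Q} λ n → neg-involutive (seq Q n))
      where
      open +-*-Solver
      neg-involutive : ∀ a → ℚ.- ℚ.- a ≡ a
      neg-involutive = solve 1 (λ a → :- (:- a) := a) refl

    c-c⊓0≈ : c + - (c ⊓ 0ℝ) ≈ P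
    c-c⊓0≈ = ≈-trans {c + - (c ⊓ 0ℝ)} {P + - Q + Q} {P} (+-cong {c} {P + - Q} { - (c ⊓ 0ℝ)} {Q} c≈ -c⊓0≈)
      (pointwise⇒≈ {P + - Q + Q} {P} λ n → cancel (seq P n) (seq Q n))
      where
      open +-*-Solver
      cancel : ∀ a b → a ℚ.+ ℚ.- b ℚ.+ b ≡ a
      cancel = solve 2 (λ a b → (a :+ (:- b)) :+ b := a) refl

  part-true-difference : part true c ≈ P * P
  part-true-difference = *-cong {c + - (c ⊓ 0ℝ)} {P} {c + - (c ⊓ 0ℝ)} {P} c-c⊓0≈ c-c⊓0≈

  part-false-difference : part false c ≈ Q * Q
  part-false-difference = *-cong { - (c ⊓ 0ℝ)} {Q} { - (c ⊓ 0ℝ)} {Q} -c⊓0≈ -c⊓0≈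

two : ℚ
two = 1ℚ ℚ.+ 1ℚ

-- Squaring is uniformly continuous only on bounded sets. With bound `two`, `Near-*` turns radius
-- `d` into `4 d`, so `d` is a quarter of `e`; the third halving is for the positive part, a
-- difference of two quantities that both vary.
part-close : ∀ b {e} z w → 0ℚ ℚ.< e → Eventually (λ n → ℚ.∣ seq z n ∣ ℚ.≤ two) → Eventually
    (λ n → ℚ.∣ seq w n ∣ ℚ.≤ two) →
             Close (half (half (half e))) z w → Close e (part b z) (part b w)
part-close b {e} z w 0<e ∣z∣ ∣w∣ close = by-sign b
  where
  open +-*-Solver
  d : ℚ
  d = half (half e)
  0<d : 0ℚ ℚ.< d
  0<d = 0<half (0<half 0<e)
  4d≡e : two ℚ.* d ℚ.+ two ℚ.* d ≡ e
  4d≡e = solve 1 (λ e → (con 1ℚ :+ con 1ℚ) :* (con ½ :* (con ½ :* e)) :+ (con 1ℚ :+ con 1ℚ) :*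
      (con ½ :* (con ½ :* e)) := e) refl e
  0≤two : 0ℚ ℚ.≤ two
  0≤two = ℚ.<⇒≤ (ℚ.positive⁻¹ two)
  bound-neg : ∀ a → ℚ.∣ a ∣ ℚ.≤ two → ℚ.∣ ℚ.- (a ℚ.⊓ 0ℚ) ∣ ℚ.≤ two
  bound-neg a le = Sum.[ (λ eq → subst (λ m → ℚ.∣ ℚ.- m ∣ ℚ.≤ two) (sym eq) (subst (ℚ._≤ two) (sym (ℚ.∣-p∣≡∣p∣ a)) le))
                       , (λ eq → subst (λ m → ℚ.∣ ℚ.- m ∣ ℚ.≤ two) (sym eq) 0≤two) ]′ (ℚ.⊓-sel a 0ℚ)
  bound-pos : ∀ a → ℚ.∣ a ∣ ℚ.≤ two → ℚ.∣ a ℚ.+ ℚ.- (a ℚ.⊓ 0ℚ) ∣ ℚ.≤ two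
  bound-pos a le = Sum.[ (λ eq → subst (λ m → ℚ.∣ a ℚ.+ ℚ.- m ∣ ℚ.≤ two) (sym eq)
      (subst (λ z → ℚ.∣ z ∣ ℚ.≤ two) (sym (ℚ.+-inverseʳ a)) 0≤two))
                       , (λ eq → subst (λ m → ℚ.∣ a ℚ.+ ℚ.- m ∣ ℚ.≤ two) (sym eq)
                           (subst (λ z → ℚ.∣ z ∣ ℚ.≤ two) (sym (ℚ.+-identityʳ a)) le)) ]′
                     (ℚ.⊓-sel a 0ℚ)
  near-min : ∀ {a b} → Near (half d) a b → Near (half d) (ℚ.- (a ℚ.⊓ 0ℚ)) (ℚ.- (b ℚ.⊓ 0ℚ))
  near-min near = Near-neg (Near-⊓ near (Near-refl (0<half 0<d)))
  square-near : ∀ {a b} → ℚ.∣ a ∣ ℚ.≤ two → ℚ.∣ b ∣ ℚ.≤ two → Near d a b → Near e (a ℚ.* a) (b ℚ.* b)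
  square-near {a} {b} p q near = subst (λ f → Near f (a ℚ.* a) (b ℚ.* b)) 4d≡e (Near-* (ℚ.positive⁻¹ two) p q near near)
  by-sign : ∀ b → Close e (part b z) (part b w)
  by-sign true  = ev-map₂ (λ n (p , q) near → square-near (bound-pos (seq z n) p) (bound-pos (seq w n) q)
      (Near-+½ near (near-min near)))
    (ev-both ∣z∣ ∣w∣) close
  by-sign false = ev-map₂ (λ n (p , q) near → square-near (bound-neg (seq z n) p) (bound-neg (seq w n) q)
    (Near-≤ (ℚ.<⇒≤ (half<self 0<d)) (near-min near)))
    (ev-both ∣z∣ ∣w∣) close

term≤Σℚ : ∀ {n} (a : Fin n → ℚ) → (∀ i → 0ℚ ℚ.≤ a i) → ∀ i → a i ℚ.≤ Σℚ a
0≤Σℚ : ∀ {n} (a : Fin n → ℚ) → (∀ i → 0ℚ ℚ.≤ a i) → 0ℚ ℚ.≤ Σℚ a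
0≤Σℚ {zero}  a 0≤a = ℚ.≤-refl
0≤Σℚ {suc n} a 0≤a = ℚ.+-mono-≤ (0≤a zero) (0≤Σℚ (a ∘ suc) (0≤a ∘ suc))
term≤Σℚ {suc n} a 0≤a zero    = subst (ℚ._≤ Σℚ a) (ℚ.+-identityʳ (a zero))
    (ℚ.+-monoʳ-≤ (a zero) (0≤Σℚ (a ∘ suc) (0≤a ∘ suc)))
term≤Σℚ {suc n} a 0≤a (suc i) = subst (ℚ._≤ Σℚ a) (ℚ.+-identityˡ (a (suc i)))
  (ℚ.+-mono-≤ (0≤a zero) (term≤Σℚ (a ∘ suc) (0≤a ∘ suc) i))

-- The sum of squares is only approximately one at each index, but eventually it is below `two`,
-- hence below `two * two`, and each square is at most the sum.
sphere-bounded : ∀ {d} z → Sphere d z → ∀ i → Eventually λ n → ℚ.∣ seq (z i) n ∣ ℚ.≤ two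
sphere-bounded z Σz²≈1 i = ev-map
    (λ n near → ℚ.<⇒≤ (square-cancel-< (ℚ.<⇒≤ (ℚ.positive⁻¹ two)) (bound n (Near.below near))))
  (≈⇒Close {Σℝ (λ i → z i * z i)} {1ℝ} Σz²≈1 (ℚ.positive⁻¹ 1ℚ))
  where
  abs-square : ∀ a → ℚ.∣ a ∣ ℚ.* ℚ.∣ a ∣ ≡ a ℚ.* a
  abs-square a = ≡.trans (sym (ℚ.∣p*q∣≡∣p∣*∣q∣ a a)) (ℚ.0≤p⇒∣p∣≡p (0≤square a))
  2≤4 : two ℚ.≤ two ℚ.* two
  2≤4 = *≤* (ℤ.+≤+ (ℕ.s≤s (ℕ.s≤s ℕ.z≤n)))
  bound : ∀ n → seq (Σℝ (λ i → z i * z i)) n ℚ.< two → ℚ.∣ seq (z i) n ∣ ℚ.* ℚ.∣ seq (z i) n ∣ ℚ.< two ℚ.* two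
  bound n lt = subst (ℚ._< two ℚ.* two) (sym (abs-square (seq (z i) n)))
    (ℚ.≤-<-trans (term≤Σℚ (λ i → seq (z i) n ℚ.* seq (z i) n) (λ i → 0≤square (seq (z i) n)) i)
      (ℚ.<-≤-trans (subst (ℚ._< two) (seq-Σ (λ i → z i * z i) n) lt) 2≤4))

module _ (d : ℕ) where
  private
    G : Graph (double (suc d))
    G = crossPolytope (suc d)
    open Graph G

    -- Antipodal coordinates are never both positive, so the square of the difference of their roots
    -- is their sum. Barycentric coordinates adding up to one thus become squares adding up to one.
    f : Vector ℝ (double (suc d)) → Vector ℝ (suc d)
    f x k = √ (x (pos k)) + - √ (x (neg k))

    g : Vector ℝ (suc d) → Vector ℝ (double (suc d))
    g z i = part (sign {suc d} i) (z (axis i))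

    f-def : ∀ x k → f x k ≈ √ (x (pos k)) + - √ (x (neg k))
    f-def x k = ≈-refl {f x k}

    g-pos : ∀ z k → g z (pos k) ≡ part true (z k)
    g-pos z k = cong₂ part (sign-pos k) (cong z (axis-pos k))

    g-neg : ∀ z k → g z (neg k) ≡ part false (z k)
    g-neg z k = cong₂ part (sign-neg k) (cong z (axis-neg k))

    pos≢neg : ∀ {n} (k : Fin n) → pos k ≢ neg k
    pos≢neg k eq = contradiction (≡.trans (sym (sign-pos k)) (≡.trans (cong sign eq) (sign-neg k))) λ ()

    antipodal : ∀ k → adj (pos k) (neg k) ≡ false
    antipodal k = ≡.trans (cong₂ (λ a b → not (a == b)) (axis-pos k) (axis-neg k)) (cong not (==-refl k))

    module _ {x : Vector ℝ (double (suc d))} (real : InRealization (cliqueComplex G) x) where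
      √-positive : ∀ i → 0ℝ < √ (x i) → 0ℝ < x i
      √-positive i 0<√ = <-≤-trans {0ℝ} {√ (x i) * √ (x i)} {x i} (0<square {√ (x i)} 0<√)
        (≈⇒≤ {√ (x i) * √ (x i)} {x i} (square-√ {x i} (proj₁ real i)))

      √-disjoint : ∀ k → √ (x (pos k)) ⊓ √ (x (neg k)) ≈ 0ℝ
      √-disjoint k = ⊓-zero {√ (x (pos k))} {√ (x (neg k))} (0≤√ (x (pos k))) (0≤√ (x (neg k))) λ (p , q) →
        realization⇒disjoint G x real (pos k) (neg k) (pos≢neg k) (antipodal k)
            (√-positive (pos k) p , √-positive (neg k) q)

      part-pos : ∀ k → part true (f x k) ≈ x (pos k)
      part-pos k = ≈-trans {part true (f x k)} {√ (x (pos k)) * √ (x (pos k))} {x (pos k)}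
        (part-true-difference {f x k} {√ (x (pos k))} {√ (x (neg k))} (f-def x k) (√-disjoint k))
        (square-√ {x (pos k)} (proj₁ real (pos k)))

      part-neg : ∀ k → part false (f x k) ≈ x (neg k)
      part-neg k = ≈-trans {part false (f x k)} {√ (x (neg k)) * √ (x (neg k))} {x (neg k)}
        (part-false-difference {f x k} {√ (x (pos k))} {√ (x (neg k))} (f-def x k) (√-disjoint k))
        (square-√ {x (neg k)} (proj₁ real (neg k)))

      f-square : ∀ k → f x k * f x k ≈ x (pos k) + x (neg k)
      f-square k = ≈-trans {f x k * f x k} {part true (f x k) + part false (f x k)} {x (pos k) + x (neg k)}
        (≈-sym {part true (f x k) + part false (f x k)} {f x k * f x k} (part-sum (f x k)))
        (+-cong {part true (f x k)} {x (pos k)} {part false (f x k)} {x (neg k)} (part-pos k) (part-neg k))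

      f-sphere : Sphere d (f x)
      f-sphere = ≈-trans {Σℝ (λ k → f x k * f x k)} {Σℝ (λ k → x (pos k) + x (neg k))} {1ℝ}
        (Σℝ-cong {suc d} {λ k → f x k * f x k} {λ k → x (pos k) + x (neg k)} f-square)
        (≈-trans {Σℝ (λ k → x (pos k) + x (neg k))} {Σℝ x} {1ℝ} (Σ-pairs {suc d} x) (proj₁ (proj₂ real)))

      g∘f : ∀ i → g (f x) i ≈ x i
      g∘f = vertex-cases {suc d} (λ i → g (f x) i ≈ x i)
        (λ k → ≈-trans {g (f x) (pos k)} {part true (f x k)} {x (pos k)} (≡⇒≈ (g-pos (f x) k)) (part-pos k))
        (λ k → ≈-trans {g (f x) (neg k)} {part false (f x k)} {x (neg k)} (≡⇒≈ (g-neg (f x) k)) (part-neg k))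

    g-disjoint : ∀ z → Disjoint G (g z)
    g-disjoint z = vertex-cases {suc d} (λ i → ∀ j → i ≢ j → adj i j ≡ false → ¬ (0ℝ < g z i × 0ℝ < g z j))
      (λ k → vertex-cases {suc d} (λ j → pos k ≢ j → adj (pos k) j ≡ false → ¬ (0ℝ < g z (pos k) × 0ℝ < g z j))
        (λ l k≢l far _ → k≢l (cong pos (same k l (axis-pos k) (axis-pos l) far)))
        (λ l _ far (p , q) → crossing k l (same k l (axis-pos k) (axis-neg l) far) p q))
      (λ k → vertex-cases {suc d} (λ j → neg k ≢ j → adj (neg k) j ≡ false → ¬ (0ℝ < g z (neg k) × 0ℝ < g z j))
        (λ l _ far (p , q) → crossing l k (sym (same k l (axis-neg k) (axis-pos l) far)) q p)
        (λ l k≢l far _ → k≢l (cong neg (same k l (axis-neg k) (axis-neg l) far))))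
      where
      not-false : ∀ {b} → not b ≡ false → b ≡ true
      not-false {true} _ = refl
      same : ∀ {i j} k l → axis i ≡ k → axis j ≡ l → adj i j ≡ false → k ≡ l
      same {i} {j} k l refl refl far = ==⇒≡ {i = axis i} {axis j} (not-false far)
      crossing : ∀ k l → k ≡ l → 0ℝ < g z (pos k) → 0ℝ < g z (neg l) → ⊥
      crossing k .k refl p q = part-disjoint (z k) (subst (0ℝ <_) (g-pos z k) p , subst (0ℝ <_) (g-neg z k) q)

    g-realizes : ∀ {z} → Sphere d z → InRealization (cliqueComplex G) (g z)
    g-realizes {z} sphere = (λ i → 0≤part (sign {suc d} i) (z (axis i))) , sum≈1 , disjoint⇒clique G (g z)
        (g-disjoint z)
      where
      sum≈1 : Σℝ (g z) ≈ 1ℝ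
      sum≈1 = ≈-trans {Σℝ (g z)} {Σℝ (λ k → g z (pos k) + g z (neg k))} {1ℝ}
        (≈-sym {Σℝ (λ k → g z (pos k) + g z (neg k))} {Σℝ (g z)} (Σ-pairs {suc d} (g z)))
        (≈-trans {Σℝ (λ k → g z (pos k) + g z (neg k))} {Σℝ (λ k → z k * z k)} {1ℝ}
          (Σℝ-cong {suc d} {λ k → g z (pos k) + g z (neg k)} {λ k → z k * z k} λ k →
            ≈-trans {g z (pos k) + g z (neg k)} {part true (z k) + part false (z k)} {z k * z k}
              (≡⇒≈ (cong₂ _+_ (g-pos z k) (g-neg z k))) (part-sum (z k)))
          sphere)

    f∘g : ∀ z k → f (g z) k ≈ z k
    f∘g z k = ≈-trans {f (g z) k} {√ (g z (pos k)) + - √ (g z (neg k))} {z k} (f-def (g z) k)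
      (≈-trans {√ (g z (pos k)) + - √ (g z (neg k))} {√ (part true (z k)) + - √ (part false (z k))} {z k}
        (≡⇒≈ (cong₂ (λ a b → √ a + - √ b) (g-pos z k) (g-neg z k)))
        (recombine (z k)))
      where
      open +-*-Solver
      recombine : ∀ c → √ (part true c) + - √ (part false c) ≈ c
      recombine c = ≈-trans {√ (part true c) + - √ (part false c)} {(c + - (c ⊓ 0ℝ)) + - (- (c ⊓ 0ℝ))} {c}
        (+-cong {√ (part true c)} {c + - (c ⊓ 0ℝ)} { - √ (part false c)} { - (- (c ⊓ 0ℝ))} (√-part-true c)
          (-‿cong {√ (part false c)} { - (c ⊓ 0ℝ)} (√-part-false c)))
        (pointwise⇒≈ {(c + - (c ⊓ 0ℝ)) + - (- (c ⊓ 0ℝ))} {c} λ n → cancel (seq c n) (seq c n ℚ.⊓ 0ℚ))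
        where
        cancel : ∀ a m → (a ℚ.+ ℚ.- m) ℚ.+ ℚ.- (ℚ.- m) ≡ a
        cancel = solve 2 (λ a m → (a :+ (:- m)) :+ (:- (:- m)) := a) refl

    f-uc : UniformlyContinuous (InRealization (cliqueComplex G)) f
    f-uc {e} 0<e = half (half e) ℚ.* half (half e) , 0<e*f (0<half (0<half 0<e)) (0<half (0<half 0<e)) ,
        λ {x} {y} _ _ close k →
      ev-map₂ (λ _ p q → Near-+½ p (Near-neg q))
        (√-close {x (pos k)} {y (pos k)} (0<half 0<e) (close (pos k)))
        (√-close {x (neg k)} {y (neg k)} (0<half 0<e) (close (neg k)))

    g-uc : UniformlyContinuous (Sphere d) g
    g-uc {e} 0<e = half (half (half e)) , 0<half (0<half (0<half 0<e)) , λ {z} {w} Sz Sw close i →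
      part-close (sign {suc d} i) (z (axis i)) (w (axis i)) 0<e
        (sphere-bounded z Sz (axis i)) (sphere-bounded w Sw (axis i)) (close (axis i))

  crossPolytope-sphere : Homeomorphism (InRealization (cliqueComplex (crossPolytope (suc d)))) (Sphere d)
  crossPolytope-sphere = mkHomeomorphism f g (λ {x} → f-sphere {x}) (λ {z} → g-realizes {z}) (λ {e} → f-uc {e})
      (λ {e} → g-uc {e})
    (λ {z} _ → f∘g z) (λ {x} → g∘f {x})

-- Flag 3-spheres with a marked facet

module _ (t : ℚ) where

  -- The cross-polytope boundary is a join of `n` pairs of points, and f-polynomials multiply under
  -- joins: each retained pair contributes `1 + 2 t`, each omitted one contributes `1`.
  axisWeight : ∀ n → (Fin n → Bool) → ℚ
  axisWeight zero    R = 1ℚ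
  axisWeight (suc n) R = (if R zero then 1ℚ ℚ.+ (t ℚ.+ t) else 1ℚ) ℚ.* axisWeight n (R ∘ suc)

  K-crossPolytope : ∀ n (R : Fin n → Bool) {S} → (∀ i → S i ≡ R (axis i)) →
                    K t (Graph.adj (crossPolytope n)) S ≡ axisWeight n R
  K-crossPolytope zero    R S≗ = refl
  K-crossPolytope (suc n) R {S} S≗ = ≡.trans (K-cong t {adj = adj₊} S≗ (λ _ _ _ _ → refl)) (by-cases (R zero) refl)
    where
    open +-*-Solver
    adj₊ : Adjacency (double (suc n))
    adj₊ = Graph.adj (crossPolytope (suc n))
    A : ℚ
    A = K t (Graph.adj (crossPolytope n)) (R ∘ suc ∘ axis)
    A≡ : A ≡ axisWeight n (R ∘ suc)
    A≡ = K-crossPolytope n (R ∘ suc) (λ _ → refl)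
    by-cases : ∀ b → R zero ≡ b → K t adj₊ (R ∘ axis) ≡ (if R zero then 1ℚ ℚ.+ (t ℚ.+ t) else 1ℚ) ℚ.* axisWeight n
        (R ∘ suc)
    by-cases false eq rewrite eq = ≡.trans (solve 1 (λ a → (a :+ con 0ℚ) :+ con 0ℚ := con 1ℚ :* a) refl A)
        (cong (1ℚ ℚ.*_) A≡)
    by-cases true  eq rewrite eq = ≡.trans
      (cong₂ (λ b c → (A ℚ.+ t ℚ.* b) ℚ.+ t ℚ.* (c ℚ.+ 0ℚ)) full full)
      (≡.trans (solve 2 (λ a t → (a :+ t :* a) :+ t :* (a :+ con 0ℚ) := (con 1ℚ :+ (t :+ t)) :* a) refl A t)
        (cong ((1ℚ ℚ.+ (t ℚ.+ t)) ℚ.*_) A≡))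
      where
      full : K t (Graph.adj (crossPolytope n)) (λ i → R (suc (axis i)) ∧ true) ≡ A
      full = K-ext t (Graph.adj (crossPolytope n)) (λ i → ∧-identityʳ (R (suc (axis i))))

nat : ℕ → ℚ
nat k = ι (+ k)

nat-suc : ∀ k → nat (suc k) ≡ 1ℚ ℚ.+ nat k
nat-suc k = ι-homo-+ (+ 1) (+ k)

nat-+ : ∀ j k → nat (j ℕ.+ k) ≡ nat j ℚ.+ nat k
nat-+ j k = ι-homo-+ (+ j) (+ k)

-- The f-polynomial of a (4 + k)-gon.
polygon : ℕ → ℚ → ℚ
polygon k t = (1ℚ ℚ.+ (t ℚ.+ t)) ℚ.* (1ℚ ℚ.+ (t ℚ.+ t)) ℚ.+ nat k ℚ.* (t ℚ.+ t ℚ.* t)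

polygon-suc : ∀ k t → polygon (suc k) t ≡ polygon k t ℚ.+ (t ℚ.+ t ℚ.* t) ℚ.* 1ℚ
polygon-suc k t = ≡.trans (cong (λ z → (1ℚ ℚ.+ (t ℚ.+ t)) ℚ.* (1ℚ ℚ.+ (t ℚ.+ t)) ℚ.+ z ℚ.* (t ℚ.+ t ℚ.* t)) (nat-suc k))
  (solve 3 (λ a z w → a :+ (con 1ℚ :+ z) :* w := (a :+ z :* w) :+ w :* con 1ℚ) refl
    ((1ℚ ℚ.+ (t ℚ.+ t)) ℚ.* (1ℚ ℚ.+ (t ℚ.+ t))) (nat k) (t ℚ.+ t ℚ.* t))
  where open +-*-Solver

-- The f-polynomial of a flag 3-sphere with γ(t) = 1 + a t + b t².
fγ : ℕ → ℕ → ℚ → ℚ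
fγ a b t = D ℚ.* D ℚ.+ (nat a ℚ.* (w ℚ.* D) ℚ.+ nat b ℚ.* (w ℚ.* w))
  where
  D w : ℚ
  D = (1ℚ ℚ.+ (t ℚ.+ t)) ℚ.* (1ℚ ℚ.+ (t ℚ.+ t))
  w = t ℚ.+ t ℚ.* t

-- Substituting `t / (1 + t)` into `h` gives `f(t) = (1 + t)⁴ h(t / (1 + t))`, hence
-- `f = D² γ(w / D)` with `D = (1 + 2 t)²` and `w = t + t²`. The increment `w (D + k w)` is
-- therefore exactly the change of `γ` by `t + k t²`.
fγ-step : ∀ a b k t → fγ (suc a) (b ℕ.+ k) t ≡ fγ a b t ℚ.+ (t ℚ.+ t ℚ.* t) ℚ.* polygon k t
fγ-step a b k t = ≡.trans
  (cong₂ (λ y z → D ℚ.* D ℚ.+ (y ℚ.* (w ℚ.* D) ℚ.+ z ℚ.* (w ℚ.* w))) (nat-suc a) (nat-+ b k))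
  (solve 5 (λ d w a b k → d :* d :+ ((con 1ℚ :+ a) :* (w :* d) :+ (b :+ k) :* (w :* w)) :=
      (d :* d :+ (a :* (w :* d) :+ b :* (w :* w))) :+ w :* (d :+ k :* w)) refl D w (nat a) (nat b) (nat k))
  where
  open +-*-Solver
  D w : ℚ
  D = (1ℚ ℚ.+ (t ℚ.+ t)) ℚ.* (1ℚ ℚ.+ (t ℚ.+ t))
  w = t ℚ.+ t ℚ.* t

-- A flag 3-sphere with γ(t) = 1 + γ₁ t + γ₂ t² and a marked facet {v,p,x,u}
-- whose opposite edges vp and xu have links of lengths 4 + k and 4 + l.
record State (k l γ₁ γ₂ : ℕ) : Set where
  field
    {size}       : ℕ
    graph        : Graph size
    triangulates : TriangulatesS³ (cliqueComplex graph)
  open Graph graph public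
  field
    v p x u  : Fin size
    vp       : adj v p ≡ true
    vx       : adj v x ≡ true
    vu       : adj v u ≡ true
    px       : adj p x ≡ true
    pu       : adj p u ≡ true
    xu       : adj x u ≡ true
    K-all    : ∀ t → K t adj everything ≡ fγ γ₁ γ₂ t
    K-vp     : ∀ t → K t adj (lk adj (v ∷ p ∷ [])) ≡ polygon k t
    K-xu     : ∀ t → K t adj (lk adj (x ∷ u ∷ [])) ≡ polygon l t
    K-xp     : ∀ t → K t adj (lk adj (x ∷ p ∷ [])) ≡ polygon 0 t
    K-xvp    : ∀ t → K t adj (lk adj (x ∷ v ∷ p ∷ [])) ≡ 1ℚ ℚ.+ (t ℚ.+ t)
    K-xuvp   : ∀ t → K t adj (lk adj (x ∷ u ∷ v ∷ p ∷ [])) ≡ 1ℚ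

initial : State 0 0 0 0
initial = record
  { graph = crossPolytope 4
  ; triangulates = crossPolytope-sphere 3
  ; v = v₀ ; p = p₀ ; x = x₀ ; u = u₀
  ; vp = refl ; vx = refl ; vu = refl ; px = refl ; pu = refl ; xu = refl
  ; K-all = λ t → ≡.trans (K-crossPolytope t 4 (λ _ → true) (λ _ → refl))
      (solve 2 (λ s w → s :* (s :* (s :* (s :* con 1ℚ))) :=
          (s :* s) :* (s :* s) :+ (con 0ℚ :* (w :* (s :* s)) :+ con 0ℚ :* (w :* w))) refl (1ℚ ℚ.+ (t ℚ.+ t))
              (t ℚ.+ t ℚ.* t))
  ; K-vp = λ t → ≡.trans (link t (v₀ ∷ p₀ ∷ []))
      (solve 2 (λ s w → con 1ℚ :* (con 1ℚ :* (s :* (s :* con 1ℚ))) := s :* s :+ con 0ℚ :* w) refl (1ℚ ℚ.+ (t ℚ.+ t))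
          (t ℚ.+ t ℚ.* t))
  ; K-xu = λ t → ≡.trans (link t (x₀ ∷ u₀ ∷ []))
      (solve 2 (λ s w → s :* (s :* (con 1ℚ :* (con 1ℚ :* con 1ℚ))) := s :* s :+ con 0ℚ :* w) refl (1ℚ ℚ.+ (t ℚ.+ t))
          (t ℚ.+ t ℚ.* t))
  ; K-xp = λ t → ≡.trans (link t (x₀ ∷ p₀ ∷ []))
      (solve 2 (λ s w → s :* (con 1ℚ :* (con 1ℚ :* (s :* con 1ℚ))) := s :* s :+ con 0ℚ :* w) refl (1ℚ ℚ.+ (t ℚ.+ t))
          (t ℚ.+ t ℚ.* t))
  ; K-xvp = λ t → ≡.trans (link t (x₀ ∷ v₀ ∷ p₀ ∷ []))
      (solve 1 (λ s → con 1ℚ :* (con 1ℚ :* (con 1ℚ :* (s :* con 1ℚ))) := s) refl (1ℚ ℚ.+ (t ℚ.+ t)))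
  ; K-xuvp = λ t → link t (x₀ ∷ u₀ ∷ v₀ ∷ p₀ ∷ [])
  }
  where
  open +-*-Solver
  v₀ p₀ x₀ u₀ : Fin (double 4)
  v₀ = pos {4} zero
  p₀ = pos {4} (suc zero)
  x₀ = pos {4} (suc (suc zero))
  u₀ = pos {4} (suc (suc (suc zero)))
  away : List (Fin (double 4)) → Fin 4 → Bool
  away []      k = true
  away (i ∷ σ) k = not (axis {4} i == k) ∧ away σ k
  away-lk : ∀ σ i → lk (Graph.adj (crossPolytope 4)) σ i ≡ away σ (axis {4} i)
  away-lk []      i = refl
  away-lk (j ∷ σ) i = cong (not (axis {4} j == axis {4} i) ∧_) (away-lk σ i)
  link : ∀ t σ → K t (Graph.adj (crossPolytope 4)) (lk (Graph.adj (crossPolytope 4)) σ) ≡ axisWeight t 4 (away σ)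
  link t σ = K-crossPolytope t 4 (away σ) (away-lk σ)

K-permuted : ∀ t {n} (adj : Adjacency n) {σ τ q} → σ ↭ τ → K t adj (lk adj τ) ≡ q → K t adj (lk adj σ) ≡ q
K-permuted t adj σ↭τ = ≡.trans (K-ext t adj (lk-↭ adj σ↭τ))

private
  module _ {A : Set} where
    ↭-ba : (a b : A) → a ∷ b ∷ [] ↭ b ∷ a ∷ []
    ↭-ba a b = swap a b ↭.refl

    ↭-acb : (a b c : A) → a ∷ b ∷ c ∷ [] ↭ a ∷ c ∷ b ∷ []
    ↭-acb a b c = prep a (swap b c ↭.refl)

    ↭-cba : (a b c : A) → a ∷ b ∷ c ∷ [] ↭ c ∷ b ∷ a ∷ []
    ↭-cba a b c = ↭.trans (swap a b ↭.refl) (↭.trans (prep b (swap a c ↭.refl)) (swap b c ↭.refl))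

    ↭-adbc : (a b c d : A) → a ∷ b ∷ c ∷ d ∷ [] ↭ a ∷ d ∷ b ∷ c ∷ []
    ↭-adbc a b c d = prep a (↭.trans (prep b (swap c d ↭.refl)) (swap b d ↭.refl))

    ↭-acdb : (a b c d : A) → a ∷ b ∷ c ∷ d ∷ [] ↭ a ∷ c ∷ d ∷ b ∷ []
    ↭-acdb a b c d = prep a (↭.trans (swap b c ↭.refl) (prep c (swap b d ↭.refl)))

    ↭-dcab : (a b c d : A) → a ∷ b ∷ c ∷ d ∷ [] ↭ d ∷ c ∷ a ∷ b ∷ []
    ↭-dcab a b c d = ↭.trans (↭-adbc a b c d)
      (↭.trans (swap a d ↭.refl) (prep d (↭.trans (prep a (swap b c ↭.refl)) (swap a c ↭.refl))))

    ↭-cdba : (a b c d : A) → a ∷ b ∷ c ∷ d ∷ [] ↭ c ∷ d ∷ b ∷ a ∷ []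
    ↭-cdba a b c d = ↭.↭-sym (↭-dcab c d b a)

module _ {k l γ₁ γ₂} (st : State k l γ₁ γ₂) where
  open State st

  private
    flip : ∀ {i j} → adj i j ≡ true → adj j i ≡ true
    flip {i} {j} = ≡.trans (symm j i)

    _∧ᵗ_ : ∀ {a b} → a ≡ true → b ≡ true → a ∧ b ≡ true
    refl ∧ᵗ eq = eq

    infixr 5 _∧ᵗ_

  -- The new vertex replaces `u`, and the half edge at `x` inherits the link of `xu`, so the step
  -- can be iterated. As `x`, `u`, `v`, `p` span a facet, `xu` is an edge of the cycle around `vp`,
  -- which becomes longer by one.
  subdivide-xu : State (suc k) l (suc γ₁) (γ₂ ℕ.+ l)
  subdivide-xu = record
    { graph = subdivision
    ; triangulates = Homeomorphism-trans subdivision-homeomorphism triangulates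
    ; v = suc v ; p = suc p ; x = suc x ; u = zero
    ; vp = ≡.trans (adj⁻-away (adjacent⇒≢ vx) (adjacent⇒≢ vu)) vp
    ; vx = ≡.trans (adj⁻-away (adjacent⇒≢ vx) (adjacent⇒≢ vu)) vx
    ; vu = nearby-common (flip vx) (flip vu)
    ; px = ≡.trans (adj⁻-away (adjacent⇒≢ px) (adjacent⇒≢ pu)) px
    ; pu = nearby-common (flip px) (flip pu)
    ; xu = nearby-u
    ; K-all = λ t → ≡.trans (K-lk-disjoint t [] refl refl)
        (≡.trans (cong₂ (λ a b → a ℚ.+ (t ℚ.+ t ℚ.* t) ℚ.* b) (K-all t) (K-xu t)) (sym (fγ-step γ₁ γ₂ l t)))
    ; K-vp = λ t → ≡.trans (K-lk-disjoint t (v ∷ p ∷ []) vp-x vp-u)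
        (≡.trans (cong₂ (λ a b → a ℚ.+ (t ℚ.+ t ℚ.* t) ℚ.* b) (K-vp t) (K-xuvp t)) (sym (polygon-suc k t)))
    ; K-xu = λ t → ≡.trans (K-lk-halfEdge t [] refl refl) (K-xu t)
    ; K-xp = λ t → ≡.trans (K-lk-sharing t (p ∷ []) (px ∧ᵗ refl) (pu ∧ᵗ refl)) (K-xp t)
    ; K-xvp = λ t → ≡.trans (K-lk-sharing t (v ∷ p ∷ []) vp-x vp-u) (K-xvp t)
    ; K-xuvp = λ t → ≡.trans (K-lk-halfEdge t (v ∷ p ∷ []) vp-x vp-u) (K-xuvp t)
    }
    where
    open Subdivision graph x u xu
    open SubdivisionHomeomorphism graph x u xu
    vp-x : lk adj (v ∷ p ∷ []) x ≡ true
    vp-x = vx ∧ᵗ px ∧ᵗ refl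
    vp-u : lk adj (v ∷ p ∷ []) u ≡ true
    vp-u = vu ∧ᵗ pu ∧ᵗ refl

  -- The mirror image of `subdivide-xu`, with the new vertex in place of `v`. The end `p` is the one
  -- kept, as `x` is there, so that the edge `xp` survives and its link remains a quadrilateral.
  subdivide-vp : State k (suc l) (suc γ₁) (γ₂ ℕ.+ k)
  subdivide-vp = record
    { graph = subdivision
    ; triangulates = Homeomorphism-trans subdivision-homeomorphism triangulates
    ; v = zero ; p = suc p ; x = suc x ; u = suc u
    ; vp = nearby-u
    ; vx = nearby-common px vx
    ; vu = nearby-common pu vu
    ; px = ≡.trans (adj⁻-symm p x) (≡.trans (adj⁻-away (adjacent⇒≢ (flip px)) (adjacent⇒≢ (flip vx))) (flip px))
    ; pu = ≡.trans (adj⁻-symm p u) (≡.trans (adj⁻-away (adjacent⇒≢ (flip pu)) (adjacent⇒≢ (flip vu))) (flip pu))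
    ; xu = ≡.trans (adj⁻-away (adjacent⇒≢ (flip px)) (adjacent⇒≢ (flip vx))) xu
    ; K-all = λ t → ≡.trans (K-lk-disjoint t [] refl refl)
        (≡.trans (cong₂ (λ a b → a ℚ.+ (t ℚ.+ t ℚ.* t) ℚ.* b) (K-all t) (K-permuted t adj (↭-ba p v) (K-vp t)))
            (sym (fγ-step γ₁ γ₂ k t)))
    ; K-vp = λ t → K-permuted t adj′ (↭-ba zero (suc p))
        (≡.trans (K-lk-halfEdge t [] refl refl) (K-permuted t adj (↭-ba p v) (K-vp t)))
    ; K-xu = λ t → ≡.trans (K-lk-disjoint t (x ∷ u ∷ []) xu-p xu-v)
        (≡.trans (cong₂ (λ a b → a ℚ.+ (t ℚ.+ t ℚ.* t) ℚ.* b) (K-xu t) (K-permuted t adj (↭-cdba p v x u) (K-xuvp t)))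
            (sym (polygon-suc l t)))
    ; K-xp = λ t → K-permuted t adj′ (↭-ba (suc x) (suc p))
        (≡.trans (K-lk-sharing t (x ∷ []) (flip px ∧ᵗ refl) (flip vx ∧ᵗ refl)) (K-permuted t adj (↭-ba p x) (K-xp t)))
    ; K-xvp = λ t → K-permuted t adj′ (↭-cba (suc x) zero (suc p))
        (≡.trans (K-lk-halfEdge t (x ∷ []) (flip px ∧ᵗ refl) (flip vx ∧ᵗ refl))
        (K-permuted t adj (↭-cba p v x) (K-xvp t)))
    ; K-xuvp = λ t → K-permuted t adj′ (↭-dcab (suc x) (suc u) zero (suc p))
        (≡.trans (K-lk-halfEdge t (x ∷ u ∷ []) xu-p xu-v) (K-permuted t adj (↭-cdba p v x u) (K-xuvp t)))
    }
    where
    open Subdivision graph p v (flip vp)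
    open SubdivisionHomeomorphism graph p v (flip vp)
    xu-p : lk adj (x ∷ u ∷ []) p ≡ true
    xu-p = flip px ∧ᵗ flip pu ∧ᵗ refl
    xu-v : lk adj (x ∷ u ∷ []) v ≡ true
    xu-v = flip vx ∧ᵗ flip vu ∧ᵗ refl

  -- The new vertex replaces `p`. The link of the new edge `vp` is the suspension of the two points
  -- forming the link of `x`, `v`, `p`: a quadrilateral whatever `k` was, while the cycle around
  -- `xu` only exchanges a vertex.
  subdivide-xp : State 0 l (suc γ₁) γ₂
  subdivide-xp = record
    { graph = subdivision
    ; triangulates = Homeomorphism-trans subdivision-homeomorphism triangulates
    ; v = suc v ; p = zero ; x = suc x ; u = suc u
    ; vp = nearby-common (flip vx) (flip vp)
    ; vx = ≡.trans (adj⁻-away (adjacent⇒≢ vx) (adjacent⇒≢ vp)) vx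
    ; vu = ≡.trans (adj⁻-away (adjacent⇒≢ vx) (adjacent⇒≢ vp)) vu
    ; px = nearby-u
    ; pu = nearby-common xu pu
    ; xu = ≡.trans (adj⁻-symm x u) (≡.trans (adj⁻-away (adjacent⇒≢ (flip xu)) (adjacent⇒≢ (flip pu))) (flip xu))
    ; K-all = λ t → ≡.trans (K-lk-disjoint t [] refl refl)
        (≡.trans (cong₂ (λ a b → a ℚ.+ (t ℚ.+ t ℚ.* t) ℚ.* b) (K-all t) (K-xp t))
          (≡.trans (sym (fγ-step γ₁ γ₂ 0 t)) (cong (λ z → fγ (suc γ₁) z t) (ℕ.+-identityʳ γ₂))))
    ; K-vp = λ t → K-permuted t adj′ (↭-ba (suc v) zero) (≡.trans (K-lk-newVertex t (v ∷ []) (vx ∧ᵗ refl) (vp ∧ᵗ refl))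
        (≡.trans (cong ((1ℚ ℚ.+ (t ℚ.+ t)) ℚ.*_) (K-permuted t adj (↭-acb x p v) (K-xvp t)))
          (solve 2 (λ s w → s :* s := s :* s :+ con 0ℚ :* w) refl (1ℚ ℚ.+ (t ℚ.+ t)) (t ℚ.+ t ℚ.* t))))
    ; K-xu = λ t → ≡.trans (K-lk-sharing t (u ∷ []) (flip xu ∧ᵗ refl) (flip pu ∧ᵗ refl)) (K-xu t)
    ; K-xp = λ t → ≡.trans (K-lk-halfEdge t [] refl refl) (K-xp t)
    ; K-xvp = λ t → K-permuted t adj′ (↭-acb (suc x) (suc v) zero)
        (≡.trans (K-lk-halfEdge t (v ∷ []) (vx ∧ᵗ refl) (vp ∧ᵗ refl)) (K-permuted t adj (↭-acb x p v) (K-xvp t)))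
    ; K-xuvp = λ t → K-permuted t adj′ (↭-adbc (suc x) (suc u) (suc v) zero) (≡.trans
        (K-lk-halfEdge t (u ∷ v ∷ []) (flip xu ∧ᵗ vx ∧ᵗ refl) (flip pu ∧ᵗ vp ∧ᵗ refl))
            (K-permuted t adj (↭-acdb x p u v) (K-xuvp t)))
    }
    where
    open +-*-Solver
    open Subdivision graph x p (flip px)
    open SubdivisionHomeomorphism graph x p (flip px)

-- Arithmetic of iterated subdivisions

subdivide-vp^ : ∀ c {l γ₁ γ₂} → State 0 l γ₁ γ₂ → State 0 (c ℕ.+ l) (c ℕ.+ γ₁) γ₂
subdivide-vp^ zero    st = st
subdivide-vp^ (suc c) {γ₂ = γ₂} st = subst (State 0 _ _) (ℕ.+-identityʳ γ₂) (subdivide-vp (subdivide-vp^ c st))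

subdivide-xu^ : ∀ m {k l γ₁ γ₂} → State k l γ₁ γ₂ → State (m ℕ.+ k) l (m ℕ.+ γ₁) (m ℕ.* l ℕ.+ γ₂)
subdivide-xu^ zero    st = st
subdivide-xu^ (suc m) {l = l} {γ₂ = γ₂} st = subst (State _ l _)
  (≡.trans (ℕ.+-comm (m ℕ.* l ℕ.+ γ₂) l) (sym (ℕ.+-assoc l (m ℕ.* l) γ₂))) (subdivide-xu (subdivide-xu^ m st))

-- Always at least one subdivision, so that the link of `vp` is a quadrilateral at the end. Further
-- ones only raise `γ₁` and serve to fill it up to the required value.
subdivide-xp^ : ∀ j {k l γ₁ γ₂} → State k l γ₁ γ₂ → State 0 l (suc j ℕ.+ γ₁) γ₂
subdivide-xp^ zero    st = subdivide-xp st
subdivide-xp^ (suc j) st = subdivide-xp (subdivide-xp^ j st)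

even⊎odd : ∀ a → ∃ λ h → a ≡ h ℕ.+ h ⊎ a ≡ h ℕ.+ suc h
even⊎odd zero = 0 , inj₁ refl
even⊎odd (suc a) with even⊎odd a
... | h , inj₁ refl = h , inj₂ (sym (ℕ.+-suc h h))
... | h , inj₂ refl = suc h , inj₁ refl

halve : ∀ a g → 4 ℕ.* g ℕ.≤ a ℕ.* a → ∃₂ λ h h′ → h ℕ.+ h′ ≡ a × g ℕ.≤ h ℕ.* h′
halve a g 4g≤a² with even⊎odd a
... | h , inj₁ refl = h , h , refl , ℕ.*-cancelˡ-≤ 4 (subst (4 ℕ.* g ℕ.≤_)
  (solve 1 (λ h → (h :+ h) :* (h :+ h) := con 4 :* (h :* h)) refl h) 4g≤a²)
  where open ℕ-Solver
... | h , inj₂ refl = h , suc h , refl , ℕ.≤-pred (ℕ.*-cancelˡ-< 4 g (suc (h ℕ.* suc h)) (ℕ.≤-<-trans 4g≤a²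
  (subst₂ ℕ._<_
      (solve 1 (λ h → con 1 :+ con 4 :* (h :* (con 1 :+ h)) := (h :+ (con 1 :+ h)) :* (h :+ (con 1 :+ h))) refl h)
    (solve 1 (λ h → con 4 :+ con 4 :* (h :* (con 1 :+ h)) := con 4 :* (con 1 :+ h :* (con 1 :+ h))) refl h)
    (ℕ.+-monoˡ-< (4 ℕ.* (h ℕ.* suc h)) {1} {4} (ℕ.s≤s (ℕ.s≤s ℕ.z≤n))))))
  where open ℕ-Solver

-- The join of a (4 + b)-gon and a (4 + c)-gon, with o + 1 further subdivisions of
-- edges whose links are quadrilaterals.
realize-product : ∀ b c o → State 0 c (suc o ℕ.+ (b ℕ.+ c)) (b ℕ.* c)
realize-product b c o = 
  subst₂ (λ l g → State 0 l (suc o ℕ.+ (b ℕ.+ l)) g) (ℕ.+-identityʳ c)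
      (≡.trans (ℕ.+-identityʳ (b ℕ.* (c ℕ.+ 0))) (cong (b ℕ.*_) (ℕ.+-identityʳ c)))
    (subdivide-xp^ o (subdivide-xu^ b (subdivide-vp^ c initial)))

-- After subdivide-xp the link of vp is a quadrilateral again, so r subdivisions of
-- xu turn it into a (4 + r)-gon and the final subdivision adds exactly r to γ₂.
realize-remainder : ∀ b c o r → ∃₂ λ k l → State k l (suc (r ℕ.+ (suc o ℕ.+ (b ℕ.+ c)))) (r ℕ.* c ℕ.+ b ℕ.* c ℕ.+ r)
realize-remainder b c o r = r , suc c ,
  subst (λ k → State k (suc c) (suc (r ℕ.+ (suc o ℕ.+ (b ℕ.+ c)))) (r ℕ.* c ℕ.+ b ℕ.* c ℕ.+ k)) (ℕ.+-identityʳ r)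
    (subdivide-vp (subdivide-xu^ r (realize-product b c o)))

-- Division of `g` by `suc h` gives a quotient `c ≤ h′`. With remainder zero a join suffices and `o`
-- fills the gap to `h′`. A positive remainder forces `c < h′`, and the spare unit is used for the
-- final subdivision of `vp`.
realize : ∀ a g → 4 ℕ.* g ℕ.≤ a ℕ.* a → ∃₂ λ k l → State k l (suc a) g
realize a g 4g≤a² with halve a g 4g≤a²
... | zero , h′ , refl , g≤0 with refl ← ℕ.n≤0⇒n≡0 g≤0 =
  0 , 0 , subst (λ n → State 0 0 n 0) (cong suc (ℕ.+-identityʳ a)) (realize-product 0 0 a)
... | suc h , h′ , refl , g≤hh′ = by-remainder (g % suc h) refl
  where
  open ℕ-Solver
  c : ℕ
  c = g / suc h
  g≡ : g ≡ g % suc h ℕ.+ c ℕ.* suc h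
  g≡ = m≡m%n+[m/n]*n g (suc h)
  c≤h′ : g % suc h ≡ 0 → c ℕ.≤ h′
  c≤h′ eq = ℕ.*-cancelˡ-≤ (suc h)
      (subst (ℕ._≤ suc h ℕ.* h′) (≡.trans g≡ (≡.trans (cong (ℕ._+ c ℕ.* suc h) eq) (ℕ.*-comm c (suc h)))) g≤hh′)
  c<h′ : ∀ {r} → g % suc h ≡ suc r → c ℕ.< h′
  c<h′ {r} eq = ℕ.*-cancelˡ-< (suc h) c h′ (ℕ.<-≤-trans
    (subst₂ ℕ._<_ (ℕ.*-comm c (suc h)) (sym (≡.trans g≡ (cong (ℕ._+ c ℕ.* suc h) eq)))
        (ℕ.s≤s (ℕ.m≤n+m (c ℕ.* suc h) r))) g≤hh′)
  by-remainder : ∀ r → g % suc h ≡ r → ∃₂ λ k l → State k l (suc (suc h ℕ.+ h′)) g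
  by-remainder zero eq =
    let o , c+o≡ = ℕ.m≤n⇒∃[o]m+o≡n (c≤h′ eq) in
    0 , c , subst₂ (State 0 c)
      (≡.trans (solve 3 (λ h c o → (con 1 :+ o) :+ (con 1 :+ (h :+ c)) := con 1 :+
          (con 1 :+ (h :+ (c :+ o)))) refl h c o)
        (cong (λ z → suc (suc (h ℕ.+ z))) c+o≡))
      (sym (≡.trans g≡ (≡.trans (cong (ℕ._+ c ℕ.* suc h) eq) (ℕ.*-comm c (suc h)))))
      (realize-product (suc h) c o)
  by-remainder (suc r) eq =
    let o , c+o≡ = ℕ.m≤n⇒∃[o]m+o≡n (c<h′ eq)
        -- The `suc h` subdivisions of `xu` are split into `b` before and `suc r` after the
        -- subdivision of `xp`: each adds `c` to `γ₂`, but only the later ones lengthen the new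
        -- cycle around `vp`.
        b , b≡ = ℕ.m≤n⇒∃[o]m+o≡n (ℕ.<⇒≤ (subst (ℕ._< suc h) eq (m%n<n g (suc h))))
        k , l , st = realize-remainder b c o (suc r)
    in k , l , subst₂ (State k l)
      (≡.trans (solve 4 (λ r o b c → con 1 :+ ((con 1 :+ r) :+ ((con 1 :+ o) :+ (b :+ c))) := con 1 :+
          (((con 1 :+ r) :+ b) :+ ((con 1 :+ c) :+ o))) refl r o b c)
        (cong₂ (λ y z → suc (y ℕ.+ z)) b≡ c+o≡))
      (≡.trans (solve 3 (λ r b c → (con 1 :+ r) :* c :+ b :* c :+ (con 1 :+ r) := (con 1 :+ r) :+ c :*
          ((con 1 :+ r) :+ b)) refl r b c)
        (sym (≡.trans g≡ (cong₂ (λ y z → y ℕ.+ c ℕ.* z) eq (sym b≡)))))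
      st

-- The h-polynomial

-- The coefficients of `(1 + t)⁴ + γ₁ t (1 + t)² + γ₂ t²`.
hPolynomial : ℤ → ℤ → Polynomial
hPolynomial γ₁ γ₂ = + 1 ∷ + 4 ℤ.+ γ₁ ∷ + 6 ℤ.+ (γ₁ ℤ.+ γ₁ ℤ.+ γ₂) ∷ + 4 ℤ.+ γ₁ ∷ + 1 ∷ []

evalh : ℚ → ℚ → ℚ → ℚ
evalh A B t = 1ℚ ℚ.+ t ℚ.*
    ((ι (+ 4) ℚ.+ A) ℚ.+ t ℚ.* ((ι (+ 6) ℚ.+ (A ℚ.+ A ℚ.+ B)) ℚ.+ t ℚ.* ((ι (+ 4) ℚ.+ A) ℚ.+ t ℚ.* (1ℚ ℚ.+ t ℚ.* 0ℚ))))

evalℚ-h : ∀ γ₁ γ₂ t → evalℚ (hPolynomial γ₁ γ₂) t ≡ evalh (ι γ₁) (ι γ₂) t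
evalℚ-h γ₁ γ₂ t = cong₂ (λ p q → 1ℚ ℚ.+ t ℚ.* (p ℚ.+ t ℚ.* (q ℚ.+ t ℚ.* (p ℚ.+ t ℚ.* (1ℚ ℚ.+ t ℚ.* 0ℚ)))))
  (ι-homo-+ (+ 4) γ₁)
  (≡.trans (ι-homo-+ (+ 6) (γ₁ ℤ.+ γ₁ ℤ.+ γ₂)) (cong (ι (+ 6) ℚ.+_)
    (≡.trans (ι-homo-+ (γ₁ ℤ.+ γ₁) γ₂) (cong (ℚ._+ ι γ₂) (ι-homo-+ γ₁ γ₁)))))

-- The ring solver cannot cancel an inverse. So `expand` gathers the product `(1 + t)² i`, which is
-- then replaced by `1`, and `collect` compares polynomials.
h-from-γ : ∀ γ₁ γ₂ → Is[1+t]⁴p[t/[1+t]²] (hPolynomial γ₁ γ₂) (+ 1 ∷ γ₁ ∷ γ₂ ∷ [])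
h-from-γ γ₁ γ₂ t = ≡.trans (evalℚ-h γ₁ γ₂ t) (sym (≡.trans (expand t (ι γ₁) (ι γ₂) i)
    (≡.trans (cong (λ z → (1ℚ ℚ.+ t) ^ 4 ℚ.+ t ℚ.* z ℚ.* (1ℚ ℚ.+ t) ^ 2 ℚ.* ι γ₁ ℚ.+ (t ℚ.* z) ℚ.* (t ℚ.* z) ℚ.* ι γ₂)
        (ℚ.*-inverseʳ ((1ℚ ℚ.+ t) ^ 2)))
      (collect t (ι γ₁) (ι γ₂)))))
  where
  open +-*-Solver renaming (Polynomial to Expr)
  i : ℚ
  i = ℚ.1/ ((1ℚ ℚ.+ t) ^ 2)
  y² : ∀ {n} → Expr n → Expr n
  y² t = (con 1ℚ :+ t) :* ((con 1ℚ :+ t) :* con 1ℚ)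
  y⁴ : ∀ {n} → Expr n → Expr n
  y⁴ t = (con 1ℚ :+ t) :* ((con 1ℚ :+ t) :* y² t)
  expand : ∀ t A B i → (1ℚ ℚ.+ t) ^ 4 ℚ.* (1ℚ ℚ.+ (t ℚ.* i) ℚ.* (A ℚ.+ (t ℚ.* i) ℚ.* (B ℚ.+ (t ℚ.* i) ℚ.* 0ℚ))) ≡
    (1ℚ ℚ.+ t) ^ 4 ℚ.+ t ℚ.* ((1ℚ ℚ.+ t) ^ 2 ℚ.* i) ℚ.* (1ℚ ℚ.+ t) ^ 2 ℚ.* A ℚ.+ (t ℚ.* ((1ℚ ℚ.+ t) ^ 2 ℚ.* i)) ℚ.*
        (t ℚ.* ((1ℚ ℚ.+ t) ^ 2 ℚ.* i)) ℚ.* B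
  expand = solve 4 (λ t A B i → y⁴ t :* (con 1ℚ :+ (t :* i) :* (A :+ (t :* i) :* (B :+ (t :* i) :* con 0ℚ))) :=
    y⁴ t :+ t :* (y² t :* i) :* y² t :* A :+ (t :* (y² t :* i)) :* (t :* (y² t :* i)) :* B) refl
  collect : ∀ t A B → (1ℚ ℚ.+ t) ^ 4 ℚ.+ t ℚ.* 1ℚ ℚ.* (1ℚ ℚ.+ t) ^ 2 ℚ.* A ℚ.+ (t ℚ.* 1ℚ) ℚ.* (t ℚ.* 1ℚ) ℚ.* B ≡
      evalh A B t
  collect = solve 3 (λ t A B → y⁴ t :+ t :* con 1ℚ :* y² t :* A :+ (t :* con 1ℚ) :* (t :* con 1ℚ) :* B :=
    con 1ℚ :+ t :*
        ((con (ι (+ 4)) :+ A) :+ t :*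
        ((con (ι (+ 6)) :+ (A :+ A :+ B)) :+ t :* ((con (ι (+ 4)) :+ A) :+ t :* (con 1ℚ :+ t :* con 0ℚ))))) refl

h-from-f : ∀ {n} (X : SimplicialComplex n) a b → (∀ t → fPolynomial X t ≡ fγ a b t) → IsHPolynomial X
    (hPolynomial (+ a) (+ b))
h-from-f X a b f≡ t = begin
  y ^ 4 ℚ.* evalℚ (hPolynomial (+ a) (+ b)) i
    ≡⟨ cong (y ^ 4 ℚ.*_) (evalℚ-h (+ a) (+ b) i) ⟩
  y ^ 4 ℚ.* evalh (nat a) (nat b) i
    ≡⟨ expand-h y i (nat a) (nat b) ⟩
  reversed (y ℚ.* i)
    ≡⟨ cong reversed (ℚ.*-inverseʳ y) ⟩
  reversed 1ℚ
    ≡⟨ agree t (nat a) (nat b) ⟩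
  (t ℚ.+ two) ℚ.* (t ℚ.+ two) ℚ.* ((t ℚ.+ two) ℚ.* (t ℚ.+ two)) ℚ.+
    (nat a ℚ.* ((t ℚ.+ 1ℚ) ℚ.* ((t ℚ.+ two) ℚ.* (t ℚ.+ two))) ℚ.+ nat b ℚ.* ((t ℚ.+ 1ℚ) ℚ.* (t ℚ.+ 1ℚ)))
    ≡⟨ cong₂ (λ d e → d ℚ.* d ℚ.+ (nat a ℚ.* (e ℚ.* d) ℚ.+ nat b ℚ.* (e ℚ.* e))) t²D t²w ⟨
  (t ℚ.* t ℚ.* D) ℚ.* (t ℚ.* t ℚ.* D) ℚ.+
    (nat a ℚ.* ((t ℚ.* t ℚ.* w) ℚ.* (t ℚ.* t ℚ.* D)) ℚ.+ nat b ℚ.* ((t ℚ.* t ℚ.* w) ℚ.* (t ℚ.* t ℚ.* w)))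
    ≡⟨ collect t D w (nat a) (nat b) ⟩
  t ^ 4 ℚ.* fγ a b z
    ≡⟨ cong (t ^ 4 ℚ.*_) (f≡ z) ⟨
  t ^ 4 ℚ.* fPolynomial X z ∎
  where
  open +-*-Solver renaming (Polynomial to Expr)
  y i z D w : ℚ
  y = 1ℚ ℚ.+ t
  i = ℚ.1/ y
  z = ℚ.1/ t
  D = (1ℚ ℚ.+ (z ℚ.+ z)) ℚ.* (1ℚ ℚ.+ (z ℚ.+ z))
  w = z ℚ.+ z ℚ.* z
  -- `y⁴ h(i)` written with `o` for every product `y * i`; the cancellation then consists in
  -- replacing `o` by `1` once.
  form : ℚ → ℚ → ℚ → ℚ → ℚ
  form A B y o = y ℚ.* y ℚ.* (y ℚ.* y) ℚ.+ (ι (+ 4) ℚ.+ A) ℚ.* (y ℚ.* y ℚ.* y) ℚ.* o ℚ.+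
      (ι (+ 6) ℚ.+ (A ℚ.+ A ℚ.+ B)) ℚ.* (y ℚ.* y) ℚ.* (o ℚ.* o) ℚ.+
    (ι (+ 4) ℚ.+ A) ℚ.* y ℚ.* (o ℚ.* o ℚ.* o) ℚ.+ o ℚ.* o ℚ.* (o ℚ.* o)
  formₚ : ∀ {n} → Expr n → Expr n → Expr n → Expr n → Expr n
  formₚ A B y o = y :* y :* (y :* y) :+ (con (ι (+ 4)) :+ A) :* (y :* y :* y) :* o :+
      (con (ι (+ 6)) :+ (A :+ A :+ B)) :* (y :* y) :* (o :* o) :+
    (con (ι (+ 4)) :+ A) :* y :* (o :* o :* o) :+ o :* o :* (o :* o)
  reversed : ℚ → ℚ
  reversed = form (nat a) (nat b) y
  expand-h : ∀ y i A B → y ^ 4 ℚ.* evalh A B i ≡ form A B y (y ℚ.* i)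
  expand-h = solve 4 (λ y i A B → (y :* (y :* (y :* (y :* con 1ℚ)))) :*
    (con 1ℚ :+ i :*
        ((con (ι (+ 4)) :+ A) :+ i :*
        ((con (ι (+ 6)) :+ (A :+ A :+ B)) :+ i :* ((con (ι (+ 4)) :+ A) :+ i :* (con 1ℚ :+ i :* con 0ℚ))))) :=
    formₚ A B y (y :* i)) refl
  agree : ∀ t A B → form A B (1ℚ ℚ.+ t) 1ℚ ≡ (t ℚ.+ two) ℚ.* (t ℚ.+ two) ℚ.* ((t ℚ.+ two) ℚ.* (t ℚ.+ two)) ℚ.+
    (A ℚ.* ((t ℚ.+ 1ℚ) ℚ.* ((t ℚ.+ two) ℚ.* (t ℚ.+ two))) ℚ.+ B ℚ.* ((t ℚ.+ 1ℚ) ℚ.* (t ℚ.+ 1ℚ)))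
  agree = solve 3 (λ t A B → formₚ A B (con 1ℚ :+ t) (con 1ℚ) := (t :+ con two) :* (t :+ con two) :*
      ((t :+ con two) :* (t :+ con two)) :+
    (A :* ((t :+ con 1ℚ) :* ((t :+ con two) :* (t :+ con two))) :+ B :* ((t :+ con 1ℚ) :* (t :+ con 1ℚ)))) refl
  collect : ∀ t D w A B → (t ℚ.* t ℚ.* D) ℚ.* (t ℚ.* t ℚ.* D) ℚ.+
    (A ℚ.* ((t ℚ.* t ℚ.* w) ℚ.* (t ℚ.* t ℚ.* D)) ℚ.+ B ℚ.* ((t ℚ.* t ℚ.* w) ℚ.* (t ℚ.* t ℚ.* w))) ≡ t ^ 4 ℚ.*
        (D ℚ.* D ℚ.+ (A ℚ.* (w ℚ.* D) ℚ.+ B ℚ.* (w ℚ.* w)))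
  collect = solve 5
      (λ t D w A B → (t :* t :* D) :* (t :* t :* D) :+
      (A :* ((t :* t :* w) :* (t :* t :* D)) :+ B :* ((t :* t :* w) :* (t :* t :* w))) :=
    (t :* (t :* (t :* (t :* con 1ℚ)))) :* (D :* D :+ (A :* (w :* D) :+ B :* (w :* w)))) refl
  t²D : t ℚ.* t ℚ.* D ≡ (t ℚ.+ two) ℚ.* (t ℚ.+ two)
  t²D = ≡.trans (solve 2 (λ t z → t :* t :* ((con 1ℚ :+ (z :+ z)) :* (con 1ℚ :+ (z :+ z))) :=
      (t :+ (t :* z :+ t :* z)) :* (t :+ (t :* z :+ t :* z))) refl t z)
    (cong (λ o → (t ℚ.+ (o ℚ.+ o)) ℚ.* (t ℚ.+ (o ℚ.+ o))) (ℚ.*-inverseʳ t))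
  t²w : t ℚ.* t ℚ.* w ≡ t ℚ.+ 1ℚ
  t²w = ≡.trans (solve 2 (λ t z → t :* t :* (z :+ z :* z) := t :* (t :* z) :+ (t :* z) :* (t :* z)) refl t z)
    (≡.trans (cong (λ o → t ℚ.* o ℚ.+ o ℚ.* o) (ℚ.*-inverseʳ t))
        (solve 1 (λ t → t :* con 1ℚ :+ con 1ℚ :* con 1ℚ := t :+ con 1ℚ) refl t))

-- The roots of γ(t) − t

module _ (z : ℂ) (n : ℕ) where
  private
    r s : ℚ
    r = seq (re z) n
    s = seq (im z) n

  horner-re : ∀ a p → seq (re (evalℂ (a ∷ p) z)) n ≡
              ι a ℚ.+ (r ℚ.* seq (re (evalℂ p z)) n ℚ.+ ℚ.- (s ℚ.* seq (im (evalℂ p z)) n))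
  horner-re a p = refl

  horner-im : ∀ a p → seq (im (evalℂ (a ∷ p) z)) n ≡
              0ℚ ℚ.+ (r ℚ.* seq (im (evalℂ p z)) n ℚ.+ s ℚ.* seq (re (evalℂ p z)) n)
  horner-im a p = refl

  private
    step-re : ∀ a p {P Q} → seq (re (evalℂ p z)) n ≡ P → seq (im (evalℂ p z)) n ≡ Q →
              seq (re (evalℂ (a ∷ p) z)) n ≡ ι a ℚ.+ (r ℚ.* P ℚ.+ ℚ.- (s ℚ.* Q))
    step-re a p eqP eqQ = ≡.trans (horner-re a p) (cong₂ (λ P Q → ι a ℚ.+ (r ℚ.* P ℚ.+ ℚ.- (s ℚ.* Q))) eqP eqQ)

    step-im : ∀ a p {P Q} → seq (re (evalℂ p z)) n ≡ P → seq (im (evalℂ p z)) n ≡ Q →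
              seq (im (evalℂ (a ∷ p) z)) n ≡ 0ℚ ℚ.+ (r ℚ.* Q ℚ.+ s ℚ.* P)
    step-im a p eqP eqQ = ≡.trans (horner-im a p) (cong₂ (λ P Q → 0ℚ ℚ.+ (r ℚ.* Q ℚ.+ s ℚ.* P)) eqP eqQ)

  module _ (c b a : ℤ) where
    private
      re₀ : seq (re (evalℂ (a ∷ []) z)) n ≡ ι a
      re₀ = ≡.trans (step-re a [] refl refl) (solve 3 (λ a r s → a :+ (r :* con 0ℚ :+ (:- (s :* con 0ℚ))) := a) refl
          (ι a) r s)
        where open +-*-Solver
      im₀ : seq (im (evalℂ (a ∷ []) z)) n ≡ 0ℚ
      im₀ = ≡.trans (step-im a [] refl refl)
          (solve 2 (λ r s → con 0ℚ :+ (r :* con 0ℚ :+ s :* con 0ℚ) := con 0ℚ) refl r s)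
        where open +-*-Solver
      re₁ : seq (re (evalℂ (b ∷ a ∷ []) z)) n ≡ ι b ℚ.+ r ℚ.* ι a
      re₁ = ≡.trans (step-re b (a ∷ []) re₀ im₀)
          (solve 4 (λ a b r s → b :+ (r :* a :+ (:- (s :* con 0ℚ))) := b :+ r :* a) refl (ι a) (ι b) r s)
        where open +-*-Solver
      im₁ : seq (im (evalℂ (b ∷ a ∷ []) z)) n ≡ s ℚ.* ι a
      im₁ = ≡.trans (step-im b (a ∷ []) re₀ im₀) (solve 3 (λ a r s → con 0ℚ :+ (r :* con 0ℚ :+ s :* a) := s :* a) refl
          (ι a) r s)
        where open +-*-Solver

    quadratic-re : seq (re (evalℂ (c ∷ b ∷ a ∷ []) z)) n ≡ ι c ℚ.+
        (r ℚ.* (ι b ℚ.+ r ℚ.* ι a) ℚ.+ ℚ.- (s ℚ.* (s ℚ.* ι a)))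
    quadratic-re = step-re c (b ∷ a ∷ []) re₁ im₁

    quadratic-im : seq (im (evalℂ (c ∷ b ∷ a ∷ []) z)) n ≡ 0ℚ ℚ.+ (r ℚ.* (s ℚ.* ι a) ℚ.+ s ℚ.* (ι b ℚ.+ r ℚ.* ι a))
    quadratic-im = step-im c (b ∷ a ∷ []) re₁ im₁

module _ (γ₁ γ₂ : ℤ) where
  private
    A B : ℚ
    A = ι γ₁
    B = ι γ₂
    γ : Polynomial
    γ = + 1 ∷ γ₁ ∷ γ₂ ∷ []

  -- `E` and `F` are simplified forms of the real and imaginary parts. They are compared index by
  -- index, since the ring solver works on rationals; only their vanishing is a statement about
  -- reals.
  isRoot : ∀ z {E F} →
    (∀ n → let r = seq (re z) n ; s = seq (im z) n in
      1ℚ ℚ.+ (r ℚ.* (A ℚ.+ r ℚ.* B) ℚ.+ ℚ.- (s ℚ.* (s ℚ.* B))) ℚ.+ ℚ.- r ≡ seq E n) → E ≈ 0ℝ →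
    (∀ n → let r = seq (re z) n ; s = seq (im z) n in
      0ℚ ℚ.+ (r ℚ.* (s ℚ.* B) ℚ.+ s ℚ.* (A ℚ.+ r ℚ.* B)) ℚ.+ ℚ.- s ≡ seq F n) → F ≈ 0ℝ →
    IsRootOf[ γ -t] z
  isRoot z {E} {F} E≡ E≈0 F≡ F≈0 =
    ≈-trans {re (evalℂ γ z) + - re z} {E} {0ℝ} (pointwise⇒≈ {re (evalℂ γ z) + - re z} {E} λ n →
      ≡.trans (cong (ℚ._+ ℚ.- seq (re z) n) (quadratic-re z n (+ 1) γ₁ γ₂)) (E≡ n)) E≈0 ,
    ≈-trans {im (evalℂ γ z) + - im z} {F} {0ℝ} (pointwise⇒≈ {im (evalℂ γ z) + - im z} {F} λ n →
      ≡.trans (cong (ℚ._+ ℚ.- seq (im z) n) (quadratic-im z n (+ 1) γ₁ γ₂)) (F≡ n)) F≈0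

  -- Completing the square: the two equations say that `γ(t) - t` is `B ((t - b)² - c)`. The roots
  -- are thus `b` plus or minus the square root of the rational `c`, whose sign decides whether they
  -- are real.
  module _ {b c : ℚ} (A≡ : A ≡ 1ℚ ℚ.+ ℚ.- (B ℚ.* b ℚ.+ B ℚ.* b)) (1≡ : 1ℚ ≡ B ℚ.* (b ℚ.* b ℚ.+ ℚ.- c)) where
    private
      open +-*-Solver
      scaled : ℝ → ℝ
      scaled e = fromℚ B * e
      scaled≈0 : ∀ e → e ≈ 0ℝ → scaled e ≈ 0ℝ
      scaled≈0 e e≈0 = ≈-trans {scaled e} {scaled 0ℝ} {0ℝ} (*-cong {fromℚ B} {fromℚ B} {e} {0ℝ} (≈-refl {fromℚ B}) e≈0)
        (pointwise⇒≈ {scaled 0ℝ} {0ℝ} λ _ → ℚ.*-zeroʳ B)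

    realRoot : ℂ
    realRoot = (fromℚ b + √ (fromℚ c)) +i 0ℝ

    realRoot-isRoot : 0ℚ ℚ.≤ c → IsRootOf[ γ -t] realRoot
    realRoot-isRoot 0≤c = isRoot realRoot {scaled (√ C * √ C + - C)} {0ℝ}
      (λ n → ≡.trans
          (cong₂ (λ o A → o ℚ.+ ((b ℚ.+ σ n) ℚ.* (A ℚ.+ (b ℚ.+ σ n) ℚ.* B) ℚ.+ ℚ.- (0ℚ ℚ.* (0ℚ ℚ.* B))) ℚ.+ ℚ.-
          (b ℚ.+ σ n)) 1≡ A≡)
                     (identity b c B (σ n)))
      (scaled≈0 (√ C * √ C + - C) (≈-trans {√ C * √ C + - C} {C + - C} {0ℝ}
        (+-cong {√ C * √ C} {C} { - C} { - C} (square-√ {C} (pointwise⇒≤ {0ℝ} {C} λ _ → 0≤c)) (≈-refl { - C}))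
        (pointwise⇒≈ {C + - C} {0ℝ} λ _ → ℚ.+-inverseʳ c)))
      (λ n → vanish (b ℚ.+ σ n) A B)
      (≈-refl {0ℝ})
      where
      C : ℝ
      C = fromℚ c
      σ : ℕ → ℚ
      σ n = seq (√ C) n
      identity : ∀ b c B s → B ℚ.* (b ℚ.* b ℚ.+ ℚ.- c) ℚ.+
          ((b ℚ.+ s) ℚ.* (1ℚ ℚ.+ ℚ.- (B ℚ.* b ℚ.+ B ℚ.* b) ℚ.+ (b ℚ.+ s) ℚ.* B) ℚ.+ ℚ.- (0ℚ ℚ.* (0ℚ ℚ.* B))) ℚ.+ ℚ.-
          (b ℚ.+ s)
                 ≡ B ℚ.* (s ℚ.* s ℚ.+ ℚ.- c)
      identity = solve 4
          (λ b c B s → B :* (b :* b :+ (:- c)) :+ ((b :+ s) :* (con 1ℚ :+ (:- (B :* b :+ B :* b)) :+ (b :+ s) :* B) :+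
          (:- (con 0ℚ :* (con 0ℚ :* B)))) :+ (:- (b :+ s))
                 := B :* (s :* s :+ (:- c))) refl
      vanish : ∀ x A B → 0ℚ ℚ.+ (x ℚ.* (0ℚ ℚ.* B) ℚ.+ 0ℚ ℚ.* (A ℚ.+ x ℚ.* B)) ℚ.+ ℚ.- 0ℚ ≡ 0ℚ
      vanish = solve 3 (λ x A B → con 0ℚ :+ (x :* (con 0ℚ :* B) :+ con 0ℚ :* (A :+ x :* B)) :+ (:- con 0ℚ) :=
          con 0ℚ) refl

    complexRoot : ℂ
    complexRoot = fromℚ b +i √ (fromℚ (ℚ.- c))

    complexRoot-isRoot : 0ℚ ℚ.≤ ℚ.- c → IsRootOf[ γ -t] complexRoot
    complexRoot-isRoot 0≤-c = isRoot complexRoot {scaled (C + - (√ C * √ C))} {0ℝ}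
      (λ n → ≡.trans (cong₂ (λ o A → o ℚ.+ (b ℚ.* (A ℚ.+ b ℚ.* B) ℚ.+ ℚ.- (σ n ℚ.* (σ n ℚ.* B))) ℚ.+ ℚ.- b) 1≡ A≡)
                     (identity b c B (σ n)))
      (scaled≈0 (C + - (√ C * √ C)) (≈-trans {C + - (√ C * √ C)} {C + - C} {0ℝ}
        (+-cong {C} {C} { - (√ C * √ C)} { - C} (≈-refl {C})
            (-‿cong {√ C * √ C} {C} (square-√ {C} (pointwise⇒≤ {0ℝ} {C} λ _ → 0≤-c))))
        (pointwise⇒≈ {C + - C} {0ℝ} λ _ → ℚ.+-inverseʳ (ℚ.- c))))
      (λ n → ≡.trans (cong (λ A → 0ℚ ℚ.+ (b ℚ.* (σ n ℚ.* B) ℚ.+ σ n ℚ.* (A ℚ.+ b ℚ.* B)) ℚ.+ ℚ.- σ n) A≡)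
          (vanish b B (σ n)))
      (≈-refl {0ℝ})
      where
      C : ℝ
      C = fromℚ (ℚ.- c)
      σ : ℕ → ℚ
      σ n = seq (√ C) n
      identity : ∀ b c B s → B ℚ.* (b ℚ.* b ℚ.+ ℚ.- c) ℚ.+ (b ℚ.* (1ℚ ℚ.+ ℚ.- (B ℚ.* b ℚ.+ B ℚ.* b) ℚ.+ b ℚ.* B) ℚ.+ ℚ.-
          (s ℚ.* (s ℚ.* B))) ℚ.+ ℚ.- b
                 ≡ B ℚ.* (ℚ.- c ℚ.+ ℚ.- (s ℚ.* s))
      identity = solve 4
          (λ b c B s → B :* (b :* b :+ (:- c)) :+ (b :* (con 1ℚ :+ (:- (B :* b :+ B :* b)) :+ b :* B) :+
          (:- (s :* (s :* B)))) :+ (:- b)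
                 := B :* ((:- c) :+ (:- (s :* s)))) refl
      vanish : ∀ b B s → 0ℚ ℚ.+ (b ℚ.* (s ℚ.* B) ℚ.+ s ℚ.* (1ℚ ℚ.+ ℚ.- (B ℚ.* b ℚ.+ B ℚ.* b) ℚ.+ b ℚ.* B)) ℚ.+ ℚ.- s ≡
          0ℚ
      vanish = solve 3 (λ b B s → con 0ℚ :+ (b :* (s :* B) :+ s :* (con 1ℚ :+ (:- (B :* b :+ B :* b)) :+ b :* B)) :+
          (:- s) := con 0ℚ) refl

√-nonzero : ∀ {q} → 0ℚ ℚ.< q → ¬ (√ (fromℚ q) ≈ 0ℝ)
√-nonzero {q} 0<q √≈0 = refute (ev-now (≈⇒Close {C} {0ℝ} C≈0 0<q))
  where
  C : ℝ
  C = fromℚ q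
  C≈0 : C ≈ 0ℝ
  C≈0 = ≈-trans {C} {√ C * √ C} {0ℝ} (≈-sym {√ C * √ C} {C} (square-√ {C} (pointwise⇒≤ {0ℝ} {C} λ _ → ℚ.<⇒≤ 0<q)))
    (≈-trans {√ C * √ C} {0ℝ * 0ℝ} {0ℝ} (*-cong {√ C} {0ℝ} {√ C} {0ℝ} √≈0 √≈0) (pointwise⇒≈ {0ℝ * 0ℝ} {0ℝ} λ _ → refl))
  refute : ∃ (λ (n : ℕ) → Near q q 0ℚ) → ⊥
  refute (_ , near) = ℚ.<-irrefl refl (subst (q ℚ.<_) (ℚ.+-identityˡ q) (Near.below near))

-- One index suffices. If `δ n` is smaller than the gap `e`, then `σ + δ n` lies below `- b`, while
-- its square already exceeds `c`.
negative-root : ∀ b c → 0ℚ ℚ.≤ c → fromℚ b + √ (fromℚ c) < 0ℝ → b ℚ.< 0ℚ × c ℚ.< b ℚ.* b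
negative-root b c 0≤c (e , 0<e , lt) = conclude (ev-now (ev-both lt (δ-small 0<e)))
  where
  open +-*-Solver
  conclude : ∃ (λ n → b ℚ.+ seq (√ (fromℚ c)) n ℚ.+ e ℚ.< 0ℚ × δ n ℚ.< e) → b ℚ.< 0ℚ × c ℚ.< b ℚ.* b
  conclude (n , neg , small) = b<0 , ℚ.<-trans (subst (ℚ._< (σ ℚ.+ δ n) ℚ.* (σ ℚ.+ δ n)) (ℚ.0≤p⇒∣p∣≡p 0≤c)
      (proj₂ (proj₂ root-σ)))
    (subst ((σ ℚ.+ δ n) ℚ.* (σ ℚ.+ δ n) ℚ.<_) (solve 1 (λ b → (:- b) :* (:- b) := b :* b) refl b)
        (square-mono-< (ℚ.<⇒≤ 0<σ+δ) σ+δ<-b))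
    where
    σ : ℚ
    σ = seq (√ (fromℚ c)) n
    root-σ : IsRoot n ℚ.∣ c ∣ σ
    root-σ = √-isRoot (fromℚ c) n
    0<σ+δ : 0ℚ ℚ.< σ ℚ.+ δ n
    0<σ+δ = ℚ.≤-<-trans (proj₁ root-σ) (<+ (0<δ n))
    σ+δ<-b : σ ℚ.+ δ n ℚ.< ℚ.- b
    σ+δ<-b = <-by (ℚ.+-mono-< neg small)
        (solve 4 (λ b s e d → (:- b) :- (s :+ d) := (con 0ℚ :+ e) :- ((b :+ s :+ e) :+ d)) refl b σ e (δ n))
    b<0 : b ℚ.< 0ℚ
    b<0 = <-by (ℚ.<-trans 0<σ+δ σ+δ<-b) (solve 1 (λ b → con 0ℚ :- b := (:- b) :- con 0ℚ) refl b)

NegativeRoots : ℤ → ℤ → Set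
NegativeRoots γ₁ γ₂ = ∀ z → IsRootOf[ + 1 ∷ γ₁ ∷ γ₂ ∷ [] -t] z → im z ≈ 0ℝ × re z < 0ℝ

-- If `γ₁ < 1`, then `1 / (1 - γ₁)` is a positive root. For `γ₁ = 1` the polynomial is the constant
-- `1` without roots, so the inequality cannot be strict.
linear-case : ∀ γ₁ → NegativeRoots γ₁ (+ 0) → 1ℚ ℚ.≤ ι γ₁
linear-case γ₁ roots = ℚ.≮⇒≥ λ A<1 → refute A<1
  where
  open +-*-Solver
  A : ℚ
  A = ι γ₁
  refute : A ℚ.< 1ℚ → ⊥
  refute A<1 = absurd (proj₂ (roots z (isRoot γ₁ (+ 0) z {0ℝ} {0ℝ}
      (λ _ → ≡.trans
          (solve 2 (λ i A → con 1ℚ :+ (i :* (A :+ i :* con 0ℚ) :+ (:- (con 0ℚ :* (con 0ℚ :* con 0ℚ)))) :+ (:- i) :=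
          con 1ℚ :- (con 1ℚ :- A) :* i) refl i A)
        (≡.trans (cong (λ o → 1ℚ ℚ.- o) Ni≡1) (ℚ.+-inverseʳ 1ℚ)))
      (≈-refl {0ℝ})
      (λ _ → solve 2 (λ i A → con 0ℚ :+ (i :* (con 0ℚ :* con 0ℚ) :+ con 0ℚ :* (A :+ i :* con 0ℚ)) :+ (:- con 0ℚ) :=
          con 0ℚ) refl i A)
      (≈-refl {0ℝ}))))
    where
    0<N : 0ℚ ℚ.< 1ℚ ℚ.- A
    0<N = <-by A<1 (solve 1 (λ A → (con 1ℚ :- A) :- con 0ℚ := con 1ℚ :- A) refl A)
    reciprocal : ∃ λ i → 0ℚ ℚ.< i × (1ℚ ℚ.- A) ℚ.* i ≡ 1ℚ
    reciprocal = divide 0<N (ℚ.positive⁻¹ 1ℚ)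
    i : ℚ
    i = proj₁ reciprocal
    Ni≡1 : (1ℚ ℚ.- A) ℚ.* i ≡ 1ℚ
    Ni≡1 = proj₂ (proj₂ reciprocal)
    z : ℂ
    z = fromℚ i +i 0ℝ
    absurd : fromℚ i < 0ℝ → ⊥
    absurd (e , 0<e , lt) = ℚ.<-irrefl refl (ℚ.<-trans (0<e+f (proj₁ (proj₂ reciprocal)) 0<e) (proj₂ (ev-now lt)))

quadratic-case : ∀ γ₁ γ₂ → ι γ₂ ≢ 0ℚ → NegativeRoots γ₁ γ₂ →
  1ℚ ℚ.< ι γ₁ × 0ℚ ℚ.< ι γ₂ × ι (+ 4) ℚ.* ι γ₂ ℚ.≤ (ι γ₁ ℚ.- 1ℚ) ℚ.* (ι γ₁ ℚ.- 1ℚ)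
quadratic-case γ₁ γ₂ B≢0 roots = 1<A , 0<B , bound
  where
  open +-*-Solver
  instance
    B-nonZero : ℚ.NonZero (ι γ₂)
    B-nonZero = ℚ.≢-nonZero B≢0
  A B i b c : ℚ
  A = ι γ₁
  B = ι γ₂
  i = ℚ.1/ B
  -- `b` is the midpoint of the two roots and `1 / B` their product. If `c` were negative there
  -- would be a non-real root; otherwise the root `b + √ c` is negative, which gives `b < 0` and
  -- `c < b * b`, that is `1 / B > 0`.
  b = ½ ℚ.* (1ℚ ℚ.- A) ℚ.* i
  c = b ℚ.* b ℚ.- i
  Bi≡1 : B ℚ.* i ≡ 1ℚ
  Bi≡1 = ℚ.*-inverseʳ B
  A≡ : A ≡ 1ℚ ℚ.+ ℚ.- (B ℚ.* b ℚ.+ B ℚ.* b)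
  A≡ = sym (≡.trans
      (solve 3 (λ A B i → con 1ℚ :+ (:- (B :* (con ½ :* (con 1ℚ :- A) :* i) :+ B :* (con ½ :* (con 1ℚ :- A) :* i))) :=
      con 1ℚ :- (con 1ℚ :- A) :* (B :* i)) refl A B i)
    (≡.trans (cong (λ o → 1ℚ ℚ.- (1ℚ ℚ.- A) ℚ.* o) Bi≡1)
        (solve 1 (λ A → con 1ℚ :- (con 1ℚ :- A) :* con 1ℚ := A) refl A)))
  1≡ : 1ℚ ≡ B ℚ.* (b ℚ.* b ℚ.+ ℚ.- c)
  1≡ = sym (≡.trans (solve 3 (λ B b i → B :* (b :* b :+ (:- (b :* b :- i))) := B :* i) refl B b i) Bi≡1)
  0≤c : 0ℚ ℚ.≤ c
  0≤c = ℚ.≮⇒≥ λ c<0 → √-nonzero (ℚ.neg-antimono-< c<0)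
    (proj₁ (roots (complexRoot γ₁ γ₂ A≡ 1≡) (complexRoot-isRoot γ₁ γ₂ A≡ 1≡ (ℚ.<⇒≤ (ℚ.neg-antimono-< c<0)))))
  negative : b ℚ.< 0ℚ × c ℚ.< b ℚ.* b
  negative = negative-root b c 0≤c (proj₂ (roots (realRoot γ₁ γ₂ A≡ 1≡) (realRoot-isRoot γ₁ γ₂ A≡ 1≡ 0≤c)))
  0<i : 0ℚ ℚ.< i
  0<i = <-by (proj₂ negative) (solve 2 (λ b i → i :- con 0ℚ := b :* b :- (b :* b :- i)) refl b i)
  0<B : 0ℚ ℚ.< B
  0<B = ℚ.positive⁻¹ B {{ℚ.pos⇒1/pos B {{B-nonZero}} {{ℚ.positive 0<i}}}}
  0<-b : 0ℚ ℚ.< ℚ.- b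
  0<-b = ℚ.neg-antimono-< (proj₁ negative)
  A-1≡ : A ℚ.- 1ℚ ≡ B ℚ.* (ℚ.- b) ℚ.+ B ℚ.* (ℚ.- b)
  A-1≡ = ≡.trans (cong (ℚ._- 1ℚ) A≡)
      (solve 2 (λ B b → (con 1ℚ :+ (:- (B :* b :+ B :* b))) :- con 1ℚ := B :* (:- b) :+ B :* (:- b)) refl B b)
  1<A : 1ℚ ℚ.< A
  1<A = <-by (0<e+f (0<e*f 0<B 0<-b) (0<e*f 0<B 0<-b)) (≡.trans A-1≡ (sym (ℚ.+-identityʳ _)))
  bound : ι (+ 4) ℚ.* B ℚ.≤ (A ℚ.- 1ℚ) ℚ.* (A ℚ.- 1ℚ)
  -- The difference of the two sides is `4 B² c`.
  bound = ≤-by (0≤e*f (0≤e*f (ι-mono-≤ {+ 0} {+ 4} (ℤ.+≤+ ℕ.z≤n)) (0≤square B)) 0≤c) (≡.trans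
    (cong₂ (λ d e → d ℚ.* d ℚ.- ι (+ 4) ℚ.* e) A-1≡ (≡.trans (sym (ℚ.*-identityʳ B)) (cong (B ℚ.*_) 1≡)))
    (solve 3 (λ B b c → (B :* (:- b) :+ B :* (:- b)) :* (B :* (:- b) :+ B :* (:- b)) :- con (ι (+ 4)) :*
        (B :* (B :* (b :* b :+ (:- c)))) :=
      con (ι (+ 4)) :* (B :* B) :* c :- con 0ℚ) refl B b c))

nat-cancel-≤ : ∀ {m n} → nat m ℚ.≤ nat n → m ℕ.≤ n
nat-cancel-≤ {m} {n} le = ℕ.≮⇒≥ λ n<m → ℚ.<-irrefl refl (ℚ.≤-<-trans le (ι-mono-< (ℤ.+<+ n<m)))

1≤⇒suc : ∀ γ → 1ℚ ℚ.≤ ι γ → ∃ λ a → γ ≡ + suc a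
1≤⇒suc (+ zero)  1≤γ = contradiction (ℚ.<-≤-trans (ℚ.positive⁻¹ 1ℚ) 1≤γ) (ℚ.<-irrefl refl)
1≤⇒suc (+ suc a) _   = a , refl
1≤⇒suc -[1+ a ]  1≤γ = contradiction (ℚ.<-trans (ℚ.<-≤-trans (ℚ.positive⁻¹ 1ℚ) 1≤γ) (ι-mono-< { -[1+ a ]} {+ 0} ℤ.-<+))
    (ℚ.<-irrefl refl)

negativeRoots⇒bounds : ∀ γ₁ γ₂ → NegativeRoots γ₁ γ₂ → ∃₂ λ a g → γ₁ ≡ + suc a × γ₂ ≡ + g × 4 ℕ.* g ℕ.≤ a ℕ.* a
negativeRoots⇒bounds γ₁ γ₂ roots with ι γ₂ ℚ.≟ 0ℚ
negativeRoots⇒bounds γ₁ (+ zero) roots | _ = let a , eq = 1≤⇒suc γ₁ (linear-case γ₁ roots) in a , 0 , eq , refl , ℕ.z≤n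
negativeRoots⇒bounds γ₁ (+ suc k) roots | yes eq = contradiction eq
    (ℚ.<⇒≢ (ι-mono-< {+ 0} {+ suc k} (ℤ.+<+ (ℕ.s≤s ℕ.z≤n))) ∘ sym)
negativeRoots⇒bounds γ₁ -[1+ k ] roots | yes eq = contradiction eq (ℚ.<⇒≢ (ι-mono-< { -[1+ k ]} {+ 0} ℤ.-<+))
negativeRoots⇒bounds γ₁ -[1+ k ] roots | no B≢0 = contradiction
  (ℚ.<-trans (proj₁ (proj₂ (quadratic-case γ₁ -[1+ k ] B≢0 roots))) (ι-mono-< { -[1+ k ]} {+ 0} ℤ.-<+))
      (ℚ.<-irrefl refl)
negativeRoots⇒bounds γ₁ (+ suc k) roots | no B≢0 =
  let 1<A , _ , bound = quadratic-case γ₁ (+ suc k) B≢0 roots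
      a , eq = 1≤⇒suc γ₁ (ℚ.<⇒≤ 1<A)
      A-1≡ : ι γ₁ ℚ.- 1ℚ ≡ nat a
      A-1≡ = ≡.trans (cong (λ γ → ι γ ℚ.- 1ℚ) eq) (≡.trans (cong (ℚ._- 1ℚ) (nat-suc a)) (cancel (nat a)))
  in a , suc k , eq , refl , nat-cancel-≤ (subst₂ ℚ._≤_
       (sym (≡.trans (cong ι (ℤ.pos-* 4 (suc k))) (ι-homo-* (+ 4) (+ suc k))))
       (≡.trans (cong₂ ℚ._*_ A-1≡ A-1≡) (sym (≡.trans (cong ι (ℤ.pos-* a a)) (ι-homo-* (+ a) (+ a)))))
       bound)
  where
  open +-*-Solver
  cancel : ∀ q → 1ℚ ℚ.+ q ℚ.- 1ℚ ≡ q
  cancel = solve 1 (λ q → con 1ℚ :+ q :- con 1ℚ := q) refl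

theorem3p2p1 : (γ₁ γ₂ : ℤ) → let γ = + 1 ∷ γ₁ ∷ γ₂ ∷ [] in
    (∀ z → IsRootOf[ γ -t] z → im z ≈ 0ℝ × re z < 0ℝ) →
    Σ[ h ∈ Polynomial ] Is[1+t]⁴p[t/[1+t]²] h γ ×
    (Σ[ n ∈ ℕ ] Σ[ X ∈ SimplicialComplex n ] Flag X × TriangulatesS³ X × IsHPolynomial X h)
theorem3p2p1 γ₁ γ₂ roots = conclude (negativeRoots⇒bounds γ₁ γ₂ roots)
  where
  conclude : (∃₂ λ a g → γ₁ ≡ + suc a × γ₂ ≡ + g × 4 ℕ.* g ℕ.≤ a ℕ.* a) → _
  conclude (a , g , refl , refl , 4g≤a²) =
    let _ , _ , st = realize a g 4g≤a²
        open State st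
    in hPolynomial (+ suc a) (+ g) , h-from-γ (+ suc a) (+ g) , size , cliqueComplex graph , cliqueComplex-flag graph ,
       triangulates , h-from-f (cliqueComplex graph) (suc a) g (λ t → ≡.trans (fPolynomial≡K graph t) (K-all t))
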